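{- Let $R$ be an interaction net and let $\mathcal{R}_1,\mathcal{R}_2$ be two interaction rules applicable on $R$ on distinct redexes, with reductions $R \xrightarrow{\mathcal{R}_1} R_1$ and $R \xrightarrow{\mathcal{R}_2} R_2$ performed on these distinct redexes. Assume that every port (element of the carrier) belonging both to $R_1$ and to $R_2$ also belongs to $R$. Then there exists an interaction net $R'$ such that $R_1 \xrightarrow{\mathcal{R}_2} R'$ and $R_2 \xrightarrow{\mathcal{R}_1} R'$.
   Context: **Partial injections.** A partial injection $f$ is a bijection from a subset $\mathrm{dom}(f)\subseteq\mathbb{N}$ onto a subset $\mathrm{codom}(f)\subseteq\mathbb{N}$; $f:A\twoheadrightarrow B$ means $\mathrm{dom}(f)=A$, $\mathrm{codom}(f)=B$; $f^\star$ is the inverse; $0$ is the empty one; products denote composition of partial functions ($(gf)(x)=g(f(x))$ where defined). $f,g$ are disjoint if their domains are disjoint and their codomains are disjoint; then $f+g$ is their union. A partial permutation is a partial injection with $\mathrm{dom}=\mathrm{codom}$. A $w$-permutation is an involutive partial permutation of finite domain. **Execution.** For $f:A\uplus B\twoheadrightarrow C\uplus D$ and $g:D\twoheadrightarrow B$ with finite domains, $\mathrm{Ex}(f,g):A\twoheadrightarrow C$ sends $x\in A$ to $f(gf)^k(x)$, where $k$ is the unique integer $\ge 0$ with $f(gf)^k(x)\in C$. **Ex-composition.** Let $\sigma,\tau$ be disjoint $w$-permutations and $f$ a partial injection with $\mathrm{dom}(f)\subseteq\mathrm{dom}(\sigma)$, $\mathrm{codom}(f)\subseteq\mathrm{dom}(\tau)$.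 Put $\sigma\leftrightsquigarrow^f_0\tau=\mathrm{Ex}(\sigma+\tau,f+f^\star)$, a $w$-permutation of domain $(\mathrm{dom}(\sigma)-\mathrm{dom}(f))\uplus(\mathrm{dom}(\tau)-\mathrm{codom}(f))$. For each $x\in\mathrm{dom}(f)$ such that $(f^\star\tau f\sigma)^n(x)=x$ for some $n\ge1$, let $O_x=\{(f^\star\tau f\sigma)^i(x): i\in\mathbb{N}\}$ and $O'_x=\{(f\sigma f^\star\tau)^i(f\sigma(x)): i\in\mathbb{N}\}$; $O_x\cup O'_x$ is called a double orbit. Let $Q$ be the set of minima of all double orbits. The full Ex-composition $\sigma\leftrightsquigarrow^f\tau$ has domain $\mathrm{dom}(\sigma\leftrightsquigarrow^f_0\tau)\uplus Q$, agrees with $\sigma\leftrightsquigarrow^f_0\tau$ on its domain, and fixes every element of $Q$. **Interaction nets.** Fix a countable set $\mathcal{S}$ of symbols and an arity function $\mathrm{ar}:\mathcal{S}\to\mathbb{N}$. An interaction net is a pair $R=(\sigma_w,\sigma_c)$ where $\sigma_w$ is a $w$-permutation (its domain is the carrier of $R$, its fixed points are the loops, its non-fixed points form the set $P(R)$, its orbits of size 2 are the wires), and $\sigma_c$ is a partial permutation whose domain $P_c(R)$ is contained in $P(R)$, such that each orbit $o$ of $\sigma_c$ (a cell) comes with a chosen element of $o$ (its principal port) and a label $l(o)\in\mathcal{S}$ with $|o|=\mathrm{ar}(l(o))+1$. Free ports: $P_f(R)=P(R)-P_c(R)$. Integers in the carrier are called ports. A renaming $\alpha$ of $R$ is an isomorphism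 of $R$ onto another net $\alpha(R)$: a bijection of carriers commuting with the wire permutations and with the cell permutations, and preserving principal ports and labels. **Gluing, contexts.** For nets $R=(\sigma_w,\sigma_c)$, $R'=(\sigma'_w,\sigma'_c)$ with disjoint carriers and a partial injection $f$ with $\mathrm{dom}(f)\subseteq P_f(R)$, $\mathrm{codom}(f)\subseteq P_f(R')$, the gluing is $R\leftrightsquigarrow^f R'=(\sigma_w\leftrightsquigarrow^f\sigma'_w,\ \sigma_c+\sigma'_c)$, where cells keep their principal ports and labels. An interface $I$ of $R$ is a subset of $P_f(R)$ with a linear order; its size is its cardinality; it is canonical if it contains all free ports. A context $R^I$ is a net with an interface. For contexts $R^I$, $R'^{I'}$ with interfaces of the same size and disjoint carriers, $R^I\leftrightsquigarrow R'^{I'}$ denotes $R\leftrightsquigarrow^{\rho}R'$, where $\rho$ is the unique order-preserving bijection $I\to I'$. **Rules and reduction.** An interaction rule for symbols $(s_1,s_2)$, with $n=\mathrm{ar}(s_1)$ and $m=\mathrm{ar}(s_2)$, is a couple $\mathcal{R}=(R_r^{I_r},R_p^{I_p})$ of contexts, where $R_r$ has wires $(b\ c)(a_1\ b_1)\dots(a_n\ b_n)(c_1\ d_1)\dots(c_m\ d_m)$ and exactly two cells $(b\ b_1\ \dots\ b_n)$ of symbol $s_1$ with principal port $b$, and $(c\ c_1\ \dots\ c_m)$ of symbol $s_2$ with principal port $c$ (all these integers distinct), $R_p$ is a net, and $I_r,I_p$ are both canonical and of the same size. Reduction by $\mathcal{R}$ is the binary relation on nets: $S\xrightarrow{\mathcal{R}}S'$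 iff there are a context $X^J$ and renamings $\alpha$ of $R_r$ and $\beta$ of $R_p$ such that $S=X^J\leftrightsquigarrow\alpha(R_r)^{\alpha(I_r)}$ and $S'=X^J\leftrightsquigarrow\beta(R_p)^{\beta(I_p)}$. The redex of such a step is the pair of cells of $\alpha(R_r)$ in $S$ (linked by their principal ports); two steps from the same net are on distinct redexes if these pairs of cells are different. -}

module Defs where

open import Data.Nat.Base using (ℕ; zero; suc; _≤_)
open import Data.List.Base using (List; []; _∷_; _++_; _∷ʳ_; length; map; zip)
open import Data.List.Membership.Propositional using () renaming (_∈_ to _∈ˡ_)
open import Data.List.Relation.Unary.All using (All)
open import Data.List.Relation.Unary.Unique.Propositional using (Unique)
open import Data.Product.Base using (∃; _×_; _,_)
open import Data.Sum.Base using (_⊎_)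
open import Data.Vec.Base using (Vec; toList)
open import Function.Base using (flip)
open import Function.Bundles using (_⇔_; _↣_)
open import Level using (0ℓ)
open import Relation.Binary.Construct.Composition using () renaming (_;_ to _⨟_)
open import Relation.Binary.Construct.Union using () renaming (_∪_ to _⊕_)
open import Relation.Binary.Core using (Rel; REL) renaming (_⇔_ to _≗ᴳ_)
open import Relation.Binary.PropositionalEquality.Core using (_≡_)
open import Relation.Nullary.Negation.Core using (¬_)
open import Relation.Unary using (Pred; _∈_; _∉_; _⊆_; _≐_; _∪_)

------------------------------------------------------------------------
-- Partial injections

-- A partial function on ℕ is given by its graph: `f x y` says that f is
-- defined at x with value y.  The composite "first f, then g" (gf in
-- applicative notation) is the library's `f ⨟ g`, the sum of disjoint
-- partial injections is the union `f ⊕ g` of graphs, and equality of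
-- partial functions is equality `f ≗ᴳ g` of graphs.

Graph : Set₁
Graph = Rel ℕ 0ℓ

dom codom : Graph → Pred ℕ 0ℓ
dom   f x = ∃ λ y → f x y
codom f y = ∃ λ x → f x y

infix 10 _⋆

_⋆ : Graph → Graph
f ⋆ = flip f

infixl 10 _^_

_^_ : Graph → ℕ → Graph
f ^ zero  = _≡_
f ^ suc n = (f ^ n) ⨟ f

record IsPartialInjection (f : Graph) : Set where
  field
    functional : ∀ {x y z} → f x y → f x z → y ≡ z
    injective  : ∀ {x y z} → f x z → f y z → x ≡ y

record IsPartialPermutation (σ : Graph) : Set where
  field
    isPartialInjection : IsPartialInjection σ
    dom≐codom          : dom σ ≐ codom σ

  open IsPartialInjection isPartialInjection public

Finite : Pred ℕ 0ℓ → Set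
Finite P = ∃ λ (xs : List ℕ) → ∀ x → x ∈ P ⇔ x ∈ˡ xs

record IsWPermutation (σ : Graph) : Set where
  field
    isPartialPermutation : IsPartialPermutation σ
    involutive           : ∀ {x y} → (σ ⨟ σ) x y → x ≡ y
    finite               : Finite (dom σ)

  open IsPartialPermutation isPartialPermutation public

Disjoint : Pred ℕ 0ℓ → Pred ℕ 0ℓ → Set
Disjoint P Q = ∀ {x} → x ∈ P → x ∉ Q

Orbit : Graph → ℕ → Pred ℕ 0ℓ
Orbit σ x y = ∃ λ i → (σ ^ i) x y

HasSize : Pred ℕ 0ℓ → ℕ → Set
HasSize P n =
  ∃ λ (xs : List ℕ) → Unique xs × length xs ≡ n × (∀ x → x ∈ P ⇔ x ∈ˡ xs)

-- The cyclic permutation (x₁ x₂ … xₖ).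
cycle : List ℕ → Graph
cycle []       x y = (x , y) ∈ˡ []
cycle (z ∷ zs) x y = (x , y) ∈ˡ zip (z ∷ zs) (zs ∷ʳ z)

-- The product of transpositions (x₁ y₁) … (xₖ yₖ).
transpositions : List (ℕ × ℕ) → Graph
transpositions ps x y = (x , y) ∈ˡ ps ⊎ (y , x) ∈ˡ ps

------------------------------------------------------------------------
-- Execution and Ex-composition

-- For f : A ⊎ B ↠ C ⊎ D and g : D ↠ B, membership in A (resp. C) is
-- membership in dom f (resp. codom f) but not in B = codom g (resp.
-- D = dom g).  The value at x is f(gf)ᵏ(x) for the k that lands in C.
Ex : Graph → Graph → Graph
Ex f g x y = x ∉ codom g × y ∉ dom g × ∃ λ k → ((f ⨟ g) ^ k ⨟ f) x y

infix 8 _↭₀[_]_ _↭[_]_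

_↭₀[_]_ : Graph → Graph → Graph → Graph
σ ↭₀[ f ] τ = Ex (σ ⊕ τ) (f ⊕ f ⋆)

IsMinimumOf : ℕ → Pred ℕ 0ℓ → Set
IsMinimumOf q P = q ∈ P × (∀ {y} → y ∈ P → q ≤ y)

module _ (σ f τ : Graph) where

  -- f⋆τfσ
  round : Graph
  round = σ ⨟ f ⨟ τ ⨟ f ⋆

  -- fσf⋆τ
  round′ : Graph
  round′ = τ ⨟ f ⋆ ⨟ σ ⨟ f

  Recurrent : Pred ℕ 0ℓ
  Recurrent x = x ∈ dom f × ∃ λ n → 1 ≤ n × (round ^ n) x x

  -- Oₓ ∪ O′ₓ, a double orbit when x is recurrent
  O∪O′ : ℕ → Pred ℕ 0ℓ
  O∪O′ x = Orbit round x ∪ λ y → ∃ λ z → (σ ⨟ f) x z × Orbit round′ z y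

  -- The set Q of minima of double orbits.
  Minima : Pred ℕ 0ℓ
  Minima q = ∃ λ x → x ∈ Recurrent × IsMinimumOf q (O∪O′ x)

_↭[_]_ : Graph → Graph → Graph → Graph
σ ↭[ f ] τ = (σ ↭₀[ f ] τ) ⊕ λ x y → x ∈ Minima σ f τ × x ≡ y

------------------------------------------------------------------------
-- Interaction nets

record Signature : Set₁ where
  field
    Symbol    : Set
    countable : Symbol ↣ ℕ
    ar        : Symbol → ℕ

module Nets (𝕊 : Signature) where

  open Signature 𝕊 public

  -- `label x s` says that port x belongs to a cell with label s.
  record RawNet : Set₁ where
    field
      wire      : Graph
      cell      : Graph
      principal : Pred ℕ 0ℓ
      label     : REL ℕ Symbol 0ℓ

    carrier : Pred ℕ 0ℓ
    carrier = dom wire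

    P : Pred ℕ 0ℓ
    P x = x ∈ carrier × ¬ wire x x

    P-c : Pred ℕ 0ℓ
    P-c = dom cell

    P-f : Pred ℕ 0ℓ
    P-f x = x ∈ P × x ∉ P-c

  open RawNet

  -- Principal ports and labels are attached to orbits of the cell
  -- permutation: each orbit contains exactly one principal port, and its
  -- elements share exactly one label.  Finiteness of P-c follows
  -- classically from P-c ⊆ P; constructively it amounts to decidability of
  -- being a cell port.
  record IsNet (R : RawNet) : Set where
    field
      wire-isWPermutation       : IsWPermutation (wire R)
      cell-isPartialPermutation : IsPartialPermutation (cell R)
      cell-finite               : Finite (P-c R)
      P-c⊆P                     : P-c R ⊆ P R
      principal⊆P-c             : principal R ⊆ P-c R
      principal-exists          : ∀ {x} → x ∈ P-c R →
                                  ∃ λ p → p ∈ Orbit (cell R) x × p ∈ principal R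
      principal-unique          : ∀ {p q} → p ∈ principal R → q ∈ principal R →
                                  q ∈ Orbit (cell R) p → p ≡ q
      label-dom                 : ∀ x → x ∈ P-c R ⇔ (∃ λ s → label R x s)
      label-functional          : ∀ {x s t} → label R x s → label R x t → s ≡ t
      label-orbit               : ∀ {x y s} → y ∈ Orbit (cell R) x →
                                  label R x s → label R y s
      label-arity               : ∀ {x s} → label R x s →
                                  HasSize (Orbit (cell R) x) (suc (ar s))

  record Net : Set₁ where
    field
      raw   : RawNet
      isNet : IsNet raw

    open RawNet raw public
    open IsNet isNet public

  infix 4 _≈_

  record _≈_ (R S : RawNet) : Set where
    field
      wire-≈      : wire R ≗ᴳ wire S
      cell-≈      : cell R ≗ᴳ cell S
      principal-≈ : principal R ≐ principal S
      label-≈     : label R ≗ᴳ label S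

  -- `to` is the bijection of carriers; its values off the carrier of R are
  -- irrelevant.
  record Renaming (R S : RawNet) : Set where
    field
      to            : ℕ → ℕ
      to-carrier    : ∀ {x} → x ∈ carrier R → to x ∈ carrier S
      to-injective  : ∀ {x y} → x ∈ carrier R → y ∈ carrier R → to x ≡ to y → x ≡ y
      to-surjective : ∀ {y} → y ∈ carrier S → ∃ λ x → x ∈ carrier R × to x ≡ y
      to-wire       : ∀ {x y} → x ∈ carrier R → y ∈ carrier R →
                      wire R x y ⇔ wire S (to x) (to y)
      to-cell       : ∀ {x y} → x ∈ carrier R → y ∈ carrier R →
                      cell R x y ⇔ cell S (to x) (to y)
      to-principal  : ∀ {x} → x ∈ carrier R → x ∈ principal R ⇔ to x ∈ principal S
      to-label      : ∀ {x s} → x ∈ carrier R → label R x s ⇔ label S (to x) s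

  ----------------------------------------------------------------------
  -- Gluing and contexts

  -- The gluing is the componentwise construction on the underlying data; it
  -- is only ever compared, up to `_≈_`, with data of a `Net`.
  infix 8 _↭ⁿ[_]_

  _↭ⁿ[_]_ : RawNet → Graph → RawNet → RawNet
  R ↭ⁿ[ f ] S = record
    { wire      = wire R ↭[ f ] wire S
    ; cell      = cell R ⊕ cell S
    ; principal = principal R ∪ principal S
    ; label     = label R ⊕ label S
    }

  -- A linearly ordered finite set of ports is given by its increasing
  -- enumeration, a duplicate-free list.
  record IsInterface (R : RawNet) (I : List ℕ) : Set where
    field
      unique : Unique I
      free   : All (P-f R) I

  Canonical : RawNet → List ℕ → Set
  Canonical R I = ∀ {x} → x ∈ P-f R → x ∈ˡ I

  record Context : Set₁ where
    field
      net         : Net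
      interface   : List ℕ
      isInterface : IsInterface (Net.raw net) interface

    open Net net public

  -- The order-preserving bijection between interfaces of the same size.
  matching : List ℕ → List ℕ → Graph
  matching I J x y = (x , y) ∈ˡ zip I J

  -- `GluesTo T R I S J` says that Rᴵ ↭ Sᴶ is defined and equal to T.
  record GluesTo (T R : RawNet) (I : List ℕ) (S : RawNet) (J : List ℕ) : Set where
    field
      same-size : length I ≡ length J
      disjoint  : Disjoint (carrier R) (carrier S)
      glued     : T ≈ R ↭ⁿ[ matching I J ] S

  ----------------------------------------------------------------------
  -- Rules and reduction

  record Rule (s₁ s₂ : Symbol) : Set₁ where
    field
      R-r R-p : Context
      b c     : ℕ
      as bs   : Vec ℕ (ar s₁)
      cs ds   : Vec ℕ (ar s₂)

    cell₁ : List ℕ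
    cell₁ = b ∷ toList bs

    cell₂ : List ℕ
    cell₂ = c ∷ toList cs

    field
      distinct    : Unique (cell₁ ++ cell₂ ++ toList as ++ toList ds)
      r-wire      : Context.wire R-r ≗ᴳ
                    transpositions ((b , c) ∷ zip (toList as) (toList bs)
                                           ++ zip (toList cs) (toList ds))
      r-cell      : Context.cell R-r ≗ᴳ cycle cell₁ ⊕ cycle cell₂
      r-principal : ∀ x → x ∈ Context.principal R-r ⇔ (x ≡ b ⊎ x ≡ c)
      r-label     : ∀ x s → Context.label R-r x s ⇔
                    ((x ∈ˡ cell₁ × s ≡ s₁) ⊎ (x ∈ˡ cell₂ × s ≡ s₂))
      r-canonical : Canonical (Context.raw R-r) (Context.interface R-r)
      p-canonical : Canonical (Context.raw R-p) (Context.interface R-p)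
      same-size   : length (Context.interface R-r) ≡ length (Context.interface R-p)

  infix 4 _⟶⟨_⟩_

  record _⟶⟨_⟩_ {s₁ s₂} (S : Net) (𝓡 : Rule s₁ s₂) (S′ : Net) : Set₁ where
    open Rule 𝓡
    field
      X     : Context
      αR βR : Net
      α     : Renaming (Context.raw R-r) (Net.raw αR)
      β     : Renaming (Context.raw R-p) (Net.raw βR)

    αI : List ℕ
    αI = map (Renaming.to α) (Context.interface R-r)

    βI : List ℕ
    βI = map (Renaming.to β) (Context.interface R-p)

    field
      source : GluesTo (Net.raw S)  (Context.raw X) (Context.interface X) (Net.raw αR) αI
      target : GluesTo (Net.raw S′) (Context.raw X) (Context.interface X) (Net.raw βR) βI

    redex : Pred ℕ 0ℓ × Pred ℕ 0ℓ
    redex = Orbit (Net.cell S) (Renaming.to α b) , Orbit (Net.cell S) (Renaming.to α c)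

  -- A redex is an unordered pair of cells.
  SamePair : Pred ℕ 0ℓ × Pred ℕ 0ℓ → Pred ℕ 0ℓ × Pred ℕ 0ℓ → Set
  SamePair (C , D) (C′ , D′) = (C ≐ C′ × D ≐ D′) ⊎ (C ≐ D′ × D ≐ C′)

  DistinctRedexes : ∀ {s₁ s₂ t₁ t₂} {𝓡₁ : Rule s₁ s₂} {𝓡₂ : Rule t₁ t₂} {S S₁ S₂ : Net} →
                    S ⟶⟨ 𝓡₁ ⟩ S₁ → S ⟶⟨ 𝓡₂ ⟩ S₂ → Set
  DistinctRedexes r₁ r₂ = ¬ SamePair (_⟶⟨_⟩_.redex r₁) (_⟶⟨_⟩_.redex r₂)

-- Read a port as a wire together with a direction.  When σ and τ are glued
-- along f, put W = σ + τ, g = f + f⋆ and next = W ⨟ g, a partial injection.  Its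
-- orbits are chains, each starting at an unglued port and yielding one end of a
-- wire of the result, and cycles, which are exactly the double orbits (a closed
-- circuit gives two of them, one for each direction).  Thus the carrier of a
-- gluing is the set of orbits of next, named by their starts or minima.  Since
-- the ports of interfaces can be renamed freely, up to the choice of X, α and β
-- only the distinctness of these names matters: a step from S is the same thing
-- as a quotient, by any naming of orbits that keeps the remaining ports of S, of
-- S with the right-hand side attached to the ports of the redex.  Distinct
-- redexes share no cell, so both right-hand sides can be attached to R at once.
-- The orbits obtained in two stages are those obtained at once, and they can be
-- named in a way that extends the names in R₁ and in R₂: a conflict would be a
-- port of both R₁ and R₂, hence one of R, which has the same orbit in both.  The
-- quotient R′ is therefore a reduct of R₁ and of R₂.

module Submission where

open import Defs
open import Data.Bool.Base using (Bool; true; false)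
open import Data.Bool.Properties as Bool using ()
open import Data.Empty using (⊥)
open import Data.Fin.Base as Fin using (Fin; toℕ)
open import Data.Fin.Properties as Fin using (pigeonhole; toℕ≤pred[n]; toℕ<n; toℕ-injective)
open import Data.List.Base using (List; []; _∷_; _++_; length; map; zip; filter; lookup)
open import Data.List.Membership.Propositional using (find; lose) renaming (_∈_ to _∈ˡ_; _∉_ to _∉ˡ_)
open import Data.List.Membership.Propositional.Properties using (∈-++⁺ˡ; ∈-++⁺ʳ; ∈-++⁻; ∈-map⁺; ∈-map⁻; ∈-filter⁺; ∈-filter⁻)
open import Data.List.Properties using (length-map; map-id)
open import Data.List.Relation.Unary.All as All using (All; []; _∷_)
open import Data.List.Relation.Unary.AllPairs.Core using ([]; _∷_)
open import Data.List.Relation.Unary.Any as Any using (Any; here; there; any?)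
open import Data.List.Relation.Unary.Any.Properties using (lookup-index)
open import Data.List.Relation.Unary.Unique.Propositional using (Unique)
open import Data.Nat.Base using (ℕ; zero; suc; _≤_; _<_; z≤n; s≤s; _+_; _*_; _⊔_)
open import Data.Nat.DivMod using (_%_; [m+kn]%n≡m%n; m<n⇒m%n≡m)
open import Data.Nat.Properties as ℕ using (_≟_; suc-injective)
open import Data.List.Membership.DecPropositional _≟_ using (_∈?_)
open import Data.Product.Base using (∃; ∃₂; _×_; _,_; proj₁; proj₂)
open import Data.Sum.Base using (_⊎_; inj₁; inj₂; [_,_]′)
open import Data.Unit.Base using (⊤; tt)
open import Data.Vec.Base using (Vec; toList)
open import Data.Vec.Properties using (length-toList)
open import Function.Base using (_∘_; flip; id)
open import Function.Bundles using (Equivalence; _⇔_; mk⇔)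
open import Level using (0ℓ)
open import Relation.Binary.Construct.Composition using () renaming (_;_ to _⨟_)
open import Relation.Binary.Construct.Union using () renaming (_∪_ to _⊕_)
open import Relation.Binary.Core using (Rel; REL) renaming (_⇔_ to _≗ᴳ_)
open import Relation.Binary.PropositionalEquality using (_≡_; _≢_; refl; sym; trans; cong; subst; subst₂)
open import Relation.Nullary using (Dec; yes; no; ¬_; ¬?; contradiction; _⊎-dec_; _→-dec_)
open import Relation.Nullary.Decidable using (map′)
open import Relation.Unary using (Pred; _∈_; _∉_; _≐_)

open Equivalence using (to; from)

-- Orbits of partial injections

-- Both reductions must end in the same net, not merely in isomorphic ones, while a gluing
-- prescribes its names: a chain is named by its unglued start, a loop by its minimum. The freedom
-- lies in the ports that a gluing hides. To give a loop a prescribed name, one interface port of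
-- the right-hand side is sent to that name and all other ports of the loop above every port of the
-- target; the prescribed name is then the minimum. The second step may join several first-stage
-- orbits, so it has to be shown that the names of `R₁` can be kept. Only those outside the second
-- redex must be, and a joint orbit has at most one of them: a walk that leaves a first-stage orbit
-- crosses the second right-hand side and comes back at a port of the second redex. Names that `R₁`
-- and `R₂` both impose on one orbit agree, because the walk between their ports reduces to a single
-- port outside both redexes, which keeps its name. An orbit on which no name is imposed gets a
-- fresh one.

module Iteration {A : Set} (h : Rel A 0ℓ) where

  -- Powers over an arbitrary type: `_^_` is confined to ℕ, whereas the orbits below also live on
  -- `Port`.
  Steps : ℕ → Rel A 0ℓ
  Steps zero    = _≡_
  Steps (suc n) = Steps n ⨟ h

  infix 4 _↝_

  _↝_ : Rel A 0ℓ
  a ↝ b = ∃ λ n → Steps n a b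

  Cyclic : Pred A 0ℓ
  Cyclic a = ∃ λ n → Steps (suc n) a a

  snoc : ∀ {a b c} → a ↝ b → h b c → a ↝ c
  snoc (n , p) s = suc n , _ , p , s

  steps-++ : ∀ {m} n {a b c} → Steps m a b → Steps n b c → Steps (n + m) a c
  steps-++ zero    p refl        = p
  steps-++ (suc n) p (d , q , s) = d , steps-++ n p q , s

  ↝-trans : ∀ {a b c} → a ↝ b → b ↝ c → a ↝ c
  ↝-trans (m , p) (n , q) = n + m , steps-++ n p q

  cons : ∀ n {a b c} → h a b → Steps n b c → Steps (suc n) a c
  cons zero    s refl        = _ , refl , s
  cons (suc n) s (d , q , t) = d , cons n s q , t

  uncons : ∀ n {a c} → Steps (suc n) a c → ∃ λ b → h a b × Steps n b c
  uncons zero    (_ , refl , s) = _ , s , refl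
  uncons (suc n) (d , p , s) with b , t , q ← uncons n p = b , t , d , q , s

  prefix : ∀ {m n a c} → m ≤ n → Steps n a c → ∃ (Steps m a)
  prefix {n = zero}  z≤n p = _ , p
  prefix {n = suc n} m≤1+n p@(_ , q , _) with ℕ.m≤n⇒m<n∨m≡n m≤1+n
  ... | inj₁ (s≤s m≤n) = prefix m≤n q
  ... | inj₂ refl      = _ , p

  module Deterministic (func : ∀ {a b c} → h a b → h a c → b ≡ c) where

    -- Determinism lets the first steps of both paths be stripped together; whichever path runs out
    -- first leaves the rest of the other.
    comparable : ∀ m n {a b c} → Steps m a b → Steps n a c → b ↝ c ⊎ c ↝ b
    comparable zero    n       refl q    = inj₁ (n , q)
    comparable (suc m) zero    p    refl = inj₂ (suc m , p)
    comparable (suc m) (suc n) p    q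
      with _ , s , p′ ← uncons m p | _ , t , q′ ← uncons n q
      with refl ← func s t = comparable m n p′ q′

    cyclic-→ : ∀ {a b} → h a b → Cyclic a → Cyclic b
    cyclic-→ s (n , p) with _ , t , q ← uncons n p with refl ← func s t = n , _ , q , s

    cyclic-↝ : ∀ {a b} → a ↝ b → Cyclic a → Cyclic b
    cyclic-↝ (zero  , refl)      c = c
    cyclic-↝ (suc n , _ , p , s) c = cyclic-→ s (cyclic-↝ (n , p) c)

    -- Each step out of a port on a cycle is undone by going round the rest of the cycle.
    cyclic-back : ∀ n {a b} → Cyclic a → Steps n a b → b ↝ a
    cyclic-back zero    c refl        = zero , refl
    cyclic-back (suc n) c (_ , p , s) with k , q ← cyclic-↝ (n , p) c
      with _ , t , q′ ← uncons k q with refl ← func s t = ↝-trans (k , q′) (cyclic-back n c p)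

    steps-func : ∀ k {a b c} → Steps k a b → Steps k a c → b ≡ c
    steps-func zero    refl        refl          = refl
    steps-func (suc k) (_ , p , s) (_ , q , t) with refl ← steps-func k p q = func s t

    -- Division with remainder by the length of the cycle: the step count is reset to 0 when it
    -- would reach `suc n`.
    wrap : ∀ {a b n} → Steps (suc n) a a → a ↝ b → ∃ λ i → i ≤ n × Steps i a b
    wrap c (zero  , refl) = zero , z≤n , refl
    wrap {n = n} c@(_ , c′ , t) (suc k , _ , p , s) with wrap c (k , p)
    ... | i , i≤n , q with ℕ.m≤n⇒m<n∨m≡n i≤n
    ...   | inj₁ i<n  = suc i , i<n , _ , q , s
    ...   | inj₂ refl with _ , r , _ ← uncons n c with refl ← steps-func n q c′ with refl ← func s t
      = zero , z≤n , refl

  module Injective (inj : ∀ {a b c} → h a c → h b c → a ≡ b) where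

    co-comparable : ∀ m n {a b c} → Steps m a c → Steps n b c → a ↝ b ⊎ b ↝ a
    co-comparable zero    n       refl        q    = inj₂ (n , q)
    co-comparable (suc m) zero    p           refl = inj₁ (suc m , p)
    co-comparable (suc m) (suc n) (_ , p , s) (_ , q , t) with refl ← inj s t = co-comparable m n p q

    cyclic-← : ∀ {a b} → h a b → Cyclic b → Cyclic a
    cyclic-← s (n , _ , p , t) with refl ← inj s t = n , cons n s p

    cyclic-↜ : ∀ {a b} → a ↝ b → Cyclic b → Cyclic a
    cyclic-↜ (zero  , refl)      c = c
    cyclic-↜ (suc n , _ , p , s) c = cyclic-↜ (n , p) (cyclic-← s c)

    -- Injectivity cancels the last `i` steps of both paths, which leaves a path of positive length
    -- from `a` to itself.
    recurrence : ∀ {i j a b} → i < j → Steps i a b → Steps j a b → Cyclic a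
    recurrence {zero}  {suc j} _         refl        q           = j , q
    recurrence {suc i} {suc j} (s≤s i<j) (_ , p , s) (_ , q , t)
      with refl ← inj s t = recurrence i<j p q

-- Wirings

-- Covers two situations at once: `σ ⊕ τ` with `f ⊕ f ⋆` on ℕ, as in an Ex-composition, and a net
-- with one or two right-hand sides attached, on `Port`.
record IsWiring {A : Set} (W g : Rel A 0ℓ) : Set where
  field
    W-sym    : ∀ {a b} → W a b → W b a
    W-func   : ∀ {a b c} → W a b → W a c → b ≡ c
    g-sym    : ∀ {a b} → g a b → g b a
    g-func   : ∀ {a b c} → g a b → g a c → b ≡ c
    g-wired  : ∀ {a b} → g a b → ∃ (W a)
    g-proper : ∀ {a b} → g a b → ¬ W a a
    g-irrefl : ∀ {a} → ¬ g a a
    g?       : ∀ a → Dec (∃ (g a))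
    ports    : List A
    W⇒port   : ∀ {a b} → W a b → a ∈ˡ ports
    port⇒W   : ∀ {a} → a ∈ˡ ports → ∃ (W a)

module Wiring {A : Set} {W g : Rel A 0ℓ} (isWiring : IsWiring W g) where

  open IsWiring isWiring public

  Glued : Pred A 0ℓ
  Glued a = ∃ (g a)

  next : Rel A 0ℓ
  next = W ⨟ g

  open Iteration next public

  next-func : ∀ {a b c} → next a b → next a c → b ≡ c
  next-func (_ , w , s) (_ , w′ , s′) with refl ← W-func w w′ = g-func s s′

  next-inj : ∀ {a b c} → next a c → next b c → a ≡ b
  next-inj (_ , w , s) (_ , w′ , s′) with refl ← g-func (g-sym s) (g-sym s′) =
    W-func (W-sym w) (W-sym w′)

  open Deterministic next-func public
  open Injective next-inj public

  next⇒glued : ∀ {a b} → next a b → Glued b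
  next⇒glued (_ , _ , s) = _ , g-sym s

  wired-next : ∀ {a b} → next a b → ∃ (W b)
  wired-next (_ , _ , s) = g-wired (g-sym s)

  wired-↝ : ∀ {a b} → ∃ (W a) → a ↝ b → ∃ (W b)
  wired-↝ w (zero  , refl)      = w
  wired-↝ w (suc n , _ , p , s) = wired-next s

  wired-↜ : ∀ n {a b} → ∃ (W b) → Steps n a b → ∃ (W a)
  wired-↜ zero    w refl = w
  wired-↜ (suc n) w p with _ , (c , v , _) , _ ← uncons n p = c , v

  -- Conjugation by the involution `W` turns `next` into its inverse, which exchanges starts and
  -- exits.
  next-reverse : ∀ {a b a′ b′} → next a b → W a a′ → W b b′ → next b′ a′
  next-reverse (_ , w , s) v v′ with refl ← W-func w v = _ , W-sym v′ , g-sym s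

  steps-reverse : ∀ n {a b a′ b′} → Steps n a b → W a a′ → W b b′ → Steps n b′ a′
  steps-reverse zero    refl        v v′ = W-func v′ v
  steps-reverse (suc n) (_ , p , s@(_ , w , _)) v v′ =
    cons n (next-reverse s w v′) (steps-reverse n p v w)

  ↝-reverse : ∀ {a b a′ b′} → a ↝ b → W a a′ → W b b′ → b′ ↝ a′
  ↝-reverse (n , p) v v′ = n , steps-reverse n p v v′

  Exits : Pred A 0ℓ
  Exits a = ∃₂ λ t c → a ↝ t × W t c × ¬ Glued c

  Starts : Pred A 0ℓ
  Starts a = ∃ λ s → s ↝ a × ¬ Glued s

  private
    advance : ∀ n {a} → ∃ (W a) → Exits a ⊎ ∃ (Steps n a)
    advance zero    w = inj₂ (_ , refl)
    advance (suc n) w with advance n w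
    ... | inj₁ e = inj₁ e
    ... | inj₂ (u , p) with c , v ← wired-↝ w (n , p) with g? c
    ...   | yes (d , s) = inj₂ (d , u , p , c , v , s)
    ...   | no ¬s       = inj₁ (u , c , (n , p) , v , ¬s)

  -- If no exit is met, `suc (length ports)` successive iterates all lie in `ports`; two of them
  -- share a position, and `recurrence` applies.
  exits⊎cyclic : ∀ {a} → ∃ (W a) → Exits a ⊎ Cyclic a
  exits⊎cyclic {a} w with advance (length ports) w
  ... | inj₁ e = inj₁ e
  ... | inj₂ (_ , p) = inj₂ (recur (pigeonhole ℕ.≤-refl place))
    where
    at : (i : Fin (suc (length ports))) → ∃ (Steps (toℕ i) a)
    at i = prefix (toℕ≤pred[n] i) p

    at∈ports : ∀ i → proj₁ (at i) ∈ˡ ports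
    at∈ports i = W⇒port (proj₂ (wired-↝ w (toℕ i , proj₂ (at i))))

    place : Fin (suc (length ports)) → Fin (length ports)
    place i = Any.index (at∈ports i)

    recur : (∃₂ λ i j → i Fin.< j × place i ≡ place j) → Cyclic a
    recur (i , j , i<j , eq) = recurrence i<j (proj₂ (at i))
      (subst (Steps (toℕ j) a) (trans (lookup-index (at∈ports j))
        (trans (cong (lookup ports) (sym eq)) (sym (lookup-index (at∈ports i))))) (proj₂ (at j)))

  -- An exit reached from the mate of `a` becomes, when read backwards, a start from which `a` is
  -- reached.
  starts⊎cyclic : ∀ {a} → ∃ (W a) → Starts a ⊎ Cyclic a
  starts⊎cyclic (a′ , w) with exits⊎cyclic (_ , W-sym w)
  ... | inj₁ (_ , c , r , v , ¬g) = inj₁ (c , ↝-reverse r (W-sym w) v , ¬g)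
  ... | inj₂ (n , p) = inj₂ (n , steps-reverse (suc n) p (W-sym w) (W-sym w))

  cyclic-glued : ∀ {a} → Cyclic a → Glued a
  cyclic-glued (n , _ , _ , s) = next⇒glued s

  start-acyclic : ∀ {a s} → s ↝ a → ¬ Glued s → ¬ Cyclic a
  start-acyclic r ¬g c = ¬g (cyclic-glued (cyclic-↜ r c))

  exit-acyclic : ∀ {a b c} → a ↝ b → W b c → ¬ Glued c → ¬ Cyclic a
  exit-acyclic r w ¬g c with n , p ← cyclic-↝ r c with _ , (_ , w′ , s) , _ ← uncons n p
    with refl ← W-func w w′ = ¬g (_ , s)

  start-unique : ∀ {s a} → s ↝ a → ¬ Glued a → s ≡ a
  start-unique (zero  , refl)      _  = refl
  start-unique (suc n , _ , _ , s) ¬g = contradiction (next⇒glued s) ¬g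

  exit-unique : ∀ {a b c} → W a c → ¬ Glued c → a ↝ b → a ≡ b
  exit-unique w ¬g (zero  , refl) = refl
  exit-unique w ¬g (suc n , p) with _ , (_ , w′ , s) , _ ← uncons n p
    with refl ← W-func w w′ = contradiction (_ , s) ¬g

  -- A chain from a to b with W b a is its own reversal, so its middle is a
  -- fixed point of W or of g.
  no-return : ∀ n {a b} → ¬ W a a → Steps n a b → ¬ W b a
  no-return zero          ¬w refl = ¬w
  no-return (suc zero)    ¬w (_ , refl , _ , w , s) v with refl ← W-func w (W-sym v) = g-irrefl s
  no-return (suc (suc n)) ¬w (u , p , d , w , s) v
    with _ , (_ , w′ , s′) , q ← uncons n p
    with refl ← W-func w′ (W-sym v)
    with refl ← g-func s′ (g-sym s) = no-return n (g-proper (g-sym s′)) q w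

  -- A naming labels the orbits of next by distinct numbers.
  record IsNaming (ν : REL A ℕ 0ℓ) : Set where
    field
      total     : ∀ {a} → ∃ (W a) → ∃ (ν a)
      wired     : ∀ {a n} → ν a n → ∃ (W a)
      func      : ∀ {a m n} → ν a m → ν a n → m ≡ n
      follows   : ∀ {a b n} → next a b → ν a n → ν b n
      connected : ∀ {a b n} → ν a n → ν b n → a ↝ b ⊎ b ↝ a

  -- There is no exit under this name, which for an orbit means that it is a cycle. The condition is
  -- vacuous when no port has the name; hence the existence clause in `QuotientWire`.
  Closed : REL A ℕ 0ℓ → Pred ℕ 0ℓ
  Closed ν n = ∀ {a b} → ν a n → W a b → Glued b

  -- A chain is wired to the one that starts where it exits (the same ports, read
  -- backwards through W); a cycle is a fixed point.
  OpenWire : REL A ℕ 0ℓ → Graph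
  OpenWire ν m n = ∃₂ λ a b → ν a m × W a b × ¬ Glued b × ν b n

  QuotientWire : REL A ℕ 0ℓ → Graph
  QuotientWire ν m n = OpenWire ν m n ⊎ (m ≡ n × ∃ (λ a → ν a m) × Closed ν m)

  module Naming {ν : REL A ℕ 0ℓ} (isNaming : IsNaming ν) where

    open IsNaming isNaming public

    follows-↝ : ∀ {a b n} → a ↝ b → ν a n → ν b n
    follows-↝ (zero  , refl)      x = x
    follows-↝ (suc n , _ , p , s) x = follows s (follows-↝ (n , p) x)

    follows⁻ : ∀ {a b n} → next a b → ν b n → ν a n
    follows⁻ s@(_ , w , _) x with _ , y ← total (_ , w) with refl ← func (follows s y) x = y

    follows-↜ : ∀ {a b n} → a ↝ b → ν b n → ν a n
    follows-↜ (zero  , refl)      x = x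
    follows-↜ (suc n , _ , p , s) x = follows-↜ (n , p) (follows⁻ s x)

    starts-≡ : ∀ {a b n} → ν a n → ν b n → ¬ Glued a → ¬ Glued b → a ≡ b
    starts-≡ x y ¬a ¬b with connected x y
    ... | inj₁ r = start-unique r ¬b
    ... | inj₂ r = sym (start-unique r ¬a)

    exits-≡ : ∀ {a b c d n} → ν a n → ν b n → W a c → W b d → ¬ Glued c → ¬ Glued d → a ≡ b
    exits-≡ x y w w′ ¬c ¬d with connected x y
    ... | inj₁ r = exit-unique w ¬c r
    ... | inj₂ r = sym (exit-unique w′ ¬d r)

    cyclic-name : ∀ {a b n} → ν a n → ν b n → Cyclic a → Cyclic b
    cyclic-name x y c with connected x y
    ... | inj₁ r = cyclic-↝ r c
    ... | inj₂ r = cyclic-↜ r c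

    closed⇒cyclic : ∀ {a n} → ν a n → Closed ν n → Cyclic a
    closed⇒cyclic x c with exits⊎cyclic (wired x)
    ... | inj₁ (_ , _ , r , w , ¬g) = contradiction (c (follows-↝ r x) w) ¬g
    ... | inj₂ cyc = cyc

    cyclic⇒closed : ∀ {a n} → ν a n → Cyclic a → Closed ν n
    cyclic⇒closed x cyc {b} y w with k , p ← cyclic-name x y cyc
      with _ , (_ , w′ , s) , _ ← uncons k p with refl ← W-func w w′ = _ , s

    closed-start : ∀ {a n} → ν a n → Closed ν n → Glued a
    closed-start x c = cyclic-glued (closed⇒cyclic x c)

    quotient-func : ∀ {m n o} → QuotientWire ν m n → QuotientWire ν m o → n ≡ o
    quotient-func (inj₁ (_ , _ , x , w , ¬g , y)) (inj₁ (_ , _ , x′ , w′ , ¬g′ , y′))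
      with refl ← exits-≡ x x′ w w′ ¬g ¬g′ with refl ← W-func w w′ = func y y′
    quotient-func (inj₁ (_ , _ , x , w , ¬g , y)) (inj₂ (refl , _ , c)) = contradiction (c x w) ¬g
    quotient-func (inj₂ (refl , _ , c)) (inj₁ (_ , _ , x , w , ¬g , y)) = contradiction (c x w) ¬g
    quotient-func (inj₂ (refl , _)) (inj₂ (refl , _)) = refl

    -- The chain from its start `s` to `a`, reversed through `W`, runs from `b` to the mate of `s`,
    -- where it exits at `s`.
    quotient-sym : ∀ {m n} → QuotientWire ν m n → QuotientWire ν n m
    quotient-sym (inj₂ (refl , c)) = inj₂ (refl , c)
    quotient-sym (inj₁ (a , b , x , w , ¬g , y)) with starts⊎cyclic (_ , w)
    ... | inj₂ c = contradiction c (exit-acyclic (zero , refl) w ¬g)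
    ... | inj₁ (s , r , ¬s) with s′ , v ← wired-↜ (proj₁ r) (_ , w) (proj₂ r) =
      inj₁ (s′ , s , follows-↝ (↝-reverse r v w) y , W-sym v , ¬s , follows-↜ r x)

    quotient-dom : ∀ {a n} → ν a n → ∃ (QuotientWire ν n)
    quotient-dom x with exits⊎cyclic (wired x)
    ... | inj₂ c = _ , inj₂ (refl , (_ , x) , cyclic⇒closed x c)
    ... | inj₁ (_ , _ , r , w , ¬g) with _ , y ← total (_ , W-sym w) =
      _ , inj₁ (_ , _ , follows-↝ r x , w , ¬g , y)

    quotient-name : ∀ {m n} → QuotientWire ν m n → ∃ λ a → ν a m
    quotient-name (inj₁ (_ , _ , x , _)) = _ , x
    quotient-name (inj₂ (_ , x , _)) = x

    -- A chain wired to itself would contain a port wired to its own start, which `no-return`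
    -- excludes.
    quotient-proper : ∀ {a n} → ν a n → ¬ Glued a → ¬ W a a → ¬ QuotientWire ν n n
    quotient-proper x ¬g ¬w (inj₂ (_ , _ , c)) = ¬g (closed-start x c)
    quotient-proper x ¬g ¬w (inj₁ (b , c , y , w , ¬c , z)) with refl ← starts-≡ x z ¬g ¬c
      with connected x y
    ... | inj₁ (n , p) = no-return n ¬w p w
    ... | inj₂ r with refl ← start-unique r ¬g = ¬w w

  -- The conditions that pin down the naming used by a gluing: the last two together make the name
  -- of a loop the minimum over its ports.
  record IsNormalised (name : A → ℕ) (ν : REL A ℕ 0ℓ) : Set where
    field
      start-name  : ∀ {a} → ∃ (W a) → ¬ Glued a → ν a (name a)
      closed-name : ∀ {a n} → ν a n → Closed ν n → ∃ λ m → name m ≡ n × ν m n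
      closed-min  : ∀ {a n} → ν a n → Closed ν n → n ≤ name a

  -- Naming chains by their starts and cycles by their minima

  module Canonical (name : A → ℕ) (name-inj : ∀ {a b} → name a ≡ name b → a ≡ b) where

    -- With `name = id` these are the names of an Ex-composition; with the injective `code` they are
    -- provisional names for orbits on `Port`.
    data canonical (a : A) (n : ℕ) : Set where
      chain : ∀ {s} → s ↝ a → ¬ Glued s → ∃ (W s) → name s ≡ n → canonical a n
      loop : ∀ {m} → Cyclic a → a ↝ m → (∀ {b} → a ↝ b → name m ≤ name b) → name m ≡ n → canonical a n

    private
      least-prefix : ∀ k {a b} → Steps k a b →
                     ∃ λ m → a ↝ m × (∀ {i c} → i ≤ k → Steps i a c → name m ≤ name c)
      least-prefix zero    {a} refl = a , (zero , refl) , λ { z≤n refl → ℕ.≤-refl }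
      least-prefix (suc k) {a} {b} p@(_ , q , _) with m , r , below ← least-prefix k q
        with ℕ.≤-total (name m) (name b)
      ... | inj₁ m≤b = m , r , λ i≤1+k q′ → [ (λ { (s≤s i≤k) → below i≤k q′ }) ,
        (λ { refl → subst (λ c → name m ≤ name c) (steps-func (suc k) p q′) m≤b }) ]′ (ℕ.m≤n⇒m<n∨m≡n i≤1+k)
      ... | inj₂ b≤m = b , (suc k , p) , λ i≤1+k q′ → [ (λ { (s≤s i≤k) → ℕ.≤-trans b≤m (below i≤k q′) }) ,
        (λ { refl → ℕ.≤-reflexive (cong name (steps-func (suc k) p q′)) }) ]′ (ℕ.m≤n⇒m<n∨m≡n i≤1+k)

    -- One turn of the cycle already visits everything reachable, by `wrap`, so a minimum over
    -- finitely many steps suffices.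
    least : ∀ {a} → Cyclic a → ∃ λ m → a ↝ m × (∀ {b} → a ↝ b → name m ≤ name b)
    least c@(n , p) with m , r , below ← least-prefix n (proj₁ (proj₂ p)) =
      m , r , λ q → let _ , i≤n , q′ = wrap p q in below i≤n q′

    canonical-func : ∀ {a m n} → canonical a m → canonical a n → m ≡ n
    canonical-func (chain (m , p) ¬g _ refl) (chain (n , q) ¬g′ _ refl) with co-comparable m n p q
    ... | inj₁ r = cong name (start-unique r ¬g′)
    ... | inj₂ r = cong name (sym (start-unique r ¬g))
    canonical-func (chain p ¬g _ _) (loop c _ _ _) = contradiction c (start-acyclic p ¬g)
    canonical-func (loop c _ _ _) (chain p ¬g _ _) = contradiction c (start-acyclic p ¬g)
    canonical-func (loop _ r min refl) (loop _ r′ min′ refl) = ℕ.≤-antisym (min r′) (min′ r)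

    canonical-isNaming : IsNaming canonical
    canonical-isNaming = record
      { total     = total
      ; wired     = λ { (chain p _ w _) → wired-↝ w p
                      ; (loop c _ _ _) → g-wired (proj₂ (cyclic-glued c)) }
      ; func      = canonical-func
      ; follows   = follows
      ; connected = connected
      }
      where
      total : ∀ {a} → ∃ (W a) → ∃ (canonical a)
      total w with starts⊎cyclic w
      ... | inj₁ (s , p , ¬g) = name s , chain p ¬g (wired-↜ (proj₁ p) w (proj₂ p)) refl
      ... | inj₂ c with m , r , min ← least c = name m , loop c r min refl

      follows : ∀ {a b n} → next a b → canonical a n → canonical b n
      follows s (chain p ¬g w eq) = chain (snoc p s) ¬g w eq
      follows s (loop c r min eq) = loop (cyclic-→ s c)
        (↝-trans (cyclic-back 1 c (_ , refl , s)) r) (λ q → min (↝-trans (1 , _ , refl , s) q)) eq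

      connected : ∀ {a b n} → canonical a n → canonical b n → a ↝ b ⊎ b ↝ a
      connected (chain (m , p) _ _ refl) (chain (n , q) _ _ eq) with refl ← name-inj eq = comparable m n p q
      connected (chain p ¬g _ refl) (loop c r _ eq) with refl ← name-inj eq =
        contradiction (cyclic-glued (cyclic-↝ r c)) ¬g
      connected (loop c r _ refl) (chain q ¬g _ eq) with refl ← name-inj eq =
        contradiction (cyclic-glued (cyclic-↝ r c)) ¬g
      connected (loop c r _ refl) (loop c′ (n , q) _ eq) with refl ← name-inj eq =
        inj₁ (↝-trans r (cyclic-back n c′ q))

    module _ {ν : REL A ℕ 0ℓ} (isNaming : IsNaming ν) (isNormalised : IsNormalised name ν) where

      open Naming isNaming
      open IsNormalised isNormalised

      -- On a cycle the two names bound each other: the canonical one is at most the name of the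
      -- port given by `closed-name`, and `closed-min` at the canonical minimum gives the converse.
      canonical⇒normalised : ∀ {a n} → canonical a n → ν a n
      canonical⇒normalised (chain p ¬g w refl) = follows-↝ p (start-name w ¬g)
      canonical⇒normalised (loop c r min refl)
        with n , x ← total (g-wired (proj₂ (cyclic-glued c)))
        with closed-name x (cyclic⇒closed x c)
      ... | m , refl , y with ℕ.≤-antisym (min a↝m) (closed-min (follows-↝ r x) (cyclic⇒closed x c))
        where
        a↝m = [ id , (λ { (k , q) → cyclic-back k (cyclic-name x y c) q }) ]′ (connected x y)
      ...   | eq = subst (ν _) (sym eq) x

      normalised⇒canonical : ∀ {a n} → ν a n → canonical a n
      normalised⇒canonical x with _ , y ← IsNaming.total canonical-isNaming (wired x)
        with refl ← func x (canonical⇒normalised y) = y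

-- Gluings as quotients of wirings

module WPermutation {σ : Graph} (σ-perm : IsWPermutation σ) where

  open IsWPermutation σ-perm public

  symmetric : ∀ {x y} → σ x y → σ y x
  symmetric s with _ , t ← proj₂ dom≐codom (_ , s) with refl ← involutive (_ , s , t) = t

  ports : List ℕ
  ports = proj₁ finite

  port⇒dom : ∀ {x} → x ∈ˡ ports → x ∈ dom σ
  port⇒dom = from (proj₂ finite _)

  dom⇒port : ∀ {x} → x ∈ dom σ → x ∈ˡ ports
  dom⇒port = to (proj₂ finite _)

record IsGluing (σ f τ : Graph) : Set where
  field
    σ-perm         : IsWPermutation σ
    τ-perm         : IsWPermutation τ
    disjoint       : Disjoint (dom σ) (dom τ)
    functional     : ∀ {x y z} → f x y → f x z → y ≡ z
    injective      : ∀ {x y z} → f x z → f y z → x ≡ y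
    dom-proper     : ∀ {x} → x ∈ dom f → x ∈ dom σ × ¬ σ x x
    codom-proper   : ∀ {x} → x ∈ codom f → x ∈ dom τ × ¬ τ x x
    dom?           : ∀ x → Dec (x ∈ dom f)
    codom?         : ∀ x → Dec (x ∈ codom f)

module Gluing {σ f τ : Graph} (isGluing : IsGluing σ f τ) where

  open IsGluing isGluing
  private
    module σ = WPermutation σ-perm
    module τ = WPermutation τ-perm

  W g : Graph
  W = σ ⊕ τ
  g = f ⊕ f ⋆

  dom-codom : ∀ {x} → x ∈ dom f → x ∉ codom f
  dom-codom d c = disjoint (proj₁ (dom-proper d)) (proj₁ (codom-proper c))

  isWiring : IsWiring W g
  isWiring = record
    { W-sym    = λ { (inj₁ s) → inj₁ (σ.symmetric s) ; (inj₂ t) → inj₂ (τ.symmetric t) }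
    ; W-func   = λ { (inj₁ s) (inj₁ s′) → σ.functional s s′
                   ; (inj₁ s) (inj₂ t)  → contradiction (_ , t) (disjoint (_ , s))
                   ; (inj₂ t) (inj₁ s)  → contradiction (_ , t) (disjoint (_ , s))
                   ; (inj₂ t) (inj₂ t′) → τ.functional t t′ }
    ; g-sym    = λ { (inj₁ s) → inj₂ s ; (inj₂ s) → inj₁ s }
    ; g-func   = λ { (inj₁ s) (inj₁ s′) → functional s s′
                   ; (inj₁ s) (inj₂ t)  → contradiction (_ , t) (dom-codom (_ , s))
                   ; (inj₂ t) (inj₁ s)  → contradiction (_ , t) (dom-codom (_ , s))
                   ; (inj₂ t) (inj₂ t′) → injective t t′ }
    ; g-wired  = λ { (inj₁ s) → let _ , p = proj₁ (dom-proper (_ , s)) in _ , inj₁ p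
                   ; (inj₂ s) → let _ , p = proj₁ (codom-proper (_ , s)) in _ , inj₂ p }
    ; g-proper = λ { (inj₁ s) (inj₁ p) → proj₂ (dom-proper (_ , s)) p
                   ; (inj₁ s) (inj₂ p) → disjoint (proj₁ (dom-proper (_ , s))) (_ , p)
                   ; (inj₂ s) (inj₁ p) → disjoint (_ , p) (proj₁ (codom-proper (_ , s)))
                   ; (inj₂ s) (inj₂ p) → proj₂ (codom-proper (_ , s)) p }
    ; g-irrefl = λ { (inj₁ s) → dom-codom (_ , s) (_ , s) ; (inj₂ s) → dom-codom (_ , s) (_ , s) }
    ; g?       = glued?
    ; ports    = σ.ports ++ τ.ports
    ; W⇒port   = λ { (inj₁ s) → ∈-++⁺ˡ (σ.dom⇒port (_ , s)) ; (inj₂ t) → ∈-++⁺ʳ σ.ports (τ.dom⇒port (_ , t)) }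
    ; port⇒W   = [ (λ p → let _ , s = σ.port⇒dom p in _ , inj₁ s) ,
                   (λ p → let _ , t = τ.port⇒dom p in _ , inj₂ t) ]′ ∘ ∈-++⁻ σ.ports
    }
    where
    glued? : ∀ x → Dec (∃ (g x))
    glued? x with dom? x | codom? x
    ... | yes (_ , s) | _           = yes (_ , inj₁ s)
    ... | no _        | yes (_ , s) = yes (_ , inj₂ s)
    ... | no ¬d       | no ¬c       = no λ { (_ , inj₁ s) → ¬d (_ , s) ; (_ , inj₂ s) → ¬c (_ , s) }

  open Wiring isWiring hiding (W-sym; W-func) public
  open Canonical id id public

  private
    ^⇒Steps : ∀ n {x y} → (next ^ n) x y → Steps n x y
    ^⇒Steps zero    eq          = eq
    ^⇒Steps (suc n) (_ , p , s) = _ , ^⇒Steps n p , s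

    Steps⇒^ : ∀ n {x y} → Steps n x y → (next ^ n) x y
    Steps⇒^ zero    eq          = eq
    Steps⇒^ (suc n) (_ , p , s) = _ , Steps⇒^ n p , s

    out : ∀ {x y} → x ∈ dom σ → next x y → (σ ⨟ f) x y
    out d (_ , inj₁ s , inj₁ t) = _ , s , t
    out d (_ , inj₁ s , inj₂ t) = contradiction (proj₁ (codom-proper (_ , t))) (disjoint (_ , σ.symmetric s))
    out d (_ , inj₂ s , _)      = contradiction (_ , s) (disjoint d)

    back : ∀ {x y} → x ∈ dom τ → next x y → (τ ⨟ f ⋆) x y
    back d (_ , inj₂ s , inj₂ t) = _ , s , t
    back d (_ , inj₂ s , inj₁ t) = contradiction (_ , τ.symmetric s) (disjoint (proj₁ (dom-proper (_ , t))))
    back d (_ , inj₁ s , _)      = contradiction d (disjoint (_ , s))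

    out⇒next : ∀ {x y} → (σ ⨟ f) x y → next x y
    out⇒next (_ , s , t) = _ , inj₁ s , inj₁ t

    back⇒next : ∀ {x y} → (τ ⨟ f ⋆) x y → next x y
    back⇒next (_ , s , t) = _ , inj₂ s , inj₂ t

    -- `round` and `round′` are rotations of one alternating word, so the half-turn `σ ⨟ f`
    -- intertwines their powers.
    out-orbit : ∀ n {x y z} → (round σ f τ ^ n) x y → (σ ⨟ f) y z →
                ∃ λ u → (σ ⨟ f) x u × (round′ σ f τ ^ n) u z
    out-orbit zero    refl s = _ , s , refl
    out-orbit (suc n) (_ , p , _ , s , _ , t , u) v with w , a , b ← out-orbit n p (_ , s , t) =
      w , a , _ , b , (let _ , c , d = u ; _ , e , h = v in _ , c , _ , d , _ , e , h)

    orbit-back : ∀ n {x y z u} → (σ ⨟ f) x y → (round′ σ f τ ^ n) y z → (τ ⨟ f ⋆) z u →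
                 (round σ f τ ^ suc n) x u
    orbit-back zero    (_ , s , t) refl u = _ , refl , _ , s , _ , t , u
    orbit-back (suc n) s (_ , p , _ , a , _ , b , _ , c , d) u =
      _ , orbit-back n s p (_ , a , b) , _ , c , _ , d , u

    Orbit⇒↝ : ∀ n {x y} → (round σ f τ ^ n) x y → x ↝ y
    Orbit⇒↝ zero    refl = zero , refl
    Orbit⇒↝ (suc n) (_ , p , _ , s , _ , t , u) =
      snoc (snoc (Orbit⇒↝ n p) (out⇒next (_ , s , t))) (back⇒next u)

    Orbit′⇒↝ : ∀ n {x y} → (round′ σ f τ ^ n) x y → x ↝ y
    Orbit′⇒↝ zero    refl = zero , refl
    Orbit′⇒↝ (suc n) (_ , p , _ , s , _ , t , u) =
      snoc (snoc (Orbit′⇒↝ n p) (back⇒next (_ , s , t))) (out⇒next u)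

    O∪O′⇒↝ : ∀ {x y} → O∪O′ σ f τ x y → x ↝ y
    O∪O′⇒↝ (inj₁ (n , p)) = Orbit⇒↝ n p
    O∪O′⇒↝ (inj₂ (_ , s , n , p)) = ↝-trans (1 , _ , refl , out⇒next s) (Orbit′⇒↝ n p)

    -- Every step of `next` changes sides. From a port of `dom f`, an even number of steps ends in
    -- the orbit of `round` and an odd number in that of `round′`; both together make the double
    -- orbit.
    Odd Even : Rel ℕ 0ℓ
    Even x y = y ∈ dom f × Orbit (round σ f τ) x y
    Odd  x y = y ∈ codom f × ∃ λ z → (σ ⨟ f) x z × Orbit (round′ σ f τ) z y

    ↝⇒parity : ∀ n {x y} → x ∈ dom f → Steps n x y → Even x y ⊎ Odd x y
    ↝⇒parity zero    d refl = inj₁ (d , zero , refl)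
    ↝⇒parity (suc n) d (_ , p , s) with ↝⇒parity n d p
    ... | inj₁ (d′ , k , q) with t@(_ , _ , v) ← out (proj₁ (dom-proper d′)) s
      with _ , a , b ← out-orbit k q t = inj₂ ((_ , v) , _ , a , k , b)
    ... | inj₂ (c , _ , a , k , b) with t@(_ , _ , v) ← back (proj₁ (codom-proper c)) s =
      inj₁ ((_ , v) , suc k , orbit-back k a b t)

    ↝⇒O∪O′ : ∀ {x y} → x ∈ dom f → x ↝ y → O∪O′ σ f τ x y
    ↝⇒O∪O′ d (n , p) with ↝⇒parity n d p
    ... | inj₁ (_ , e) = inj₁ e
    ... | inj₂ (_ , o) = inj₂ o

    -- Since sides alternate, a cycle of `next` through `dom f` has even length, hence is a power of
    -- `round`.
    recurrent : ∀ {x} → x ∈ dom f → Cyclic x → Recurrent σ f τ x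
    recurrent d (n , _ , p , s) with ↝⇒parity n d p
    ... | inj₁ (d′ , _) with _ , _ , v ← out (proj₁ (dom-proper d′)) s =
      contradiction (_ , v) (dom-codom d)
    ... | inj₂ (c , _ , a , k , b) =
      d , suc k , s≤s z≤n , orbit-back k a b (back (proj₁ (codom-proper c)) s)

    round⇒cyclic : ∀ n {x} → (round σ f τ ^ suc n) x x → Cyclic x
    round⇒cyclic n (_ , p , _ , s , _ , t , u) with k , q ← Orbit⇒↝ n p =
      suc k , _ , (_ , q , out⇒next (_ , s , t)) , back⇒next u

    minimum : ∀ {m} → Cyclic m → (∀ {y} → m ↝ y → m ≤ y) → m ∈ Minima σ f τ
    minimum c min with cyclic-glued c
    ... | _ , inj₁ s = _ , recurrent (_ , s) c , ↝⇒O∪O′ (_ , s) (zero , refl) , min ∘ O∪O′⇒↝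
    -- `Minima` only quantifies over double orbits of ports in `dom f`. When the minimum lies in
    -- `codom f`, the next port of the cycle lies in `dom f` and has the same double orbit.
    ... | _ , inj₂ s with n , p ← c with x , t , _ ← uncons n p
      with _ , _ , v ← back (proj₁ (codom-proper (_ , s))) t =
      x , recurrent (_ , v) (cyclic-→ t c) , ↝⇒O∪O′ (_ , v) (cyclic-back 1 c (_ , refl , t)) ,
      min ∘ ↝-trans (1 , _ , refl , t) ∘ O∪O′⇒↝

  -- The `k` rounds of an execution are `k` steps of `next` from an unglued start and its last
  -- application of `σ ⊕ τ` is the exit; a fixed minimum is a cycle with its canonical name.
  ↭⇒quotient : ∀ {x y} → (σ ↭[ f ] τ) x y → QuotientWire canonical x y
  ↭⇒quotient (inj₁ (x∉ , y∉ , k , _ , p , w)) =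
    inj₁ (_ , _ , chain (k , p′) ¬gx (wired-↜ k (_ , w) p′) refl , w , y∉ ,
          chain (zero , refl) y∉ (_ , IsWiring.W-sym isWiring w) refl)
    where
    p′  = ^⇒Steps k p
    ¬gx = λ { (_ , s) → x∉ (_ , IsWiring.g-sym isWiring s) }
  ↭⇒quotient (inj₂ ((x , (d , suc n , _ , p) , q∈ , min) , refl)) with x↝q ← O∪O′⇒↝ q∈ =
    inj₂ (refl , (x , named) , cyclic⇒closed named cyc)
    where
    open Naming canonical-isNaming
    cyc   = round⇒cyclic n p
    named = loop cyc x↝q (min ∘ ↝⇒O∪O′ d) refl

  quotient⇒↭ : ∀ {x y} → QuotientWire canonical x y → (σ ↭[ f ] τ) x y
  quotient⇒↭ (inj₁ (_ , _ , loop c _ _ _ , w , ¬g , _)) =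
    contradiction c (exit-acyclic (zero , refl) w ¬g)
  quotient⇒↭ (inj₁ (_ , _ , chain (k , p) ¬gx _ refl , w , ¬gy , y))
    with refl ← canonical-func y (chain (zero , refl) ¬gy (_ , IsWiring.W-sym isWiring w) refl) =
    inj₁ ((λ { (_ , s) → ¬gx (_ , IsWiring.g-sym isWiring s) }) , ¬gy , k , _ , Steps⇒^ k p , w)
  quotient⇒↭ (inj₂ (refl , (_ , x@(chain p ¬g _ refl)) , cl)) =
    contradiction (Naming.closed⇒cyclic canonical-isNaming x cl) (start-acyclic p ¬g)
  quotient⇒↭ (inj₂ (refl , (_ , loop c r min refl) , _)) =
    inj₂ (minimum (cyclic-↝ r c) (min ∘ ↝-trans r) , refl)

-- Transport of namings

-- The correspondence is a relation because only wired ports need a counterpart.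
record WiringIso {A B : Set} (T : REL A B 0ℓ) (W g : Rel A 0ℓ) (W′ g′ : Rel B 0ℓ) : Set where
  field
    isWiring  : IsWiring W g
    isWiring′ : IsWiring W′ g′
    wired     : ∀ {a a′} → T a a′ → ∃ (W a)
    total     : ∀ {a} → ∃ (W a) → ∃ (T a)
    onto      : ∀ {a′} → ∃ (W′ a′) → ∃ λ a → T a a′
    func      : ∀ {a b c} → T a b → T a c → b ≡ c
    inj       : ∀ {a b c} → T a c → T b c → a ≡ b
    W⇒        : ∀ {a b a′ b′} → T a a′ → T b b′ → W a b → W′ a′ b′
    W⇐        : ∀ {a b a′ b′} → T a a′ → T b b′ → W′ a′ b′ → W a b
    g⇒        : ∀ {a b a′ b′} → T a a′ → T b b′ → g a b → g′ a′ b′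
    g⇐        : ∀ {a b a′ b′} → T a a′ → T b b′ → g′ a′ b′ → g a b

flip-iso : ∀ {A B : Set} {T : REL A B 0ℓ} {W g : Rel A 0ℓ} {W′ g′ : Rel B 0ℓ} →
           WiringIso T W g W′ g′ → WiringIso (flip T) W′ g′ W g
flip-iso iso = record
  { isWiring  = isWiring′ ; isWiring′ = isWiring
  ; wired     = λ t → let _ , w = wired t ; _ , u = total (_ , IsWiring.W-sym isWiring w) in _ , W⇒ t u w
  ; total     = onto ; onto = total ; func = inj ; inj = func
  ; W⇒ = W⇐ ; W⇐ = W⇒ ; g⇒ = g⇐ ; g⇐ = g⇒
  }
  where open WiringIso iso

module Transport {A B : Set} {T : REL A B 0ℓ} {W g : Rel A 0ℓ} {W′ g′ : Rel B 0ℓ}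
                 (iso : WiringIso T W g W′ g′) where

  open WiringIso iso
  private
    module A = Wiring isWiring
    module B = Wiring isWiring′

  transport : REL A ℕ 0ℓ → REL B ℕ 0ℓ
  transport ν b n = ∃ λ a → T a b × ν a n

  glued⇒ : ∀ {a b} → T a b → A.Glued a → B.Glued b
  glued⇒ t (_ , s) with _ , u ← total (A.g-wired (A.g-sym s)) = _ , g⇒ t u s

  glued⇐ : ∀ {a b} → T a b → B.Glued b → A.Glued a
  glued⇐ t (_ , s) with _ , u ← onto (B.g-wired (B.g-sym s)) = _ , g⇐ t u s

  next⇒ : ∀ {a b c} → T a b → A.next a c → ∃ λ d → T c d × B.next b d
  next⇒ t (_ , w , s) with _ , u ← total (A.g-wired s) | _ , v ← total (A.g-wired (A.g-sym s)) =
    _ , v , _ , W⇒ t u w , g⇒ u v s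

  next⇐ : ∀ {a b d} → T a b → B.next b d → ∃ λ c → T c d × A.next a c
  next⇐ t (_ , w , s) with _ , u ← onto (B.g-wired s) | _ , v ← onto (B.g-wired (B.g-sym s)) =
    _ , v , _ , W⇐ t u w , g⇐ u v s

  steps⇒ : ∀ n {a b c} → T a b → A.Steps n a c → ∃ λ d → T c d × B.Steps n b d
  steps⇒ zero    t refl = _ , t , refl
  steps⇒ (suc n) t (_ , p , s) with _ , u , q ← steps⇒ n t p with _ , v , r ← next⇒ u s =
    _ , v , _ , q , r

  ↝⇒ : ∀ {a b c d} → T a c → T b d → a A.↝ b → c B.↝ d
  ↝⇒ t u (n , p) with _ , v , q ← steps⇒ n t p with refl ← func u v = n , q

  module _ {ν : REL A ℕ 0ℓ} (isNaming : A.IsNaming ν) where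

    private module N = A.IsNaming isNaming

    transport-isNaming : B.IsNaming (transport ν)
    transport-isNaming = record
      { total     = λ w → let _ , t = onto w ; _ , x = N.total (wired t) in _ , _ , t , x
      ; wired     = λ { (_ , t , x) → WiringIso.wired (flip-iso iso) t }
      ; func      = λ { (_ , t , x) (_ , u , y) → N.func x (subst (λ a → ν a _) (inj u t) y) }
      ; follows   = λ { s (_ , t , x) → let _ , u , r = next⇐ t s in _ , u , N.follows r x }
      ; connected = λ { (_ , t , x) (_ , u , y) → [ inj₁ ∘ ↝⇒ t u , inj₂ ∘ ↝⇒ u t ]′ (N.connected x y) }
      }

    closed⇒ : ∀ {n} → A.Closed ν n → B.Closed (transport ν) n
    closed⇒ cl (_ , t , x) w with _ , u ← onto (_ , B.W-sym w) = glued⇒ u (cl x (W⇐ t u w))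

    closed⇐ : ∀ {n} → B.Closed (transport ν) n → A.Closed ν n
    closed⇐ cl x w with _ , t ← total (_ , w) | _ , u ← total (_ , A.W-sym w) =
      glued⇐ u (cl (_ , t , x) (W⇒ t u w))

    quotient⇒ : ∀ {m n} → A.QuotientWire ν m n → B.QuotientWire (transport ν) m n
    quotient⇒ (inj₁ (_ , _ , x , w , ¬g , y)) with _ , t ← total (_ , w) | _ , u ← total (_ , A.W-sym w) =
      inj₁ (_ , _ , (_ , t , x) , W⇒ t u w , ¬g ∘ glued⇐ u , _ , u , y)
    quotient⇒ (inj₂ (refl , (_ , x) , cl)) with _ , t ← total (N.wired x) =
      inj₂ (refl , (_ , _ , t , x) , closed⇒ cl)

    quotient⇐ : ∀ {m n} → B.QuotientWire (transport ν) m n → A.QuotientWire ν m n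
    quotient⇐ (inj₁ (_ , _ , (_ , t , x) , w , ¬g , _ , u , y)) =
      inj₁ (_ , _ , x , W⇐ t u w , ¬g ∘ glued⇒ u , y)
    quotient⇐ (inj₂ (refl , (_ , _ , t , x) , cl)) = inj₂ (refl , (_ , x) , closed⇐ cl)

-- Matchings of lists

module _ {A B : Set} where

  zip-∈ˡ : ∀ {x : A} {y : B} xs {ys} → (x , y) ∈ˡ zip xs ys → x ∈ˡ xs
  zip-∈ˡ (_ ∷ xs) {_ ∷ _} (here refl) = here refl
  zip-∈ˡ (_ ∷ xs) {_ ∷ _} (there p)   = there (zip-∈ˡ xs p)

  zip-∈ʳ : ∀ {x : A} {y : B} xs {ys} → (x , y) ∈ˡ zip xs ys → y ∈ˡ ys
  zip-∈ʳ (_ ∷ xs) {_ ∷ _} (here refl) = here refl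
  zip-∈ʳ (_ ∷ xs) {_ ∷ _} (there p)   = there (zip-∈ʳ xs p)

  zip-functional : ∀ {x : A} {y z : B} {xs} ys → Unique xs →
                   (x , y) ∈ˡ zip xs ys → (x , z) ∈ˡ zip xs ys → y ≡ z
  zip-functional {xs = _ ∷ _} (_ ∷ _)  _        (here refl) (here refl) = refl
  zip-functional {xs = _ ∷ _} (_ ∷ ys) (h ∷ _)  (here refl) (there q)   = contradiction refl (All.lookup h (zip-∈ˡ _ q))
  zip-functional {xs = _ ∷ _} (_ ∷ ys) (h ∷ _)  (there p)   (here refl) = contradiction refl (All.lookup h (zip-∈ˡ _ p))
  zip-functional {xs = _ ∷ _} (_ ∷ ys) (_ ∷ u)  (there p)   (there q)   = zip-functional ys u p q

  zip-total : ∀ {x : A} (xs : List A) (ys : List B) → length xs ≡ length ys → x ∈ˡ xs →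
              ∃ λ y → (x , y) ∈ˡ zip xs ys
  zip-total (_ ∷ xs) (y ∷ ys) eq (here refl) = y , here refl
  zip-total (_ ∷ xs) (_ ∷ ys) eq (there p) with y , q ← zip-total xs ys (suc-injective eq) p = y , there q

module _ {A B : Set} where

  zip-flip : ∀ {x : A} {y : B} xs ys → (x , y) ∈ˡ zip xs ys → (y , x) ∈ˡ zip ys xs
  zip-flip (_ ∷ xs) (_ ∷ ys) (here refl) = here refl
  zip-flip (_ ∷ xs) (_ ∷ ys) (there p)   = there (zip-flip xs ys p)

module _ {A B : Set} where

  zip-injective : ∀ {x y : A} {z : B} xs {ys} → Unique ys →
                  (x , z) ∈ˡ zip xs ys → (y , z) ∈ˡ zip xs ys → x ≡ y
  zip-injective xs u p q = zip-functional xs u (zip-flip xs _ p) (zip-flip xs _ q)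

  zip-onto : ∀ {y : B} (xs : List A) (ys : List B) → length xs ≡ length ys → y ∈ˡ ys →
             ∃ λ x → (x , y) ∈ˡ zip xs ys
  zip-onto xs ys eq p with x , q ← zip-total ys xs (sym eq) p = x , zip-flip ys xs q

  zip-map⁺ : ∀ {C D : Set} (f : A → C) (g : B → D) {x y} xs ys →
             (x , y) ∈ˡ zip xs ys → (f x , g y) ∈ˡ zip (map f xs) (map g ys)
  zip-map⁺ f g (_ ∷ xs) (_ ∷ ys) (here refl) = here refl
  zip-map⁺ f g (_ ∷ xs) (_ ∷ ys) (there p)   = there (zip-map⁺ f g xs ys p)

  zip-map⁻ : ∀ {C D : Set} (f : A → C) (g : B → D) {u v} xs ys →
             (u , v) ∈ˡ zip (map f xs) (map g ys) →
             ∃₂ λ x y → (x , y) ∈ˡ zip xs ys × u ≡ f x × v ≡ g y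
  zip-map⁻ f g (_ ∷ xs) (_ ∷ ys) (here refl) = _ , _ , here refl , refl , refl
  zip-map⁻ f g (_ ∷ xs) (_ ∷ ys) (there p) with x , y , q , e ← zip-map⁻ f g xs ys p = x , y , there q , e

  zip-graph⁺ : ∀ (f : A → B) {x xs} → x ∈ˡ xs → (f x , x) ∈ˡ zip (map f xs) xs
  zip-graph⁺ f (here refl) = here refl
  zip-graph⁺ f (there p)   = there (zip-graph⁺ f p)

  zip-graph⁻ : ∀ (f : A → B) {x y} xs → (y , x) ∈ˡ zip (map f xs) xs → y ≡ f x × x ∈ˡ xs
  zip-graph⁻ f (_ ∷ _)  (here refl) = refl , here refl
  zip-graph⁻ f (_ ∷ xs) (there p) with e , q ← zip-graph⁻ f xs p = e , there q

  zip-compose : ∀ {C : Set} {x : A} {y : B} {z : C} xs {ys} zs → Unique ys →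
                (x , y) ∈ˡ zip xs ys → (y , z) ∈ˡ zip ys zs → (x , z) ∈ˡ zip xs zs
  zip-compose (_ ∷ xs) {_ ∷ _} (_ ∷ zs) _       (here refl) (here refl) = here refl
  zip-compose (_ ∷ xs) {_ ∷ _} (_ ∷ zs) (h ∷ _) (here refl) (there q)   = contradiction refl (All.lookup h (zip-∈ˡ _ q))
  zip-compose (_ ∷ xs) {_ ∷ _} (_ ∷ zs) (h ∷ _) (there p)   (here refl) = contradiction refl (All.lookup h (zip-∈ʳ xs p))
  zip-compose (_ ∷ xs) {_ ∷ _} (_ ∷ zs) (_ ∷ u) (there p)   (there q)   = there (zip-compose xs zs u p q)

module _ {A : Set} where

  unique-++ : ∀ {x : A} xs {ys} → Unique (xs ++ ys) → x ∈ˡ xs → x ∉ˡ ys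
  unique-++ (_ ∷ xs) (h ∷ _) (here refl) q = All.lookup h (∈-++⁺ʳ xs q) refl
  unique-++ (_ ∷ xs) (_ ∷ u) (there p)   q = unique-++ xs u p q

  unique-++ˡ : ∀ (xs {ys} : List A) → Unique (xs ++ ys) → Unique xs
  unique-++ˡ []       u       = []
  unique-++ˡ (_ ∷ xs) (h ∷ u) = All.tabulate (λ p → All.lookup h (∈-++⁺ˡ p)) ∷ unique-++ˡ xs u

  unique-++ʳ : ∀ (xs {ys} : List A) → Unique (xs ++ ys) → Unique ys
  unique-++ʳ []       u       = u
  unique-++ʳ (_ ∷ xs) (_ ∷ u) = unique-++ʳ xs u

  unique-map : ∀ {B : Set} {f : A → B} {xs} → (∀ {x y} → x ∈ˡ xs → y ∈ˡ xs → f x ≡ f y → x ≡ y) →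
               Unique xs → Unique (map f xs)
  unique-map inj []            = []
  unique-map inj (_∷_ {x = x} h u) =
    avoid h (λ p → inj (here refl) (there p)) ∷ unique-map (λ p q → inj (there p) (there q)) u
    where
    avoid : ∀ {zs} → All (x ≢_) zs → (∀ {z} → z ∈ˡ zs → _ ≡ _ → x ≡ z) → All (_ ≢_) (map _ zs)
    avoid []      k = []
    avoid (n ∷ h) k = n ∘ k (here refl) ∷ avoid h (k ∘ there)

-- Mates, patched ports and their codes, and finite sets of numbers

module Mate {σ : Graph} (σ-perm : IsWPermutation σ) where

  open WPermutation σ-perm

  abstract

    mate : ℕ → ℕ
    mate x with x ∈? ports
    ... | yes p = proj₁ (port⇒dom p)
    ... | no _  = x

    mate-wire : ∀ {x} → x ∈ dom σ → σ x (mate x)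
    mate-wire {x} d with x ∈? ports
    ... | yes p = proj₂ (port⇒dom p)
    ... | no ¬p = contradiction (dom⇒port d) ¬p

  mate-≡ : ∀ {x y} → σ x y → mate x ≡ y
  mate-≡ s = functional (mate-wire (_ , s)) s

-- Ports of a net into which right-hand sides have been glued: `new i q` is
-- port q of the right-hand side of patch i.
data Port : Set where
  old : ℕ → Port
  new : Bool → ℕ → Port

module _ {A : Set} (T : REL A ℕ 0ℓ) where

  record Images (xs : List A) : Set where
    field
      list   : List ℕ
      size   : length list ≡ length xs
      image  : ∀ {y} → y ∈ˡ list → ∃ λ x → x ∈ˡ xs × T x y
      onto   : ∀ {x} → x ∈ˡ xs → ∃ λ y → y ∈ˡ list × T x y
      unique : (∀ {x y z} → T x z → T y z → x ≡ y) → Unique xs → Unique list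

  images : ∀ xs → (∀ {x} → x ∈ˡ xs → ∃ (T x)) → Images xs
  images []       f = record
    { list = [] ; size = refl ; image = λ () ; onto = λ () ; unique = λ _ _ → [] }
  images (x ∷ xs) f with y , t ← f (here refl) = record
    { list   = y ∷ list
    ; size   = cong suc size
    ; image  = λ { (here refl) → x , here refl , t
                 ; (there p) → let z , q , u = image p in z , there q , u }
    ; onto   = λ { (here refl) → y , here refl , t
                 ; (there p) → let z , q , u = onto p in z , there q , u }
    ; unique = λ { inj (h ∷ u) → All.tabulate (λ { p refl →
                     let z , q , v = image p in All.lookup h q (inj t v) }) ∷ unique inj u }
    }
    where open Images (images xs (f ∘ there))

  images-finite : (∀ {x y z} → T x y → T x z → y ≡ z) → ∀ {xs} (i : Images xs) →
                  ∀ {y} → (∃ λ x → x ∈ˡ xs × T x y) ⇔ y ∈ˡ Images.list i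
  images-finite func i = mk⇔
    (λ (x , p , t) → let z , q , u = Images.onto i p in subst (_∈ˡ _) (func u t) q)
    (Images.image i)

isWPermutation : ∀ {σ} → (∀ {x y} → σ x y → σ y x) → (∀ {x y z} → σ x y → σ x z → y ≡ z) →
                 Finite (dom σ) → IsWPermutation σ
isWPermutation sym-σ func fin = record
  { isPartialPermutation = record
    { isPartialInjection = record
      { functional = func
      ; injective  = λ s t → func (sym-σ s) (sym-σ t) }
    ; dom≐codom = (λ (_ , s) → _ , sym-σ s) , λ (_ , s) → _ , sym-σ s }
  ; involutive = λ (_ , s , t) → func (sym-σ s) t
  ; finite     = fin
  }

bound : ∀ xs → ∃ λ M → ∀ {x} → x ∈ˡ xs → x < M
bound []       = 0 , λ ()
bound (x ∷ xs) with M , below ← bound xs = suc x ⊔ M , λ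
  { (here refl) → ℕ.m≤m⊔n _ M
  ; (there p)   → ℕ.<-≤-trans (below p) (ℕ.m≤n⊔m (suc x) M) }

remainder : ∀ (d : Fin 3) x → (toℕ d + x * 3) % 3 ≡ toℕ d
remainder d x = trans ([m+kn]%n≡m%n (toℕ d) x 3) (m<n⇒m%n≡m (toℕ<n d))

digits-injective : ∀ (d e : Fin 3) {x y} → toℕ d + x * 3 ≡ toℕ e + y * 3 → d ≡ e × x ≡ y
digits-injective d e {x} {y} eq
  with refl ← toℕ-injective (trans (sym (remainder d x)) (trans (cong (_% 3) eq) (remainder e y))) =
  refl , ℕ.*-cancelʳ-≡ x y 3 (ℕ.+-cancelˡ-≡ (toℕ d) _ _ eq)

digit : Port → Fin 3
digit (old _)       = Fin.zero
digit (new true _)  = Fin.suc Fin.zero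
digit (new false _) = Fin.suc (Fin.suc Fin.zero)

index : Port → ℕ
index (old x)   = x
index (new _ x) = x

-- Residue 0 modulo 3 marks the ports of the net, residues 1 and 2 those of the two right-hand
-- sides.
code : Port → ℕ
code a = toℕ (digit a) + index a * 3

code-injective : ∀ {a b} → code a ≡ code b → a ≡ b
code-injective {a} {b} eq with digits-injective (digit a) (digit b) {index a} {index b} eq
code-injective {old _}       {old _}       eq | _ , refl = refl
code-injective {new true _}  {new true _}  eq | _ , refl = refl
code-injective {new false _} {new false _} eq | _ , refl = refl
code-injective {old _}       {new true _}  eq | () , _
code-injective {old _}       {new false _} eq | () , _
code-injective {new true _}  {old _}       eq | () , _
code-injective {new true _}  {new false _} eq | () , _
code-injective {new false _} {old _}       eq | () , _
code-injective {new false _} {new true _}  eq | () , _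

least : ∀ {P : Pred ℕ 0ℓ} → (∀ x → Dec (P x)) → ∀ xs → Any P xs →
        ∃ λ m → m ∈ˡ xs × P m × (∀ {y} → y ∈ˡ xs → P y → m ≤ y)
least P? (x ∷ xs) p with P? x | any? P? xs
least P? (x ∷ xs) (here px) | no ¬px | no _  = contradiction px ¬px
least P? (x ∷ xs) (there q) | no _   | no ¬q = contradiction q ¬q
... | yes px | no ¬q = x , here refl , px , λ
  { (here refl) _ → ℕ.≤-refl ; (there r) py → contradiction (lose r py) ¬q }
... | d | yes q with m , r , pm , min ← least P? xs q with d
...   | no ¬px = m , there r , pm , λ { (here refl) px → contradiction px ¬px ; (there r) py → min r py }
...   | yes px with ℕ.≤-total x m
...     | inj₁ x≤m = x , here refl , px , λ { (here refl) _ → ℕ.≤-refl ; (there r) py → ℕ.≤-trans x≤m (min r py) }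
...     | inj₂ m≤x = m , there r , pm , λ { (here refl) _ → m≤x ; (there r) py → min r py }

module Reduction (𝕊 : Signature) where

  open Nets 𝕊

  -- Rules and redexes

  module LeftHandSide {s₁ s₂ : Symbol} (𝓡 : Rule s₁ s₂) where

    open Rule 𝓡
    private module L = Context R-r

    Inner Principal : Pred ℕ 0ℓ
    Inner t     = t ∈ L.P-c
    Principal t = t ≡ b ⊎ t ≡ c

    private
      arms frees : List ℕ
      arms  = toList bs ++ toList cs
      frees = toList as ++ toList ds

      same-length : ∀ {n} (xs ys : Vec ℕ n) → length (toList xs) ≡ length (toList ys)
      same-length xs ys = trans (length-toList xs) (sym (length-toList ys))

      Cell : Pred ℕ 0ℓ
      Cell x = x ∈ˡ cell₁ ⊎ x ∈ˡ cell₂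

      cell-free : ∀ {x} → Cell x → x ∉ˡ frees
      cell-free (inj₁ p) q = unique-++ cell₁ distinct p (∈-++⁺ʳ cell₂ q)
      cell-free (inj₂ p) q = unique-++ cell₂ (unique-++ʳ cell₁ distinct) p q

      cell₁-cell₂ : ∀ {x} → x ∈ˡ cell₁ → x ∉ˡ cell₂
      cell₁-cell₂ p q = unique-++ cell₁ distinct p (∈-++⁺ˡ q)

      arm-cell : ∀ {x} → x ∈ˡ arms → Cell x
      arm-cell p with ∈-++⁻ (toList bs) p
      ... | inj₁ q = inj₁ (there q)
      ... | inj₂ q = inj₂ (there q)

      arm-auxiliary : ∀ {x} → x ∈ˡ arms → ¬ Principal x
      arm-auxiliary p e with ∈-++⁻ (toList bs) p
      arm-auxiliary p (inj₁ refl) | inj₁ q with h ∷ _ ← distinct = All.lookup h (∈-++⁺ˡ q) refl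
      arm-auxiliary p (inj₂ refl) | inj₁ q = cell₁-cell₂ (there q) (here refl)
      arm-auxiliary p (inj₁ refl) | inj₂ q = cell₁-cell₂ (here refl) (there q)
      arm-auxiliary p (inj₂ refl) | inj₂ q with h ∷ _ ← unique-++ʳ cell₁ distinct = All.lookup h (∈-++⁺ˡ q) refl

      auxiliary-arm : ∀ {x} → Cell x → ¬ Principal x → x ∈ˡ arms
      auxiliary-arm (inj₁ (here e))  n = contradiction (inj₁ e) n
      auxiliary-arm (inj₁ (there p)) n = ∈-++⁺ˡ p
      auxiliary-arm (inj₂ (here e))  n = contradiction (inj₂ e) n
      auxiliary-arm (inj₂ (there p)) n = ∈-++⁺ʳ (toList bs) p

      -- The two possible shapes of a wire of a left-hand side: it joins the principal ports, or a
      -- free port and an auxiliary one. The facts about the interface below are case analyses on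
      -- this.
      Link : Graph
      Link x y = (x ≡ b × y ≡ c) ⊎ (x ∈ˡ frees × y ∈ˡ arms) ⊎ (x ∈ˡ arms × y ∈ˡ frees)

      link : ∀ {x y} → (x , y) ∈ˡ (b , c) ∷ zip (toList as) (toList bs) ++ zip (toList cs) (toList ds) → Link x y
      link (here refl) = inj₁ (refl , refl)
      link (there p) with ∈-++⁻ (zip (toList as) (toList bs)) p
      ... | inj₁ q = inj₂ (inj₁ (∈-++⁺ˡ (zip-∈ˡ _ q) , ∈-++⁺ˡ (zip-∈ʳ (toList as) q)))
      ... | inj₂ q = inj₂ (inj₂ (∈-++⁺ʳ (toList bs) (zip-∈ˡ _ q) , ∈-++⁺ʳ (toList as) (zip-∈ʳ (toList cs) q)))

      wire-link : ∀ {x y} → L.wire x y → Link x y ⊎ Link y x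
      wire-link w with proj₁ r-wire w
      ... | inj₁ p = inj₁ (link p)
      ... | inj₂ p = inj₂ (link p)

      inner⇒cell : ∀ {x} → Inner x → Cell x
      inner⇒cell p with _ , l ← to (L.label-dom _) p with to (r-label _ _) l
      ... | inj₁ (q , _) = inj₁ q
      ... | inj₂ (q , _) = inj₂ q

      cell⇒inner : ∀ {x} → Cell x → Inner x
      cell⇒inner (inj₁ p) = from (L.label-dom _) (_ , from (r-label _ _) (inj₁ (p , refl)))
      cell⇒inner (inj₂ p) = from (L.label-dom _) (_ , from (r-label _ _) (inj₂ (p , refl)))

      module W = WPermutation L.wire-isWPermutation

    I : List ℕ
    I = interface
      where open Context R-r

    b-inner : Inner b
    b-inner = cell⇒inner (inj₁ (here refl))

    c-inner : Inner c
    c-inner = cell⇒inner (inj₂ (here refl))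

    b-c : L.wire b c
    b-c = proj₂ r-wire (inj₁ (here refl))

    I-free : ∀ {r} → r ∈ˡ I → r ∈ L.P-f
    I-free = All.lookup (IsInterface.free (Context.isInterface R-r))

    I-outer : ∀ {r} → r ∈ˡ I → ¬ Inner r
    I-outer = proj₂ ∘ I-free

    I-mate : ∀ {r t} → r ∈ˡ I → L.wire r t → Inner t × ¬ Principal t
    I-mate p w with wire-link w
    ... | inj₁ (inj₁ (refl , _))       = contradiction b-inner (I-outer p)
    ... | inj₁ (inj₂ (inj₁ (_ , q)))   = cell⇒inner (arm-cell q) , arm-auxiliary q
    ... | inj₁ (inj₂ (inj₂ (q , _)))   = contradiction (cell⇒inner (arm-cell q)) (I-outer p)
    ... | inj₂ (inj₁ (_ , refl))       = contradiction c-inner (I-outer p)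
    ... | inj₂ (inj₂ (inj₁ (_ , q)))   = contradiction (cell⇒inner (arm-cell q)) (I-outer p)
    ... | inj₂ (inj₂ (inj₂ (q , _)))   = cell⇒inner (arm-cell q) , arm-auxiliary q

    private
      -- This is where the interface of the left-hand side is required to be canonical.
      free-I : ∀ {x y} → x ∈ˡ frees → L.wire x y → x ∈ˡ I
      free-I p w = r-canonical (((_ , w) , proper) , λ i → cell-free (inner⇒cell i) p)
        where
        proper : ¬ L.wire _ _
        proper v with wire-link v
        ... | inj₁ (inj₁ (refl , _))     = cell-free (inj₁ (here refl)) p
        ... | inj₁ (inj₂ (inj₁ (_ , q))) = cell-free (arm-cell q) p
        ... | inj₁ (inj₂ (inj₂ (q , _))) = cell-free (arm-cell q) p
        ... | inj₂ (inj₁ (refl , _))     = cell-free (inj₁ (here refl)) p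
        ... | inj₂ (inj₂ (inj₁ (_ , q))) = cell-free (arm-cell q) p
        ... | inj₂ (inj₂ (inj₂ (q , _))) = cell-free (arm-cell q) p

    auxiliary-mate : ∀ {t} → Inner t → ¬ Principal t → ∃ λ r → r ∈ˡ I × L.wire r t
    auxiliary-mate i n with ∈-++⁻ (toList bs) (auxiliary-arm (inner⇒cell i) n)
    ... | inj₁ p with a , q ← zip-onto (toList as) (toList bs) (same-length as bs) p =
      a , free-I (∈-++⁺ˡ (zip-∈ˡ _ q)) w , w
      where w = proj₂ r-wire (inj₁ (there (∈-++⁺ˡ q)))
    ... | inj₂ p with d , q ← zip-total (toList cs) (toList ds) (same-length cs ds) p =
      d , free-I (∈-++⁺ʳ (toList as) (zip-∈ʳ (toList cs) q)) w , w
      where w = proj₂ r-wire (inj₂ (there (∈-++⁺ʳ (zip (toList as) (toList bs)) q)))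

    outer-I : ∀ {x} → x ∈ L.carrier → ¬ Inner x → x ∈ˡ I
    outer-I (_ , w) n with wire-link w
    ... | inj₁ (inj₁ (refl , _))     = contradiction b-inner n
    ... | inj₁ (inj₂ (inj₁ (p , _))) = free-I p w
    ... | inj₁ (inj₂ (inj₂ (p , _))) = contradiction (cell⇒inner (arm-cell p)) n
    ... | inj₂ (inj₁ (_ , refl))     = contradiction c-inner n
    ... | inj₂ (inj₂ (inj₁ (_ , p))) = contradiction (cell⇒inner (arm-cell p)) n
    ... | inj₂ (inj₂ (inj₂ (_ , p))) = free-I p w

    inner? : ∀ t → Dec (Inner t)
    inner? t with t ∈? proj₁ L.cell-finite
    ... | yes p = yes (from (proj₂ L.cell-finite t) p)
    ... | no ¬p = no (¬p ∘ to (proj₂ L.cell-finite t))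

  -- A rule together with a placement ι of the ports of its two cells.
  record Patch : Set₁ where
    field
      {s₁ s₂} : Symbol
      𝓡       : Rule s₁ s₂
      ι       : ℕ → ℕ

    open Rule 𝓡 public
    open LeftHandSide 𝓡 public

    module L = Context R-r
    module R = Context R-p

    open Mate L.wire-isWPermutation public

    -- The interface port `r` is hidden by the gluing that produces the source of a step. The
    -- auxiliary port at the other end of its wire is not hidden, so it stands for `r` in the
    -- source.
    attach : ℕ → ℕ
    attach r = ι (mate r)

    Removed Active : Pred ℕ 0ℓ
    Removed x = ∃ λ t → Inner t × x ≡ ι t
    Active x  = x ≡ ι b ⊎ x ≡ ι c

    glue : Graph
    glue = matching (map attach I) R.interface

    removed? : ∀ x → Dec (Removed x)
    removed? x = map′ (λ p → let t , q , e = ∈-map⁻ ι p in t , from (proj₂ L.cell-finite t) q , e)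
                      (λ { (t , i , refl) → ∈-map⁺ ι (to (proj₂ L.cell-finite t) i) })
                      (x ∈? map ι (proj₁ L.cell-finite))

    active? : ∀ x → Dec (Active x)
    active? x = (x ≟ ι b) ⊎-dec (x ≟ ι c)

    active-removed : ∀ {x} → Active x → Removed x
    active-removed (inj₁ e) = b , b-inner , e
    active-removed (inj₂ e) = c , c-inner , e

    I-wire : ∀ {r} → r ∈ˡ I → L.wire r (mate r)
    I-wire p = mate-wire (proj₁ (proj₁ (I-free p)))

    glue-free : ∀ {s q} → glue s q → q ∈ R.P-f
    glue-free p = All.lookup (IsInterface.free R.isInterface) (zip-∈ʳ (map attach I) p)

    glue-injective : ∀ {s t q} → glue s q → glue t q → s ≡ t
    glue-injective = zip-injective (map attach I) (IsInterface.unique R.isInterface)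

    attach-glue : ∀ {r} → r ∈ˡ I → ∃ λ q → (r , q) ∈ˡ zip I R.interface × glue (attach r) q
    attach-glue p with q , m ← zip-total I R.interface same-size p = q , m , glued m
      where
      glued : ∀ {r q} → (r , q) ∈ˡ zip I R.interface → glue (attach r) q
      glued {r} {q} m = subst (λ J → (attach r , q) ∈ˡ zip (map attach I) J) (map-id _)
                              (zip-map⁺ attach id I R.interface m)

    glue-attach : ∀ {s q} → glue s q → ∃ λ r → (r , q) ∈ˡ zip I R.interface × s ≡ attach r
    glue-attach {s} {q} p with r , q , m , e , refl ← zip-map⁻ attach id I R.interface
                         (subst (λ J → (s , q) ∈ˡ zip (map attach I) J) (sym (map-id _)) p) = r , m , e

  -- Only the cells and the wire between their principal ports are located in `S`. The other wires
  -- of the left-hand side are absorbed by the gluing, and what an auxiliary port is wired to is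
  -- left open: it may be another auxiliary port of the same redex.
  record Redex (S : Net) (p : Patch) : Set where
    open Patch p
    private module S = Net S
    field
      ι-injective : ∀ {t u} → Inner t → Inner u → ι t ≡ ι u → t ≡ u
      wire-b-c    : S.wire (ι b) (ι c)
      cell⇒       : ∀ {t u} → L.cell t u → S.cell (ι t) (ι u)
      cell⇐       : ∀ {t u} → Inner t → Inner u → S.cell (ι t) (ι u) → L.cell t u
      cell-from   : ∀ {t y} → Inner t → S.cell (ι t) y → Removed y
      cell-to     : ∀ {t y} → Inner t → S.cell y (ι t) → Removed y
      principal⇒  : ∀ {t} → Inner t → L.principal t → S.principal (ι t)
      principal⇐  : ∀ {t} → Inner t → S.principal (ι t) → L.principal t
      label⇒      : ∀ {t s} → Inner t → L.label t s → S.label (ι t) s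
      label⇐      : ∀ {t s} → Inner t → S.label (ι t) s → L.label t s

    private module W = WPermutation S.wire-isWPermutation

    removed-P-c : ∀ {x} → Removed x → x ∈ S.P-c
    removed-P-c (t , (_ , i) , refl) = _ , cell⇒ i

    removed-P : ∀ {x} → Removed x → x ∈ S.P
    removed-P = S.P-c⊆P ∘ removed-P-c

    active-wire : ∀ {x y} → Active x → S.wire x y → Active y
    active-wire (inj₁ refl) w = inj₂ (W.functional w wire-b-c)
    active-wire (inj₂ refl) w = inj₁ (W.functional w (W.symmetric wire-b-c))

    attach-removed : ∀ {r} → r ∈ˡ I → Removed (attach r)
    attach-removed p = _ , proj₁ (I-mate p (I-wire p)) , refl

    attach-inactive : ∀ {r} → r ∈ˡ I → ¬ Active (attach r)
    attach-inactive p with i , n ← I-mate p (I-wire p) = λ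
      { (inj₁ e) → n (inj₁ (ι-injective i b-inner e))
      ; (inj₂ e) → n (inj₂ (ι-injective i c-inner e)) }

    attach-injective : ∀ {r u} → r ∈ˡ I → u ∈ˡ I → attach r ≡ attach u → r ≡ u
    attach-injective p q e =
      IsWPermutation.injective L.wire-isWPermutation (I-wire p)
        (subst (L.wire _) (sym (ι-injective (proj₁ (I-mate p (I-wire p))) (proj₁ (I-mate q (I-wire q))) e)) (I-wire q))

    glue-functional : ∀ {s q u} → glue s q → glue s u → q ≡ u
    glue-functional = zip-functional R.interface (unique-map attach-injective (IsInterface.unique L.isInterface))

    glue-removed : ∀ {s q} → glue s q → Removed s
    glue-removed g with r , m , refl ← glue-attach g = attach-removed (zip-∈ˡ _ m)

    glue-inactive : ∀ {s q} → glue s q → ¬ Active s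
    glue-inactive g with r , m , refl ← glue-attach g = attach-inactive (zip-∈ˡ _ m)

    removed-attach : ∀ {x} → Removed x → Active x ⊎ ∃ λ r → r ∈ˡ I × x ≡ attach r
    removed-attach (t , i , refl) with t ≟ b | t ≟ c
    ... | yes refl | _        = inj₁ (inj₁ refl)
    ... | no _     | yes refl = inj₁ (inj₂ refl)
    ... | no ¬b    | no ¬c with r , p , w ← auxiliary-mate i [ ¬b , ¬c ]′ =
      inj₂ (r , p , cong ι (sym (mate-≡ w)))

    removed-glued : ∀ {x} → Removed x → Active x ⊎ ∃ (glue x)
    removed-glued d with removed-attach d
    ... | inj₁ a = inj₁ a
    ... | inj₂ (_ , p , refl) with q , _ , g ← attach-glue p = inj₂ (q , g)

  -- `act` selects the patches that are applied, so that one construction serves for a single step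
  -- (`Only`) and for the two steps at once (`Both`).
  module System (S : Net) (act : Pred Bool 0ℓ) (ps : Bool → Patch) where

    private
      module S = Net S
      module p i = Patch (ps i)

    -- Only the wire between the principal ports disappears. The auxiliary ports of a redex lose
    -- their cells but stay as the places to which the right-hand side is glued.
    data Wire : Rel Port 0ℓ where
      old : ∀ {x y} → S.wire x y → (∀ {i} → act i → ¬ p.Active i x) → Wire (old x) (old y)
      new : ∀ {i x y} → act i → p.R.wire i x y → Wire (new i x) (new i y)

    -- The interface ports of a left-hand side are left out: a port of the redex is
    -- glued directly to the port of the right-hand side that replaces it.
    data Glue : Rel Port 0ℓ where
      down : ∀ {i s q} → act i → p.glue i s q → Glue (old s) (new i q)
      up   : ∀ {i s q} → act i → p.glue i s q → Glue (new i q) (old s)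

    data Cell : Rel Port 0ℓ where
      old : ∀ {x y} → S.cell x y → (∀ {i} → act i → ¬ p.Removed i x) → Cell (old x) (old y)
      new : ∀ {i x y} → act i → p.R.cell i x y → Cell (new i x) (new i y)

    data Principal : Pred Port 0ℓ where
      old : ∀ {x} → S.principal x → (∀ {i} → act i → ¬ p.Removed i x) → Principal (old x)
      new : ∀ {i x} → act i → p.R.principal i x → Principal (new i x)

    data Label : REL Port Symbol 0ℓ where
      old : ∀ {x s} → S.label x s → (∀ {i} → act i → ¬ p.Removed i x) → Label (old x) s
      new : ∀ {i x s} → act i → p.R.label i x s → Label (new i x) s

  record IsSystem (S : Net) (act : Pred Bool 0ℓ) (ps : Bool → Patch) : Set where
    field
      act?     : ∀ i → Dec (act i)
      redex    : ∀ {i} → act i → Redex S (ps i)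
      disjoint : ∀ {i j x} → act i → act j → x ∈ Patch.Removed (ps i) → x ∈ Patch.Removed (ps j) → i ≡ j

    private
      module S = Net S
      module SW = WPermutation S.wire-isWPermutation
      module p i = Patch (ps i)
      module RW i = WPermutation (p.R.wire-isWPermutation i)

    open System S act ps

    glue-inactive : ∀ {i j s q} → act i → act j → p.glue i s q → ¬ p.Active j s
    glue-inactive {i} {j} α α′ g a
      with refl ← disjoint α α′ (Redex.glue-removed (redex α) g) (p.active-removed j a) =
      Redex.glue-inactive (redex α) g a

    private
      sym-inactive : ∀ {x y} → S.wire x y → (∀ {i} → act i → ¬ p.Active i x) → ∀ {i} → act i → ¬ p.Active i y
      sym-inactive w n α a = n α (Redex.active-wire (redex α) a (SW.symmetric w))

      inactive? : ∀ x → Dec (∀ {i} → act i → ¬ p.Active i x)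
      inactive? x with act? true →-dec ¬? (p.active? true x) | act? false →-dec ¬? (p.active? false x)
      ... | yes m | yes n = yes λ { {true} → m ; {false} → n }
      ... | no ¬m | _     = no λ f → ¬m f
      ... | yes _ | no ¬n = no λ f → ¬n f

      newPorts : Bool → List Port
      newPorts i with act? i
      ... | yes _ = map (new i) (RW.ports i)
      ... | no _  = []

      ∈-newPorts : ∀ {i x} → act i → x ∈ dom (p.R.wire i) → new i x ∈ˡ newPorts i
      ∈-newPorts {i} α d with act? i
      ... | yes _ = ∈-map⁺ (new i) (RW.dom⇒port i d)
      ... | no ¬α = contradiction α ¬α

      newPorts-W : ∀ i {a} → a ∈ˡ newPorts i → ∃ (Wire a)
      newPorts-W i m with act? i
      ... | yes α with _ , m′ , refl ← ∈-map⁻ (new i) m with _ , w ← RW.port⇒dom i m′ = _ , new α w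

      oldPorts : List Port
      oldPorts = map old (filter inactive? SW.ports)

    isWiring : IsWiring Wire Glue
    isWiring = record
      { W-sym    = λ { (old w n) → old (SW.symmetric w) (sym-inactive w n)
                     ; (new {i} α w) → new α (RW.symmetric i w) }
      ; W-func   = λ { (old w _) (old w′ _) → cong old (SW.functional w w′)
                     ; (new {i} _ w) (new _ w′) → cong (new i) (RW.functional i w w′) }
      ; g-sym    = λ { (down α g) → up α g ; (up α g) → down α g }
      ; g-func   = g-func
      ; g-wired  = g-wired
      ; g-proper = g-proper
      ; g-irrefl = λ ()
      ; g?       = g?
      ; ports    = oldPorts ++ newPorts true ++ newPorts false
      ; W⇒port   = W⇒port
      ; port⇒W   = [ old-W , [ newPorts-W true , newPorts-W false ]′ ∘ ∈-++⁻ (newPorts true) ]′ ∘ ∈-++⁻ oldPorts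
      }
      where
      g-func : ∀ {a b c} → Glue a b → Glue a c → b ≡ c
      g-func (down α g) (down α′ g′)
        with refl ← disjoint α α′ (Redex.glue-removed (redex α) g) (Redex.glue-removed (redex α′) g′) =
        cong (new _) (Redex.glue-functional (redex α) g g′)
      g-func (up {i} α g) (up α′ g′) = cong old (p.glue-injective i g g′)

      g-wired : ∀ {a b} → Glue a b → ∃ (Wire a)
      g-wired (down α g) with (_ , w) , _ ← Redex.removed-P (redex α) (Redex.glue-removed (redex α) g) =
        _ , old w (λ α′ → glue-inactive α α′ g)
      g-wired (up {i} α g) with ((_ , w) , _) , _ ← p.glue-free i g = _ , new α w

      g-proper : ∀ {a b} → Glue a b → ¬ Wire a a
      g-proper (down α g) (old w _) = proj₂ (Redex.removed-P (redex α) (Redex.glue-removed (redex α) g)) w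
      g-proper (up {i} α g) (new _ w) = proj₂ (proj₁ (p.glue-free i g)) w

      dom-glue? : ∀ i s → Dec (∃ (p.glue i s))
      dom-glue? i s with s ∈? map (p.attach i) (p.I i)
      ... | yes m = yes (zip-total _ _ (trans (length-map _ (p.I i)) (p.same-size i)) m)
      ... | no ¬m = no λ (_ , g) → ¬m (zip-∈ˡ _ g)

      g? : ∀ a → Dec (∃ (Glue a))
      g? (old s) with act? true | act? false | dom-glue? true s | dom-glue? false s
      ... | yes α | _     | yes (_ , g) | _           = yes (_ , down α g)
      ... | _     | yes α | _           | yes (_ , g) = yes (_ , down α g)
      ... | no ¬α | no ¬β | _           | _           = no λ { (_ , down {true} α _) → ¬α α ; (_ , down {false} α _) → ¬β α }
      ... | no ¬α | _     | _           | no ¬g       = no λ { (_ , down {true} α _) → ¬α α ; (_ , down {false} _ g) → ¬g (_ , g) }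
      ... | _     | no ¬β | no ¬g       | _           = no λ { (_ , down {true} _ g) → ¬g (_ , g) ; (_ , down {false} α _) → ¬β α }
      ... | yes _ | yes _ | no ¬g       | no ¬h       = no λ { (_ , down {true} _ g) → ¬g (_ , g) ; (_ , down {false} _ g) → ¬h (_ , g) }
      g? (new i q) with act? i | q ∈? p.R.interface i
      ... | yes α | yes m with _ , g ← zip-onto (map (p.attach i) (p.I i)) (p.R.interface i)
                                          (trans (length-map _ (p.I i)) (p.same-size i)) m = yes (_ , up α g)
      g? (new i q) | no ¬α | _     = no λ { (_ , up α _) → ¬α α }
      g? (new i q) | _     | no ¬m = no λ { (_ , up _ g) → ¬m (zip-∈ʳ (map (p.attach i) (p.I i)) g) }

      W⇒port : ∀ {a b} → Wire a b → a ∈ˡ oldPorts ++ newPorts true ++ newPorts false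
      W⇒port (old w n) = ∈-++⁺ˡ (∈-map⁺ old (∈-filter⁺ inactive? (SW.dom⇒port (_ , w)) n))
      W⇒port (new {true}  α w) = ∈-++⁺ʳ oldPorts (∈-++⁺ˡ (∈-newPorts α (_ , w)))
      W⇒port (new {false} α w) = ∈-++⁺ʳ oldPorts (∈-++⁺ʳ (newPorts true) (∈-newPorts α (_ , w)))

      old-W : ∀ {a} → a ∈ˡ oldPorts → ∃ (Wire a)
      old-W m with x , m′ , refl ← ∈-map⁻ old m with k , n ← ∈-filter⁻ inactive? {xs = SW.ports} m′
        with _ , w ← SW.port⇒dom k = _ , old w n

  -- Constructions of nets

  -- `T` may be partial. What matters is that it is closed under steps of both cell permutations,
  -- forwards and (fields marked `ᵒ`) backwards, so that it carries whole orbits in either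
  -- direction.
  record Embedding (N : Net) (K : RawNet) (T : REL ℕ ℕ 0ℓ) : Set where
    private
      module N = Net N
      module K = RawNet K
    field
      func       : ∀ {p m n} → T p m → T p n → m ≡ n
      inj        : ∀ {p q n} → T p n → T q n → p ≡ q
      cell⇒      : ∀ {p q n} → T p n → N.cell p q → ∃ λ m → T q m × K.cell n m
      cell⇒ᵒ     : ∀ {p q n} → T p n → N.cell q p → ∃ λ m → T q m × K.cell m n
      cell⇐      : ∀ {p m n} → T p n → K.cell n m → ∃ λ q → T q m × N.cell p q
      cell⇐ᵒ     : ∀ {p m n} → T p n → K.cell m n → ∃ λ q → T q m × N.cell q p
      principal⇒ : ∀ {p n} → T p n → N.principal p → K.principal n
      principal⇐ : ∀ {p n} → T p n → K.principal n → N.principal p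
      label⇒     : ∀ {p n s} → T p n → N.label p s → K.label n s
      label⇐     : ∀ {p n s} → T p n → K.label n s → N.label p s

    orbit⇒ : ∀ i {p q n} → T p n → (N.cell ^ i) p q → ∃ λ m → T q m × (K.cell ^ i) n m
    orbit⇒ zero    t refl        = _ , t , refl
    orbit⇒ (suc i) t (_ , o , s) with _ , u , o′ ← orbit⇒ i t o with _ , v , s′ ← cell⇒ u s =
      _ , v , _ , o′ , s′

    orbit⇐ : ∀ i {p m n} → T p n → (K.cell ^ i) n m → ∃ λ q → T q m × (N.cell ^ i) p q
    orbit⇐ zero    t refl        = _ , t , refl
    orbit⇐ (suc i) t (_ , o , s) with _ , u , o′ ← orbit⇐ i t o with _ , v , s′ ← cell⇐ u s =
      _ , v , _ , o′ , s′

  record Covered (K : RawNet) (n : ℕ) : Set₁ where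
    constructor covered
    field
      {N}       : Net
      {T}       : REL ℕ ℕ 0ℓ
      embedding : Embedding N K T
      {p}       : ℕ
      at        : T p n

  Cellular : RawNet → Pred ℕ 0ℓ
  Cellular K n = n ∈ RawNet.P-c K ⊎ RawNet.principal K n ⊎ ∃ (RawNet.label K n)

  -- The conditions on cells only concern one orbit at a time, so they can be
  -- checked in any net in which that orbit embeds.
  isNet : (K : RawNet) → (∀ {n} → Cellular K n → Covered K n) →
          IsWPermutation (RawNet.wire K) → Finite (RawNet.P-c K) →
          (∀ {x} → x ∈ RawNet.P-c K → x ∈ RawNet.P K) → IsNet K
  isNet K cover w f proper = record
    { wire-isWPermutation       = w
    ; cell-isPartialPermutation = record
      { isPartialInjection = record { functional = functional ; injective = injective }
      ; dom≐codom          = dom⊆codom , codom⊆dom }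
    ; cell-finite               = f
    ; P-c⊆P                     = proper
    ; principal⊆P-c             = principal-cell
    ; principal-exists          = principal-exists
    ; principal-unique          = principal-unique
    ; label-dom                 = λ x → mk⇔ label-exists λ (_ , l) → label-cell l
    ; label-functional          = λ l → label-functional l
    ; label-orbit               = label-orbit
    ; label-arity               = label-arity
    }
    where
    open RawNet K

    functional : ∀ {x y z} → cell x y → cell x z → y ≡ z
    functional s t with covered {N} e a ← cover (inj₁ (_ , s))
      with _ , b , s′ ← Embedding.cell⇐ e a s | _ , c , t′ ← Embedding.cell⇐ e a t
      with refl ← IsPartialPermutation.functional (Net.cell-isPartialPermutation N) s′ t′ = Embedding.func e b c

    injective : ∀ {x y z} → cell x z → cell y z → x ≡ y
    injective s t with covered {N} e a ← cover (inj₁ (_ , s))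
      with _ , b , s′ ← Embedding.cell⇐ e a s with _ , c , t′ ← Embedding.cell⇐ᵒ e b t
      with refl ← IsPartialPermutation.injective (Net.cell-isPartialPermutation N) s′ t′ = Embedding.func e a c

    dom⊆codom : ∀ {x} → x ∈ dom cell → x ∈ codom cell
    dom⊆codom (_ , s) with covered {N} e a ← cover (inj₁ (_ , s)) with _ , _ , s′ ← Embedding.cell⇐ e a s
      with _ , t ← proj₁ (IsPartialPermutation.dom≐codom (Net.cell-isPartialPermutation N)) (_ , s′)
      with _ , _ , t′ ← Embedding.cell⇒ᵒ e a t = _ , t′

    codom⊆dom : ∀ {x} → x ∈ codom cell → x ∈ dom cell
    codom⊆dom (_ , s) with covered {N} e a ← cover (inj₁ (_ , s)) with _ , b , s′ ← Embedding.cell⇐ e a s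
      with _ , t ← proj₂ (IsPartialPermutation.dom≐codom (Net.cell-isPartialPermutation N)) (_ , s′)
      with _ , _ , t′ ← Embedding.cell⇒ e b t = _ , t′

    principal-cell : ∀ {x} → x ∈ principal → x ∈ P-c
    principal-cell p with covered {N} e a ← cover (inj₂ (inj₁ p))
      with _ , s ← Net.principal⊆P-c N (Embedding.principal⇐ e a p)
      with _ , _ , s′ ← Embedding.cell⇒ e a s = _ , s′

    label-cell : ∀ {x s} → label x s → x ∈ P-c
    label-cell l with covered {N} e a ← cover (inj₂ (inj₂ (_ , l)))
      with _ , s ← from (Net.label-dom N _) (_ , Embedding.label⇐ e a l)
      with _ , _ , s′ ← Embedding.cell⇒ e a s = _ , s′

    label-exists : ∀ {x} → x ∈ P-c → ∃ (label x)
    label-exists (_ , s) with covered {N} e a ← cover (inj₁ (_ , s)) with _ , _ , s′ ← Embedding.cell⇐ e a s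
      with _ , l ← to (Net.label-dom N _) (_ , s′) = _ , Embedding.label⇒ e a l

    principal-exists : ∀ {x} → x ∈ P-c → ∃ λ p → p ∈ Orbit cell x × p ∈ principal
    principal-exists (_ , s) with covered {N} e a ← cover (inj₁ (_ , s)) with _ , _ , s′ ← Embedding.cell⇐ e a s
      with _ , (i , o) , p ← Net.principal-exists N (_ , s′)
      with _ , b , o′ ← Embedding.orbit⇒ e i a o = _ , (i , o′) , Embedding.principal⇒ e b p

    principal-unique : ∀ {p q} → p ∈ principal → q ∈ principal → q ∈ Orbit cell p → p ≡ q
    principal-unique p q (i , o) with covered {N} e a ← cover (inj₂ (inj₁ p))
      with _ , b , o′ ← Embedding.orbit⇐ e i a o
      with refl ← Net.principal-unique N (Embedding.principal⇐ e a p) (Embedding.principal⇐ e b q) (i , o′) =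
      Embedding.func e a b

    label-functional : ∀ {x s t} → label x s → label x t → s ≡ t
    label-functional l k with covered {N} e a ← cover (inj₂ (inj₂ (_ , l))) =
      Net.label-functional N (Embedding.label⇐ e a l) (Embedding.label⇐ e a k)

    label-orbit : ∀ {x y s} → y ∈ Orbit cell x → label x s → label y s
    label-orbit (i , o) l with covered {N} e a ← cover (inj₂ (inj₂ (_ , l)))
      with _ , b , o′ ← Embedding.orbit⇐ e i a o =
      Embedding.label⇒ e b (Net.label-orbit N (i , o′) (Embedding.label⇐ e a l))

    label-arity : ∀ {x s} → label x s → HasSize (Orbit cell x) (suc (ar s))
    label-arity l with covered {N} {T} e a ← cover (inj₂ (inj₂ (_ , l)))
      with xs , u , size , m ← Net.label-arity N (Embedding.label⇐ e a l)
      -- The enumeration of the orbit in `N` is carried along `T`, whose injectivity keeps it free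
      -- of duplicates.
      with I ← images T xs (λ p → let i , o = from (m _) p ; _ , t , _ = Embedding.orbit⇒ e i a o in _ , t) =
      Images.list I , Images.unique I (Embedding.inj e) u , trans (Images.size I) size ,
      λ y → mk⇔
        (λ (i , o) → let q , t , o′ = Embedding.orbit⇐ e i a o in
                     to (images-finite T (Embedding.func e) I) (q , to (m q) (i , o′) , t))
        (λ p → let q , r , t = Images.image I p ; i , o = from (m q) r ; _ , t′ , o′ = Embedding.orbit⇒ e i a o in
               i , subst ((cell ^ i) _) (Embedding.func e t′ t) o′)

  module Image (N : Net) (f : ℕ → ℕ)
               (f-inj : ∀ {x y} → x ∈ Net.carrier N → y ∈ Net.carrier N → f x ≡ f y → x ≡ y) where

    private
      module N = Net N
      module W = WPermutation N.wire-isWPermutation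

    lift₂ : Graph → Graph
    lift₂ r m n = ∃₂ λ x y → r x y × f x ≡ m × f y ≡ n

    raw : RawNet
    raw = record
      { wire      = lift₂ N.wire
      ; cell      = lift₂ N.cell
      ; principal = λ n → ∃ λ x → N.principal x × f x ≡ n
      ; label     = λ n s → ∃ λ x → N.label x s × f x ≡ n
      }

    private
      cell-carrier : ∀ {x} → x ∈ N.P-c → x ∈ N.carrier
      cell-carrier = proj₁ ∘ N.P-c⊆P

      codom-carrier : ∀ {x y} → N.cell x y → y ∈ N.carrier
      codom-carrier s = cell-carrier (proj₂ (IsPartialPermutation.dom≐codom N.cell-isPartialPermutation) (_ , s))

      principal-carrier : ∀ {x} → N.principal x → x ∈ N.carrier
      principal-carrier = cell-carrier ∘ N.principal⊆P-c

      label-carrier : ∀ {x s} → N.label x s → x ∈ N.carrier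
      label-carrier l = cell-carrier (from (N.label-dom _) (_ , l))

      T : REL ℕ ℕ 0ℓ
      T p n = p ∈ N.carrier × f p ≡ n

      embedding : Embedding N raw T
      embedding = record
        { func   = λ { (_ , refl) (_ , refl) → refl }
        ; inj    = λ (d , e) (d′ , e′) → f-inj d d′ (trans e (sym e′))
        ; cell⇒  = λ (_ , e) s → _ , (codom-carrier s , refl) , _ , _ , s , e , refl
        ; cell⇒ᵒ = λ (_ , e) s → _ , (cell-carrier (_ , s) , refl) , _ , _ , s , refl , e
        ; cell⇐  = λ { (d , e) (_ , _ , s , e′ , e″) → _ , (codom-carrier s , e″) ,
                       subst (λ x → N.cell x _) (f-inj (cell-carrier (_ , s)) d (trans e′ (sym e))) s }
        ; cell⇐ᵒ = λ { (d , e) (_ , _ , s , e′ , e″) → _ , (cell-carrier (_ , s) , e′) ,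
                       subst (N.cell _) (f-inj (codom-carrier s) d (trans e″ (sym e))) s }
        ; principal⇒ = λ (_ , e) p → _ , p , e
        ; principal⇐ = λ (d , e) (_ , p , e′) → subst N.principal (f-inj (principal-carrier p) d (trans e′ (sym e))) p
        ; label⇒     = λ (_ , e) l → _ , l , e
        ; label⇐     = λ (d , e) (_ , l , e′) → subst (λ x → N.label x _) (f-inj (label-carrier l) d (trans e′ (sym e))) l
        }

      func : ∀ {x y z} → lift₂ N.wire x y → lift₂ N.wire x z → y ≡ z
      func (_ , _ , w , refl , refl) (_ , _ , v , e , refl)
        with refl ← f-inj (_ , v) (_ , w) e = cong f (W.functional w v)

    image : Net
    image = record
      { raw   = raw
      ; isNet = isNet raw
          (λ { (inj₁ (_ , _ , _ , s , e , _)) → covered embedding (cell-carrier (_ , s) , e)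
             ; (inj₂ (inj₁ (_ , p , e)))      → covered embedding (principal-carrier p , e)
             ; (inj₂ (inj₂ (_ , _ , l , e)))  → covered embedding (label-carrier l , e) })
          (isWPermutation (λ (_ , _ , w , e , e′) → _ , _ , W.symmetric w , e′ , e) func
            (map f W.ports , λ n → mk⇔
              (λ { (_ , _ , _ , w , refl , _) → ∈-map⁺ f (W.dom⇒port (_ , w)) })
              (λ p → let _ , q , e = ∈-map⁻ f p ; _ , w = W.port⇒dom q in _ , _ , _ , w , sym e , refl)))
          (map f (proj₁ N.cell-finite) , λ n → mk⇔
            (λ { (_ , _ , _ , s , refl , _) → ∈-map⁺ f (to (proj₂ N.cell-finite _) (_ , s)) })
            (λ p → let _ , q , e = ∈-map⁻ f p ; _ , s = from (proj₂ N.cell-finite _) q in _ , _ , _ , s , sym e , refl))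
          (λ { (_ , _ , _ , s , refl , _) → let (_ , w) , ¬w = N.P-c⊆P (_ , s) in
               (_ , _ , _ , w , refl , refl) ,
               λ { (_ , _ , v , e , e′) → ¬w (subst₂ N.wire (f-inj (_ , v) (_ , w) e)
                                                (f-inj (_ , W.symmetric v) (_ , w) e′) v) } })
      }

    isRenaming : Renaming N.raw raw
    isRenaming = record
      { to            = f
      ; to-carrier    = λ (_ , w) → _ , _ , _ , w , refl , refl
      ; to-injective  = f-inj
      ; to-surjective = λ (_ , _ , _ , w , e , _) → _ , (_ , w) , e
      ; to-wire       = λ d d′ → mk⇔ (λ w → _ , _ , w , refl , refl)
                          λ (_ , _ , w , e , e′) → subst₂ N.wire (f-inj (_ , w) d e) (f-inj (_ , W.symmetric w) d′ e′) w
      ; to-cell       = λ d d′ → mk⇔ (λ s → _ , _ , s , refl , refl)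
                          λ (_ , _ , s , e , e′) → subst₂ N.cell (f-inj (cell-carrier (_ , s)) d e) (f-inj (codom-carrier s) d′ e′) s
      ; to-principal  = λ d → mk⇔ (λ p → _ , p , refl)
                          λ (_ , p , e) → subst N.principal (f-inj (principal-carrier p) d e) p
      ; to-label      = λ d → mk⇔ (λ l → _ , l , refl)
                          λ (_ , l , e) → subst (λ x → N.label x _) (f-inj (label-carrier l) d e) l
      }

  -- The context of a step before its ports are renamed: once the cells are gone, the auxiliary
  -- ports of the redex are free and can serve as an interface.
  module Deletion {S : Net} {p : Patch} (redex : Redex S p) where

    open Patch p
    open Redex redex
    private
      module S = Net S
      module W = WPermutation S.wire-isWPermutation

    raw : RawNet
    raw = record
      { wire      = λ x y → S.wire x y × ¬ Active x
      ; cell      = λ x y → S.cell x y × ¬ Removed x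
      ; principal = λ x → S.principal x × ¬ Removed x
      ; label     = λ x s → S.label x s × ¬ Removed x
      }

    private
      stays : ∀ {x y} → S.cell x y → ¬ Removed x → ¬ Removed y
      stays s ¬d (t , i , refl) = ¬d (cell-to i s)

      stays⁻ : ∀ {x y} → S.cell x y → ¬ Removed y → ¬ Removed x
      stays⁻ s ¬d (t , i , refl) = ¬d (cell-from i s)

      embedding : Embedding S raw (λ p n → p ≡ n × ¬ Removed p)
      embedding = record
        { func       = λ { (refl , _) (refl , _) → refl }
        ; inj        = λ { (refl , _) (refl , _) → refl }
        ; cell⇒      = λ { (refl , d) s → _ , (refl , stays s d) , s , d }
        ; cell⇒ᵒ     = λ { (refl , d) s → _ , (refl , stays⁻ s d) , s , stays⁻ s d }
        ; cell⇐      = λ { (refl , d) (s , _) → _ , (refl , stays s d) , s }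
        ; cell⇐ᵒ     = λ { (refl , d) (s , d′) → _ , (refl , d′) , s }
        ; principal⇒ = λ { (refl , d) x → x , d }
        ; principal⇐ = λ { (refl , _) (x , _) → x }
        ; label⇒     = λ { (refl , d) x → x , d }
        ; label⇐     = λ { (refl , _) (x , _) → x }
        }

      inactive : ∀ {x y} → S.wire x y → ¬ Active x → ¬ Active y
      inactive w ¬a a = ¬a (active-wire a (W.symmetric w))

    net : Net
    net = record
      { raw   = raw
      ; isNet = isNet raw
          (λ { (inj₁ (_ , _ , d))        → covered embedding (refl , d)
             ; (inj₂ (inj₁ (_ , d)))     → covered embedding (refl , d)
             ; (inj₂ (inj₂ (_ , _ , d))) → covered embedding (refl , d) })
          (isWPermutation (λ (w , ¬a) → W.symmetric w , inactive w ¬a) (λ (w , _) (v , _) → W.functional w v)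
            (filter (¬? ∘ active?) W.ports , λ x → mk⇔
              (λ (_ , w , ¬a) → ∈-filter⁺ (¬? ∘ active?) (W.dom⇒port (_ , w)) ¬a)
              (λ m → let k , ¬a = ∈-filter⁻ (¬? ∘ active?) {xs = W.ports} m ; _ , w = W.port⇒dom k in _ , w , ¬a)))
          (filter (¬? ∘ removed?) (proj₁ S.cell-finite) , λ x → mk⇔
              (λ (_ , s , d) → ∈-filter⁺ (¬? ∘ removed?) (to (proj₂ S.cell-finite _) (_ , s)) d)
              (λ m → let k , d = ∈-filter⁻ (¬? ∘ removed?) {xs = proj₁ S.cell-finite} m
                         _ , s = from (proj₂ S.cell-finite _) k in _ , s , d))
          (λ (_ , s , d) → let (_ , w) , ¬w = S.P-c⊆P (_ , s) in
            (_ , w , d ∘ active-removed) , λ (v , _) → ¬w v)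
      }

  -- The quotient of a patched net by a naming is a net

  module Quotient {S : Net} {act : Pred Bool 0ℓ} {ps : Bool → Patch} (isSystem : IsSystem S act ps) where

    open IsSystem isSystem public
    open System S act ps public
    open Wiring isWiring public

    private
      module S = Net S
      module p i = Patch (ps i)

    quotient : REL Port ℕ 0ℓ → RawNet
    quotient ν = record
      { wire      = QuotientWire ν
      ; cell      = λ m n → ∃₂ λ a b → ν a m × Cell a b × ν b n
      ; principal = λ n → ∃ λ a → ν a n × Principal a
      ; label     = λ n s → ∃ λ a → ν a n × Label a s
      }

    data CellPort : Pred Port 0ℓ where
      old : ∀ {x} → x ∈ S.P-c → (∀ {i} → act i → ¬ p.Removed i x) → CellPort (old x)
      new : ∀ {i x} → act i → x ∈ p.R.P-c i → CellPort (new i x)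

    cell-port : ∀ {a b} → Cell a b → CellPort a
    cell-port (old s d) = old (_ , s) d
    cell-port (new α s) = new α (_ , s)

    cell-port-to : ∀ {a b} → Cell a b → CellPort b
    cell-port-to (old s d) = old (proj₂ (IsPartialPermutation.dom≐codom S.cell-isPartialPermutation) (_ , s))
      λ { α (t , i , refl) → d α (Redex.cell-to (redex α) i s) }
    cell-port-to (new {i} α s) =
      new α (proj₂ (IsPartialPermutation.dom≐codom (p.R.cell-isPartialPermutation i)) (_ , s))

    principal-port : ∀ {a} → Principal a → CellPort a
    principal-port (old x d) = old (S.principal⊆P-c x) d
    principal-port (new {i} α x) = new α (p.R.principal⊆P-c i x)

    label-port : ∀ {a s} → Label a s → CellPort a
    label-port (old x d) = old (from (S.label-dom _) (_ , x)) d
    label-port (new {i} α x) = new α (from (p.R.label-dom i _) (_ , x))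

    -- The reason why quotients do not merge cells: an unglued port is the start of its chain, so a
    -- name is borne by at most one cell port.
    unglued : ∀ {a} → CellPort a → ¬ Glued a
    unglued (old _ d) (_ , down α g) = d α (Redex.glue-removed (redex α) g)
    unglued (new {i} _ c) (_ , up α g) = proj₂ (p.glue-free i g) c

    cell-port-wired : ∀ {a} → CellPort a → ∃ (Wire a)
    cell-port-wired (old c d) = let (_ , w) , _ = S.P-c⊆P c in _ , old w λ {i} α → d α ∘ p.active-removed i
    cell-port-wired (new {i} α c) = let (_ , w) , _ = p.R.P-c⊆P i c in _ , new α w

    cell-port-proper : ∀ {a} → CellPort a → ¬ Wire a a
    cell-port-proper (old c _) (old w _) = proj₂ (S.P-c⊆P c) w
    cell-port-proper (new {i} _ c) (new _ w) = proj₂ (p.R.P-c⊆P i c) w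

    module _ {ν : REL Port ℕ 0ℓ} (isNaming : IsNaming ν) where

      open Naming isNaming

      private
        at-cell : ∀ {a b n} → CellPort a → CellPort b → ν a n → ν b n → a ≡ b
        at-cell c c′ x y = starts-≡ x y (unglued c) (unglued c′)

        T-old : REL ℕ ℕ 0ℓ
        T-old x n = CellPort (old x) × ν (old x) n

        T-new : Bool → REL ℕ ℕ 0ℓ
        T-new i x n = CellPort (new i x) × ν (new i x) n

        old-embedding : Embedding S (quotient ν) T-old
        old-embedding = record
          { func       = λ (_ , x) (_ , y) → func x y
          ; inj        = λ (c , x) (c′ , y) → old-injective (at-cell c c′ x y)
          ; cell⇒      = λ { (old _ d , x) s → let c = cell-port-to (old s d) ; _ , y = total (cell-port-wired c) in
                             _ , (c , y) , _ , _ , x , old s d , y }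
          ; cell⇒ᵒ     = λ { (old _ d , x) s →
                             let s′ = old s λ { α (t , i , refl) → d α (Redex.cell-from (redex α) i s) }
                                 c = cell-port s′ ; _ , y = total (cell-port-wired c) in
                             _ , (c , y) , _ , _ , y , s′ , x }
          ; cell⇐      = cell⇐
          ; cell⇐ᵒ     = cell⇐ᵒ
          ; principal⇒ = λ { (old _ d , x) p → _ , x , old p d }
          ; principal⇐ = principal⇐
          ; label⇒     = λ { (old _ d , x) l → _ , x , old l d }
          ; label⇐     = label⇐
          }
          where
          old-injective : ∀ {x y} → old x ≡ old y → x ≡ y
          old-injective refl = refl

          cell⇐ : ∀ {p m n} → T-old p n → RawNet.cell (quotient ν) n m → ∃ λ q → T-old q m × S.cell p q
          cell⇐ (c , x) (_ , _ , x′ , s , y) with refl ← at-cell c (cell-port s) x x′ with old s′ _ ← s =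
            _ , (cell-port-to s , y) , s′

          cell⇐ᵒ : ∀ {p m n} → T-old p n → RawNet.cell (quotient ν) m n → ∃ λ q → T-old q m × S.cell q p
          cell⇐ᵒ (c , x) (_ , _ , y , s , x′) with refl ← at-cell c (cell-port-to s) x x′ with old s′ _ ← s =
            _ , (cell-port s , y) , s′

          principal⇐ : ∀ {p n} → T-old p n → RawNet.principal (quotient ν) n → S.principal p
          principal⇐ (c , x) (_ , x′ , s) with refl ← at-cell c (principal-port s) x x′ with old s′ _ ← s = s′

          label⇐ : ∀ {p n l} → T-old p n → RawNet.label (quotient ν) n l → S.label p l
          label⇐ (c , x) (_ , x′ , s) with refl ← at-cell c (label-port s) x x′ with old s′ _ ← s = s′

        new-embedding : ∀ i → Embedding (record { raw = p.R.raw i ; isNet = p.R.isNet i }) (quotient ν) (T-new i)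
        new-embedding i = record
          { func       = λ (_ , x) (_ , y) → func x y
          ; inj        = λ (c , x) (c′ , y) → new-injective (at-cell c c′ x y)
          ; cell⇒      = λ { (new α _ , x) s → let c = cell-port-to (new α s) ; _ , y = total (cell-port-wired c) in
                             _ , (c , y) , _ , _ , x , new α s , y }
          ; cell⇒ᵒ     = λ { (new α _ , x) s → let c = cell-port (new α s) ; _ , y = total (cell-port-wired c) in
                             _ , (c , y) , _ , _ , y , new α s , x }
          ; cell⇐      = cell⇐
          ; cell⇐ᵒ     = cell⇐ᵒ
          ; principal⇒ = λ { (new α _ , x) p → _ , x , new α p }
          ; principal⇐ = principal⇐
          ; label⇒     = λ { (new α _ , x) l → _ , x , new α l }
          ; label⇐     = label⇐
          }
          where
          new-injective : ∀ {x y} → new i x ≡ new i y → x ≡ y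
          new-injective refl = refl

          cell⇐ : ∀ {p m n} → T-new i p n → RawNet.cell (quotient ν) n m → ∃ λ q → T-new i q m × p.R.cell i p q
          cell⇐ (c , x) (_ , _ , x′ , s , y) with refl ← at-cell c (cell-port s) x x′ with new _ s′ ← s =
            _ , (cell-port-to s , y) , s′

          cell⇐ᵒ : ∀ {p m n} → T-new i p n → RawNet.cell (quotient ν) m n → ∃ λ q → T-new i q m × p.R.cell i q p
          cell⇐ᵒ (c , x) (_ , _ , y , s , x′) with refl ← at-cell c (cell-port-to s) x x′ with new _ s′ ← s =
            _ , (cell-port s , y) , s′

          principal⇐ : ∀ {p n} → T-new i p n → RawNet.principal (quotient ν) n → p.R.principal i p
          principal⇐ (c , x) (_ , x′ , s) with refl ← at-cell c (principal-port s) x x′ with new _ s′ ← s = s′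

          label⇐ : ∀ {p n l} → T-new i p n → RawNet.label (quotient ν) n l → p.R.label i p l
          label⇐ (c , x) (_ , x′ , s) with refl ← at-cell c (label-port s) x x′ with new _ s′ ← s = s′

        cover : ∀ {a n} → CellPort a → ν a n → Covered (quotient ν) n
        cover c@(old _ _)     x = covered old-embedding (c , x)
        cover c@(new {i} _ _) x = covered (new-embedding i) (c , x)

        P-c-name : ∀ {n} → n ∈ RawNet.P-c (quotient ν) ⇔ ∃ λ a → CellPort a × ν a n
        P-c-name = mk⇔ (λ (_ , _ , _ , x , s , _) → _ , cell-port s , x) from-port
          where
          from-port : ∀ {n} → (∃ λ a → CellPort a × ν a n) → n ∈ RawNet.P-c (quotient ν)
          from-port (_ , old (_ , s) d , x) with _ , y ← total (cell-port-wired (cell-port-to (old s d))) =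
            _ , _ , _ , x , old s d , y
          from-port (_ , new α (_ , s) , x) with _ , y ← total (cell-port-wired (cell-port-to (new α s))) =
            _ , _ , _ , x , new α s , y

        unremoved? : ∀ x → Dec (∀ {i} → act i → ¬ p.Removed i x)
        unremoved? x with act? true →-dec ¬? (p.removed? true x) | act? false →-dec ¬? (p.removed? false x)
        ... | yes m | yes n = yes λ { {true} → m ; {false} → n }
        ... | no ¬m | _     = no λ f → ¬m f
        ... | yes _ | no ¬n = no λ f → ¬n f

        cellPort? : ∀ a → Dec (CellPort a)
        cellPort? (old x) with x ∈? proj₁ S.cell-finite | unremoved? x
        ... | yes m | yes d = yes (old (from (proj₂ S.cell-finite x) m) d)
        ... | no ¬m | _     = no λ { (old c _) → ¬m (to (proj₂ S.cell-finite x) c) }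
        ... | _     | no ¬d = no λ { (old _ d) → ¬d d }
        cellPort? (new i x) with act? i | x ∈? proj₁ (p.R.cell-finite i)
        ... | yes α | yes m = yes (new α (from (proj₂ (p.R.cell-finite i) x) m))
        ... | no ¬α | _     = no λ { (new α _) → ¬α α }
        ... | _     | no ¬m = no λ { (new _ c) → ¬m (to (proj₂ (p.R.cell-finite i) x) c) }

        cellPorts : List Port
        cellPorts = filter cellPort? ports

        names : Images ν ports
        names = images ν ports (total ∘ port⇒W)

        cell-names : Images ν cellPorts
        cell-names = images ν cellPorts (λ m → total (port⇒W (proj₁ (∈-filter⁻ cellPort? {xs = ports} m))))

      quotient-isNet : IsNet (quotient ν)
      quotient-isNet = isNet (quotient ν)
        (λ { (inj₁ (_ , _ , _ , x , s , _)) → cover (cell-port s) x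
           ; (inj₂ (inj₁ (_ , x , s)))      → cover (principal-port s) x
           ; (inj₂ (inj₂ (_ , _ , x , s)))  → cover (label-port s) x })
        (isWPermutation quotient-sym quotient-func (Images.list names , λ n → mk⇔
          (λ (_ , w) → let _ , x = quotient-name w in
             to (images-finite ν func names) (_ , W⇒port (proj₂ (wired x)) , x))
          (λ m → let _ , _ , x = from (images-finite ν func names) m in quotient-dom x)))
        (Images.list cell-names , λ n → mk⇔
          (λ d → let a , c , x = to P-c-name d in to (images-finite ν func cell-names)
                   (a , ∈-filter⁺ cellPort? (W⇒port (proj₂ (wired x))) c , x))
          (λ m → let a , k , x = from (images-finite ν func cell-names) m in
                 from P-c-name (a , proj₂ (∈-filter⁻ cellPort? {xs = ports} k) , x)))
        (λ d → let _ , c , x = to P-c-name d in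
          quotient-dom x , quotient-proper x (unglued c) (cell-port-proper c))

      quotientNet : Net
      quotientNet = record { raw = quotient ν ; isNet = quotient-isNet }

  -- Gluing in two stages

  ≈-trans : ∀ {A B C} → A ≈ B → B ≈ C → A ≈ C
  ≈-trans p q = record
    { wire-≈      = proj₁ q.wire-≈ ∘ proj₁ p.wire-≈ , proj₂ p.wire-≈ ∘ proj₂ q.wire-≈
    ; cell-≈      = proj₁ q.cell-≈ ∘ proj₁ p.cell-≈ , proj₂ p.cell-≈ ∘ proj₂ q.cell-≈
    ; principal-≈ = proj₁ q.principal-≈ ∘ proj₁ p.principal-≈ , proj₂ p.principal-≈ ∘ proj₂ q.principal-≈
    ; label-≈     = proj₁ q.label-≈ ∘ proj₁ p.label-≈ , proj₂ p.label-≈ ∘ proj₂ q.label-≈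
    }
    where
    module p = _≈_ p
    module q = _≈_ q

  ≈-sym : ∀ {A B} → A ≈ B → B ≈ A
  ≈-sym p = record
    { wire-≈      = proj₂ wire-≈ , proj₁ wire-≈
    ; cell-≈      = proj₂ cell-≈ , proj₁ cell-≈
    ; principal-≈ = proj₂ principal-≈ , proj₁ principal-≈
    ; label-≈     = proj₂ label-≈ , proj₁ label-≈
    }
    where open _≈_ p

  ≈-refl : ∀ {A} → A ≈ A
  ≈-refl = record { wire-≈ = id , id ; cell-≈ = id , id ; principal-≈ = id , id ; label-≈ = id , id }

  Both : Pred Bool 0ℓ
  Both _ = ⊤

  Only : Bool → Pred Bool 0ℓ
  Only i k = k ≡ i

  only-system : ∀ {S ps i} → Redex S (ps i) → IsSystem S (Only i) ps
  only-system {i = i} r = record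
    { act?     = Bool._≟ i
    ; redex    = λ { refl → r }
    ; disjoint = λ { refl refl _ _ → refl }
    }

  -- A port outside the redex comes from the context, which is literally the same net in the source
  -- and in the target of a step.
  Keeps : (S : Net) (ps : Bool → Patch) (i : Bool) → REL Port ℕ 0ℓ → Set
  Keeps S ps i ν = ∀ {x} → x ∈ Net.carrier S → ¬ Patch.Removed (ps i) x → ν (old x) x

  -- What remains of a step when `X`, `α` and `β` are forgotten. It is extracted from a step by
  -- `reduct` and turned back into one by `Construction`.
  record Reduct (S S′ : Net) (ps : Bool → Patch) (i : Bool) (redex : Redex S (ps i)) : Set₁ where
    field
      ν        : REL Port ℕ 0ℓ
      isNaming : Wiring.IsNaming (IsSystem.isWiring (only-system {S} {ps} {i} redex)) ν
      keeps    : Keeps S ps i ν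
      reduct-≈ : Net.raw S′ ≈ Quotient.quotient (only-system {S} {ps} {i} redex) ν

  -- A redex survives the contraction of a disjoint one

  module Survival {R : Net} {ps : Bool → Patch} (both : IsSystem R Both ps)
                  {i j : Bool} (i≢j : i ≢ j) (i⊎j : ∀ k → k ≡ i ⊎ k ≡ j) where

    module Q = Quotient both

    sys₁ : IsSystem R (Only i) ps
    sys₁ = only-system {ps = ps} (Q.redex tt)

    module Q₁ = Quotient sys₁
    private
      module R = Net R
      module RW = WPermutation R.wire-isWPermutation
      module p k = Patch (ps k)
      module redexⱼ = Redex (Q.redex {j} tt)

    separate : ∀ {x} → p.Removed j x → ¬ p.Removed i x
    separate d d′ = i≢j (Q.disjoint tt tt d′ d)

    -- Nothing is glued to the second redex in the first stage, so its ports are starts of chains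
    -- and keep their names. Hence the same `ι` places this redex in `R₁`.
    removed-unglued : ∀ {x} → p.Removed j x → ¬ Q₁.Glued (old x)
    removed-unglued d (_ , Q₁.down refl g) = separate d (Redex.glue-removed (Q.redex tt) g)

    lift-wire : ∀ {a b} → Q₁.Wire a b → ∃ (Q.Wire a) → Q.Wire a b
    lift-wire (Q₁.old w _)      (_ , Q.old _ n) = Q.old w n
    lift-wire (Q₁.new refl w) _               = Q.new tt w

    lower-wire : ∀ {x b} → Q.Wire (old x) b → Q₁.Wire (old x) b
    lower-wire (Q.old w n) = Q₁.old w λ _ → n tt

    lift-glue : ∀ {a b} → Q₁.Glue a b → Q.Glue a b
    lift-glue (Q₁.down _ g) = Q.down tt g
    lift-glue (Q₁.up _ g)   = Q.up tt g

    -- The joint wiring lacks the wire between the principal ports of the second redex. A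
    -- first-stage step cannot use it: the wire of the step leads to a glued port, and glued ports
    -- are still wired in the joint wiring.
    lift-next : ∀ {a b} → Q₁.next a b → Q.next a b
    lift-next (_ , Q₁.new refl w , s) = _ , Q.new tt w , lift-glue s
    lift-next (_ , Q₁.old w _ , s) with _ , v ← Q.g-wired (lift-glue s) with Q.old w′ _ ← v
      with refl ← RW.functional w′ (RW.symmetric w) = _ , Q.W-sym v , lift-glue s

    lift-steps : ∀ n {a b} → Q₁.Steps n a b → Q.Steps n a b
    lift-steps zero    refl        = refl
    lift-steps (suc n) (_ , p , s) = _ , lift-steps n p , lift-next s

    same-class : ∀ {ν₁ ν} → Q₁.IsNaming ν₁ → Q.IsNaming ν →
                 ∀ {a b n m} → ν₁ a n → ν₁ b n → ν a m → ν b m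
    same-class isNaming₁ isNaming x y z with Q₁.IsNaming.connected isNaming₁ x y
    ... | inj₁ (n , r) = Q.Naming.follows-↝ isNaming (n , lift-steps n r) z
    ... | inj₂ (n , r) = Q.Naming.follows-↜ isNaming (n , lift-steps n r) z

    module _ {ν₁ : REL Port ℕ 0ℓ} (isNaming₁ : Q₁.IsNaming ν₁) (keeps₁ : Keeps R ps i ν₁)
             {R₁ : Net} (R₁≈ : Net.raw R₁ ≈ Q₁.quotient ν₁) where

      private
        module N₁ = Q₁.Naming isNaming₁
        module R₁ = Net R₁
        open _≈_ R₁≈

      named : ∀ {x} → p.Removed j x → ν₁ (old x) x
      named d = keeps₁ (proj₁ (redexⱼ.removed-P d)) (separate d)

      removed-old : ∀ {a x} → Q₁.CellPort a → ν₁ a x → p.Removed j x → a ≡ old x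
      removed-old c n d = N₁.starts-≡ n (named d) (Q₁.unglued c) (removed-unglued d)

      wired-both : ∀ {a n} → ν₁ a n → ¬ p.Active j n → ∃ (Q.Wire a)
      wired-both {a} x ¬α with N₁.wired x
      ... | _ , Q₁.new refl w = _ , Q.new tt w
      ... | _ , Q₁.old {z} w n = _ , Q.old w λ {k} _ → case (i⊎j k)
        where
        case : ∀ {k} → k ≡ i ⊎ k ≡ j → ¬ p.Active k z
        case (inj₁ refl) = n refl
        case (inj₂ refl) α = ¬α (subst (p.Active j) (N₁.func (named (p.active-removed j α)) x) α)

      survives : Redex R₁ (ps j)
      survives = record
        { ι-injective = redexⱼ.ι-injective
        ; wire-b-c    = proj₂ wire-≈ (inj₁ (_ , _ , named b-removed ,
            Q₁.old redexⱼ.wire-b-c (λ { refl a → separate b-removed (p.active-removed i a) }) ,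
            removed-unglued c-removed , named c-removed))
        ; cell⇒       = λ s → let t = inner (_ , s) ; u = inner (proj₂ (IsPartialPermutation.dom≐codom (p.L.cell-isPartialPermutation j)) (_ , s)) in
                        proj₂ cell-≈ (_ , _ , named t , Q₁.old (redexⱼ.cell⇒ s) (λ { refl → separate t }) , named u)
        ; cell⇐       = cell⇐
        ; cell-from   = cell-from
        ; cell-to     = cell-to
        ; principal⇒  = λ t p → proj₂ principal-≈ (_ , named (inner t) , Q₁.old (redexⱼ.principal⇒ t p) (λ { refl → separate (inner t) }))
        ; principal⇐  = principal⇐
        ; label⇒      = λ t l → proj₂ label-≈ (_ , named (inner t) , Q₁.old (redexⱼ.label⇒ t l) (λ { refl → separate (inner t) }))
        ; label⇐      = label⇐
        }
        where
        inner : ∀ {t} → p.Inner j t → p.Removed j (p.ι j t)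
        inner t = _ , t , refl

        b-removed = inner (p.b-inner j)
        c-removed = inner (p.c-inner j)

        cell⇐ : ∀ {t u} → p.Inner j t → p.Inner j u → R₁.cell (p.ι j t) (p.ι j u) → p.L.cell j t u
        cell⇐ t u s with _ , _ , x , s′ , y ← proj₁ cell-≈ s
          with refl ← removed-old (Q₁.cell-port s′) x (inner t) | refl ← removed-old (Q₁.cell-port-to s′) y (inner u)
          with Q₁.old s″ _ ← s′ = redexⱼ.cell⇐ t u s″

        cell-from : ∀ {t y} → p.Inner j t → R₁.cell (p.ι j t) y → p.Removed j y
        cell-from t s with _ , _ , x , s′ , y ← proj₁ cell-≈ s
          with refl ← removed-old (Q₁.cell-port s′) x (inner t)
          with Q₁.old s″ _ ← s′ with d ← redexⱼ.cell-from t s″ with refl ← N₁.func y (named d) = d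

        cell-to : ∀ {t y} → p.Inner j t → R₁.cell y (p.ι j t) → p.Removed j y
        cell-to t s with _ , _ , y , s′ , x ← proj₁ cell-≈ s
          with refl ← removed-old (Q₁.cell-port-to s′) x (inner t)
          with Q₁.old s″ _ ← s′ with d ← redexⱼ.cell-to t s″ with refl ← N₁.func y (named d) = d

        principal⇐ : ∀ {t} → p.Inner j t → R₁.principal (p.ι j t) → p.L.principal j t
        principal⇐ t s with _ , x , s′ ← proj₁ principal-≈ s
          with refl ← removed-old (Q₁.principal-port s′) x (inner t) with Q₁.old s″ _ ← s′ = redexⱼ.principal⇐ t s″

        label⇐ : ∀ {t l} → p.Inner j t → R₁.label (p.ι j t) l → p.L.label j t l
        label⇐ t s with _ , x , s′ ← proj₁ label-≈ s
          with refl ← removed-old (Q₁.label-port s′) x (inner t) with Q₁.old s″ _ ← s′ = redexⱼ.label⇐ t s″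

  -- Ports of the second stage are names of first-stage orbits, so a second-stage orbit is a chain
  -- of such orbits. The hypothesis `agrees` says that the joint naming extends the names of `R₁`
  -- outside the second redex; it yields `Keeps` for the second step.
  module Composition {R : Net} {ps : Bool → Patch} (both : IsSystem R Both ps)
                     {i j : Bool} (i≢j : i ≢ j) (i⊎j : ∀ k → k ≡ i ⊎ k ≡ j)
                     {ν₁ : REL Port ℕ 0ℓ} (isNaming₁ : Survival.Q₁.IsNaming both i≢j i⊎j ν₁) (keeps₁ : Keeps R ps i ν₁)
                     {R₁ : Net} (R₁≈ : Net.raw R₁ ≈ Survival.Q₁.quotient both i≢j i⊎j ν₁)
                     {ν : REL Port ℕ 0ℓ} (isNaming : Quotient.IsNaming both ν)
                     (agrees : ∀ {n} → n ∈ Net.carrier R₁ → ¬ Patch.Removed (ps j) n → ∃ λ a → ν₁ a n × ν a n)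
                     where

    open Survival both i≢j i⊎j

    private
      module R = Net R
      module R₁ = Net R₁
      module RW = WPermutation R.wire-isWPermutation
      module p k = Patch (ps k)
      module N₁ = Q₁.Naming isNaming₁
      module N = Q.Naming isNaming
      open _≈_ R₁≈

      named′ : ∀ {x} → p.Removed j x → ν₁ (old x) x
      named′ = named isNaming₁ keeps₁ {R₁} R₁≈

    sys₂ : IsSystem R₁ (Only j) ps
    sys₂ = only-system {ps = ps} (survives isNaming₁ keeps₁ {R₁} R₁≈)

    module Q₂ = Quotient sys₂

    private
      same-class′ : ∀ {a b n m} → ν₁ a n → ν₁ b n → ν a m → ν b m
      same-class′ = same-class isNaming₁ isNaming

      -- A principal port of the second redex is unglued and wired to an unglued port in the first
      -- stage, so it starts a chain that exits at once. Dropping its wire therefore affects no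
      -- other port of a first-stage orbit.
      isolated : ∀ {a n} → p.Active j n → a Q₁.↝ old n ⊎ old n Q₁.↝ a → a ≡ old n
      isolated α (inj₁ r) = Q₁.start-unique r (removed-unglued (p.active-removed j α))
      isolated α (inj₂ r) with d ← p.active-removed j α
        with (_ , w) , _ ← Redex.removed-P (Q.redex {j} tt) d =
        sym (Q₁.exit-unique (Q₁.old w (λ { refl β → separate d (p.active-removed i β) }))
          (removed-unglued (p.active-removed j (Redex.active-wire (Q.redex tt) α w))) r)

      inactive : ∀ {a n} → ν₁ a n → ∃ (Q.Wire a) → ¬ p.Active j n
      inactive x (_ , v) α with refl ← isolated α (N₁.connected x (named′ (p.active-removed j α)))
        with Q.old _ n ← v = n tt α

      wired-both′ : ∀ {a n} → ν₁ a n → ¬ p.Active j n → ∃ (Q.Wire a)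
      wired-both′ = wired-both isNaming₁ keeps₁ {R₁} R₁≈

      entry : ∀ {n l q} → R₁.wire n l → p.glue j l q → ∃ λ a → ν₁ a n × Q₁.Wire a (old l)
      entry w g with d ← Redex.glue-removed (Q.redex tt) g with proj₁ wire-≈ w
      ... | inj₂ (refl , _ , cl) = contradiction (N₁.closed-start (named′ d) cl) (removed-unglued d)
      ... | inj₁ (_ , _ , x , w′ , ¬g , y) with refl ← N₁.starts-≡ y (named′ d) ¬g (removed-unglued d) =
        _ , x , w′

    -- `old n` stands for a whole first-stage orbit, which takes the joint name of any of its ports;
    -- `same-class` makes this independent of the choice.
    data ν₂ : REL Port ℕ 0ℓ where
      old : ∀ {a n m} → ν₁ a n → ν a m → ν₂ (old n) m
      new : ∀ {q m} → ν (new j q) m → ν₂ (new j q) m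

    private
      infix 4 _▹_

      data _▹_ : Port → Port → Set where
        old : ∀ {a n} → ν₁ a n → a ▹ old n
        new : ∀ {q} → new j q ▹ new j q

      foreign : ∀ {q n} → ¬ ν₁ (new j q) n
      foreign x with _ , Q₁.new e _ ← N₁.wired x = i≢j (sym e)

      ▹-func : ∀ {a u v} → a ▹ u → a ▹ v → u ≡ v
      ▹-func (old x) (old y) = cong old (N₁.func x y)
      ▹-func (old x) new     = contradiction x foreign
      ▹-func new     (old x) = contradiction x foreign
      ▹-func new     new     = refl

      project-name : ∀ {u m} → ν₂ u m → ∃ λ a → a ▹ u × ν a m
      project-name (old x y) = _ , old x , y
      project-name (new y)   = _ , new , y

      -- A joint step through the glue of patch `i` stays inside one first-stage orbit and projects
      -- to no step at all; a step through the glue of patch `j` projects to exactly one.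
      project-next : ∀ {a b u} → Q.next a b → a ▹ u → ∃ λ v → b ▹ v × u Q₂.↝ v
      project-next (_ , w@(Q.old _ n) , Q.down {k} _ g) r with i⊎j k
      project-next (_ , w@(Q.old _ n) , Q.down {k} _ g) (old x) | inj₁ refl =
        _ , old (N₁.follows (_ , lower-wire w , Q₁.down refl g) x) , zero , refl
      project-next (_ , w@(Q.old _ n) , Q.down {k} _ g) (old x) | inj₂ refl
        with d ← Redex.glue-removed (Q.redex tt) g =
        _ , new , 1 , _ , refl , _ ,
        Q₂.old (proj₂ wire-≈ (inj₁ (_ , _ , x , lower-wire w , removed-unglued d , named′ d)))
               (λ { refl → inactive x (_ , w) }) ,
        Q₂.down refl g
      project-next (_ , Q.new {k} _ w , Q.up _ g) r with i⊎j k
      project-next (_ , Q.new {k} _ w , Q.up _ g) (old x) | inj₁ refl =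
        _ , old (N₁.follows (_ , Q₁.new refl w , Q₁.up refl g) x) , zero , refl
      project-next (_ , Q.new {k} _ w , Q.up _ g) new     | inj₁ e = contradiction (sym e) i≢j
      project-next (_ , Q.new {k} _ w , Q.up _ g) (old x) | inj₂ refl = contradiction x foreign
      project-next (_ , Q.new {k} _ w , Q.up _ g) new     | inj₂ _ =
        _ , old (named′ (Redex.glue-removed (Q.redex tt) g)) , 1 , _ , refl , _ , Q₂.new refl w , Q₂.up refl g

      project-steps : ∀ n {a b u} → Q.Steps n a b → a ▹ u → ∃ λ v → b ▹ v × u Q₂.↝ v
      project-steps zero    refl        r = _ , r , zero , refl
      project-steps (suc n) (_ , p , s) r with _ , r′ , q ← project-steps n p r
        with _ , r″ , q′ ← project-next s r′ = _ , r″ , Q₂.↝-trans q q′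

      project-↝ : ∀ {a b u v} → a Q.↝ b → a ▹ u → b ▹ v → u Q₂.↝ v
      project-↝ (n , p) r r′ with _ , r″ , q ← project-steps n p r with refl ← ▹-func r′ r″ = q

    isNaming₂ : Q₂.IsNaming ν₂
    isNaming₂ = record
      { total = total ; wired = wired ; func = func ; follows = follows ; connected = connected }
      where
      total : ∀ {a} → ∃ (Q₂.Wire a) → ∃ (ν₂ a)
      total (_ , Q₂.old w n) with _ , x ← N₁.quotient-name (proj₁ wire-≈ w)
        with _ , y ← N.total (wired-both′ x (n refl)) = _ , old x y
      total (_ , Q₂.new refl w) with _ , y ← N.total (_ , Q.new tt w) = _ , new y

      wired : ∀ {a m} → ν₂ a m → ∃ (Q₂.Wire a)
      wired (old x y) with _ , w ← N₁.quotient-dom x =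
        _ , Q₂.old (proj₂ wire-≈ w) (λ { refl → inactive x (N.wired y) })
      wired (new y) with _ , Q.new _ w ← N.wired y = _ , Q₂.new refl w

      func : ∀ {a m n} → ν₂ a m → ν₂ a n → m ≡ n
      func (old x y) (old x′ y′) = N.func (same-class′ x x′ y) y′
      func (new y)   (new y′)    = N.func y y′

      follows : ∀ {a b m} → Q₂.next a b → ν₂ a m → ν₂ b m
      follows (_ , Q₂.old w n , Q₂.down refl g) (old x y) with _ , x′ , w′ ← entry w g
        with y′ ← same-class′ x x′ y = new (N.follows (_ , lift-wire w′ (N.wired y′) , Q.down tt g) y′)
      follows (_ , Q₂.new refl w , Q₂.up refl g) (new y) =
        old (named′ (Redex.glue-removed (Q.redex tt) g)) (N.follows (_ , Q.new tt w , Q.up tt g) y)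

      connected : ∀ {a b m} → ν₂ a m → ν₂ b m → a Q₂.↝ b ⊎ b Q₂.↝ a
      connected x y with _ , r , x′ ← project-name x | _ , r′ , y′ ← project-name y with N.connected x′ y′
      ... | inj₁ s = inj₁ (project-↝ s r r′)
      ... | inj₂ s = inj₂ (project-↝ s r′ r)

    keeps₂ : Keeps R₁ ps j ν₂
    keeps₂ d ¬r with _ , x , y ← agrees d ¬r = old x y

    private
      data Side : Port → Port → Set where
        inside  : ∀ {a b} → Q₁.Wire a b → Side a b
        outside : ∀ {q r} → p.R.wire j q r → Side (new j q) (new j r)

      side : ∀ {a b} → Q.Wire a b → Side a b
      side w@(Q.old _ _) = inside (lower-wire w)
      side (Q.new {k} _ w) with i⊎j k
      ... | inj₁ refl = inside (Q₁.new refl w)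
      ... | inj₂ refl = outside w

      glued-new : ∀ {q} → Q.Glued (new j q) → Q₂.Glued (new j q)
      glued-new (_ , Q.up _ g) = _ , Q₂.up refl g

      glued-new⁻ : ∀ {q} → Q₂.Glued (new j q) → Q.Glued (new j q)
      glued-new⁻ (_ , Q₂.up _ g) = _ , Q.up tt g

      glued-old : ∀ {a b l} → Q₁.Wire a b → ν₁ b l → ¬ Q₁.Glued b → Q.Glued b → Q₂.Glued (old l)
      glued-old w y ¬g (_ , Q.down {k} _ g) with i⊎j k
      ... | inj₁ refl = contradiction (_ , Q₁.down refl g) ¬g
      ... | inj₂ refl with refl ← N₁.func y (named′ (Redex.glue-removed (Q.redex tt) g)) = _ , Q₂.down refl g
      glued-old (Q₁.new refl _) y ¬g (_ , Q.up _ g) = contradiction (_ , Q₁.up refl g) ¬g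

      glued-old⁻ : ∀ {b l} → ν₁ b l → ¬ Q₁.Glued b → Q₂.Glued (old l) → Q.Glued b
      glued-old⁻ y ¬g (_ , Q₂.down refl g) with d ← Redex.glue-removed (Q.redex tt) g
        with refl ← N₁.starts-≡ y (named′ d) ¬g (removed-unglued d) = _ , Q.down tt g

      unglued₁ : ∀ {b} → ¬ Q.Glued b → ¬ Q₁.Glued b
      unglued₁ ¬g (_ , g) = ¬g (_ , lift-glue g)

      pass : ∀ {a b k l} → ν₁ a k → ν₁ b l → Q.Wire a b → Q₁.Wire a b → ¬ Q₁.Glued b → Q₂.Wire (old k) (old l)
      pass x y w w₁ ¬g = Q₂.old (proj₂ wire-≈ (inj₁ (_ , _ , x , w₁ , ¬g , y))) λ { refl → inactive x (_ , w) }

      lift-cyclic : ∀ {a} → Q₁.Cyclic a → Q.Cyclic a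
      lift-cyclic (n , r) = n , lift-steps (suc n) r

      cyclic₁-→ : ∀ n {a b} → Q.Steps n a b → Q₁.Cyclic a → Q₁.Cyclic b
      cyclic₁-→ zero    refl        c = c
      cyclic₁-→ (suc n) (_ , r , s) c with c′@(k , r′) ← cyclic₁-→ n r c with _ , t , _ ← Q₁.uncons k r′
        with refl ← Q.next-func s (lift-next t) = Q₁.cyclic-→ t c′

      cyclic₁-← : ∀ n {a b} → Q.Steps n a b → Q₁.Cyclic b → Q₁.Cyclic a
      cyclic₁-← zero    refl        c = c
      cyclic₁-← (suc n) (_ , r , s) c@(_ , _ , _ , t) with refl ← Q.next-inj s (lift-next t) =
        cyclic₁-← n r (Q₁.cyclic-← t c)

      -- The steps of a first-stage cycle are joint steps, and joint steps are deterministic in both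
      -- directions. Such a cycle is thus already an entire joint orbit.
      cyclic₁-class : ∀ {a b n} → ν a n → ν b n → Q₁.Cyclic a → Q₁.Cyclic b
      cyclic₁-class x y c with N.connected x y
      ... | inj₁ (n , r) = cyclic₁-→ n r c
      ... | inj₂ (n , r) = cyclic₁-← n r c

      closed₂ : ∀ {n} → (∀ {a} → ν a n → ¬ Q₁.Cyclic a) → Q.Closed ν n → Q₂.Closed ν₂ n
      closed₂ ¬c cl (new y) (Q₂.new refl w) = glued-new (cl y (Q.new tt w))
      closed₂ ¬c cl (old x y) (Q₂.old w _) with proj₁ wire-≈ w
      ... | inj₁ (_ , _ , x′ , w′ , ¬g , z) with y′ ← same-class′ x x′ y =
        glued-old w′ z ¬g (cl y′ (lift-wire w′ (N.wired y′)))
      ... | inj₂ (_ , _ , cl₁) = contradiction (N₁.closed⇒cyclic x cl₁) (¬c y)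

      wire⇒ : ∀ {m n} → Q.QuotientWire ν m n → Q₂.QuotientWire ν₂ m n
      wire⇒ (inj₁ (_ , _ , x , w , ¬g , y)) with side w
      ... | outside w′ = inj₁ (_ , _ , new x , Q₂.new refl w′ , ¬g ∘ glued-new⁻ , new y)
      ... | inside w′ with _ , x′ ← N₁.total (_ , w′) | _ , y′ ← N₁.total (_ , Q₁.W-sym w′) =
        inj₁ (_ , _ , old x′ x , pass x′ y′ w w′ (unglued₁ ¬g) , ¬g ∘ glued-old⁻ y′ (unglued₁ ¬g) , old y′ y)
      wire⇒ (inj₂ (refl , (_ , x) , cl)) with _ , v₀ ← N.wired x with side v₀
      ... | outside w = inj₂ (refl , (_ , new x) , closed₂ acyclic cl)
        where
        acyclic : ∀ {a} → ν a _ → ¬ Q₁.Cyclic a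
        acyclic y c with _ , g ← Q₁.cyclic-glued (cyclic₁-class y x c) with Q₁.up e _ ← g = i≢j (sym e)
      ... | inside w with Q₁.exits⊎cyclic (_ , w) | N₁.total (_ , w)
      ...   | inj₁ (_ , _ , r , v , ¬g) | _ , x′ = inj₂ (refl , (_ , old x′ x) ,
        closed₂ (λ y c → Q₁.exit-acyclic r v ¬g (cyclic₁-class y x c)) cl)
      -- A loop closed in the first stage is a fixed point of the wires of `R₁`. In the second stage
      -- it is an unglued port wired to itself, hence an open wire from a chain to itself and not a
      -- cycle.
      ...   | inj₂ c | k , x′ = inj₁ (_ , _ , old x′ x ,
        Q₂.old (proj₂ wire-≈ (inj₂ (refl , (_ , x′) , cl₁))) (λ { refl → inactive x′ (N.wired x) }) ,
        unglued , old x′ x)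
        where
        cl₁ = N₁.cyclic⇒closed x′ c
        unglued : ¬ Q₂.Glued (old k)
        unglued (_ , Q₂.down refl g) with d ← Redex.glue-removed (Q.redex tt) g =
          removed-unglued d (N₁.closed-start (named′ d) cl₁)

      wire⇐ : ∀ {m n} → Q₂.QuotientWire ν₂ m n → Q.QuotientWire ν m n
      wire⇐ (inj₁ (_ , _ , new x , Q₂.new refl w , ¬g , new y)) =
        inj₁ (_ , _ , x , Q.new tt w , ¬g ∘ glued-new , y)
      wire⇐ (inj₁ (_ , _ , old x x′ , Q₂.old w _ , ¬g , old y y′)) with proj₁ wire-≈ w
      ... | inj₁ (_ , _ , u , v , ¬g₁ , z) with u′ ← same-class′ x u x′ =
        inj₁ (_ , _ , u′ , lift-wire v (N.wired u′) , ¬g ∘ glued-old v z ¬g₁ , same-class′ y z y′)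
      ... | inj₂ (refl , _ , cl₁) with refl ← N.func (same-class′ y x y′) x′ =
        inj₂ (refl , (_ , x′) , N.cyclic⇒closed x′ (lift-cyclic (N₁.closed⇒cyclic x cl₁)))
      wire⇐ (inj₂ (refl , (_ , x) , cl)) with _ , _ , x′ ← project-name x =
        inj₂ (refl , (_ , x′) , closed)
        where
        closed : Q.Closed ν _
        closed {b = c} y w with Q.g? c
        ... | yes g = g
        ... | no ¬g with side w
        ...   | outside w′ = glued-new⁻ (cl (new y) (Q₂.new refl w′))
        ...   | inside w′ with _ , y′ ← N₁.total (_ , w′) | _ , z′ ← N₁.total (_ , Q₁.W-sym w′) =
          glued-old⁻ z′ (unglued₁ ¬g) (cl (old y′ y) (pass y′ z′ w w′ (unglued₁ ¬g)))

      data CellSide : Port → Set where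
        inside  : ∀ {a k} → ν₁ a k → ¬ p.Removed j k → Q₁.CellPort a → CellSide a
        outside : ∀ {q} → CellSide (new j q)

      cell-side : ∀ {a} → Q.CellPort a → CellSide a
      cell-side c@(Q.old d ¬r) = inside (keeps₁ (proj₁ (R.P-c⊆P d)) (¬r tt)) (¬r tt) (Q₁.old d λ _ → ¬r tt)
      cell-side (Q.new {k} _ d) with i⊎j k
      ... | inj₂ refl = outside
      ... | inj₁ refl with c ← Q₁.new refl d with _ , x ← N₁.total (Q₁.cell-port-wired c) =
        inside x (λ r → new≢old (removed-old isNaming₁ keeps₁ {R₁} R₁≈ c x r)) c
        where
        new≢old : ∀ {x y k} → new k x ≢ old y
        new≢old ()

      unremoved : ∀ {x k} → ν₁ (old x) k → ¬ p.Removed j k → (∀ {l} → l ≡ i → ¬ p.Removed l x) → ∀ {l} → ⊤ → ¬ p.Removed l x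
      unremoved x ¬r n {l} _ d with i⊎j l
      ... | inj₁ refl = n refl d
      ... | inj₂ refl = ¬r (subst (p.Removed j) (N₁.func (named′ d) x) d)

      lower-cell : ∀ {a b} → Q.Cell a b → Q₁.CellPort a → Q₁.Cell a b
      lower-cell (Q.old s d) _             = Q₁.old s λ _ → d tt
      lower-cell (Q.new _ s) (Q₁.new e _) = Q₁.new e s

      lower-principal : ∀ {a} → Q.Principal a → Q₁.CellPort a → Q₁.Principal a
      lower-principal (Q.old s d) _             = Q₁.old s λ _ → d tt
      lower-principal (Q.new _ s) (Q₁.new e _) = Q₁.new e s

      lower-label : ∀ {a l} → Q.Label a l → Q₁.CellPort a → Q₁.Label a l
      lower-label (Q.old s d) _             = Q₁.old s λ _ → d tt
      lower-label (Q.new _ s) (Q₁.new e _) = Q₁.new e s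

      open RawNet (Q.quotient ν) using (cell; principal; label)
      open RawNet (Q₂.quotient ν₂) using () renaming (cell to cell₂; principal to principal₂; label to label₂)

      cell⇒ : ∀ {m n} → cell m n → cell₂ m n
      cell⇒ (_ , _ , x , s , y) with cell-side (Q.cell-port s)
      cell⇒ (_ , _ , x , Q.new _ s , y) | outside = _ , _ , new x , Q₂.new refl s , new y
      cell⇒ (_ , _ , x , s , y) | inside x′ ¬r c with s₁ ← lower-cell s c
        with _ , y′ ← N₁.total (Q₁.cell-port-wired (Q₁.cell-port-to s₁)) =
        _ , _ , old x′ x , Q₂.old (proj₂ cell-≈ (_ , _ , x′ , s₁ , y′)) (λ { refl → ¬r }) , old y′ y

      cell⇐ : ∀ {m n} → cell₂ m n → cell m n
      cell⇐ (_ , _ , new x , Q₂.new refl s , new y) = _ , _ , x , Q.new tt s , y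
      cell⇐ (_ , _ , old x x′ , Q₂.old s ¬r , old y y′) with proj₁ cell-≈ s
      ... | _ , _ , u , Q₁.old s₁ d , v =
        _ , _ , same-class′ x u x′ , Q.old s₁ (unremoved u (¬r refl) d) , same-class′ y v y′
      ... | _ , _ , u , Q₁.new refl s₁ , v = _ , _ , same-class′ x u x′ , Q.new tt s₁ , same-class′ y v y′

      principal⇒ : ∀ {n} → principal n → principal₂ n
      principal⇒ (_ , x , s) with cell-side (Q.principal-port s)
      principal⇒ (_ , x , Q.new _ s) | outside = _ , new x , Q₂.new refl s
      principal⇒ (_ , x , s) | inside x′ ¬r c =
        _ , old x′ x , Q₂.old (proj₂ principal-≈ (_ , x′ , lower-principal s c)) (λ { refl → ¬r })

      principal⇐ : ∀ {n} → principal₂ n → principal n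
      principal⇐ (_ , new x , Q₂.new refl s) = _ , x , Q.new tt s
      principal⇐ (_ , old x x′ , Q₂.old s ¬r) with proj₁ principal-≈ s
      ... | _ , u , Q₁.old s₁ d    = _ , same-class′ x u x′ , Q.old s₁ (unremoved u (¬r refl) d)
      ... | _ , u , Q₁.new refl s₁ = _ , same-class′ x u x′ , Q.new tt s₁

      label⇒ : ∀ {n l} → label n l → label₂ n l
      label⇒ (_ , x , s) with cell-side (Q.label-port s)
      label⇒ (_ , x , Q.new _ s) | outside = _ , new x , Q₂.new refl s
      label⇒ (_ , x , s) | inside x′ ¬r c =
        _ , old x′ x , Q₂.old (proj₂ label-≈ (_ , x′ , lower-label s c)) (λ { refl → ¬r })

      label⇐ : ∀ {n l} → label₂ n l → label n l
      label⇐ (_ , new x , Q₂.new refl s) = _ , x , Q.new tt s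
      label⇐ (_ , old x x′ , Q₂.old s ¬r) with proj₁ label-≈ s
      ... | _ , u , Q₁.old s₁ d    = _ , same-class′ x u x′ , Q.old s₁ (unremoved u (¬r refl) d)
      ... | _ , u , Q₁.new refl s₁ = _ , same-class′ x u x′ , Q.new tt s₁

    quotient-≈ : Q.quotient ν ≈ Q₂.quotient ν₂
    quotient-≈ = record
      { wire-≈      = wire⇒ , wire⇐
      ; cell-≈      = cell⇒ , cell⇐
      ; principal-≈ = principal⇒ , principal⇐
      ; label-≈     = label⇒ , label⇐
      }

    residual : ∀ {R′ : Net} → Net.raw R′ ≈ Quotient.quotient both ν →
               Reduct R₁ R′ ps j (survives isNaming₁ keeps₁ {R₁} R₁≈)
    residual R′≈ = record
      { ν = ν₂ ; isNaming = isNaming₂ ; keeps = keeps₂ ; reduct-≈ = ≈-trans R′≈ quotient-≈ }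

  -- Names for both reducts

  module JointNaming
    {R : Net} {ps : Bool → Patch} (both : IsSystem R Both ps)
    (N : Bool → Net) (reducts : ∀ i → Reduct R (N i) ps i (IsSystem.redex both tt))
    (fresh : ∀ x → x ∈ Net.carrier (N true) → x ∈ Net.carrier (N false) → x ∈ Net.carrier R)
    where

    private
      module R = Net R
      module N i = Net (N i)
      module NW i = WPermutation (N.wire-isWPermutation i)
      module p k = Patch (ps k)
      open module reducts i = Reduct (reducts i) renaming (reduct-≈ to N≈)

    module Q = Quotient both
    open Q.Canonical code code-injective renaming (canonical to ν₀)
    private module N₀ = Q.Naming canonical-isNaming

    -- The joint orbit with provisional name `n` must be renamed to `m`, since it contains a port
    -- that one reduct calls `m` and the remaining step does not remove `m`.
    data Old (i j : Bool) (n m : ℕ) : Set where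
      mkOld : ∀ {a} → ν i a m → ¬ p.Removed j m → ν₀ a n → Old i j n m

    module Half {i j : Bool} (i≢j : i ≢ j) (i⊎j : ∀ k → k ≡ i ⊎ k ≡ j) where

      open Survival both i≢j i⊎j hiding (module Q)
      private module Nᵢ = Q₁.Naming (isNaming i)

      name-carrier : ∀ {a m} → ν i a m → m ∈ N.carrier i
      name-carrier x = _ , proj₂ (_≈_.wire-≈ (N≈ i)) (proj₂ (Nᵢ.quotient-dom x))

      carrier-name : ∀ {m} → m ∈ N.carrier i → ∃ λ a → ν i a m
      carrier-name (_ , w) = Nᵢ.quotient-name (proj₁ (_≈_.wire-≈ (N≈ i)) w)

      same : ∀ {a b m n} → ν i a m → ν i b m → ν₀ a n → ν₀ b n
      same = same-class (isNaming i) canonical-isNaming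

      removed-name : ∀ {x} → p.Removed j x → ν i (old x) x
      removed-name = named (isNaming i) (keeps i) {N i} (N≈ i)

      old-name : ∀ {m} → m ∈ N.carrier i → ¬ p.Removed j m → ∃ λ a → ν i a m × ∃ (ν₀ a)
      old-name d ¬r with _ , x ← carrier-name d =
        _ , x , N₀.total (wired-both (isNaming i) (keeps i) {N i} (N≈ i) x (¬r ∘ p.active-removed j))

      foreign : ∀ {q n} → ¬ ν i (new j q) n
      foreign x with _ , Q₁.new e _ ← Nᵢ.wired x = i≢j (sym e)

      data Entry (b : Port) : Port → Set where
        stays  : ∀ {a} → Q₁.next b a → Entry b a
        leaves : ∀ {q} → Entry b (new j q)
        enters : ∀ {s} → p.Removed j s → Entry b (old s)

      entry : ∀ {b a} → Q.next b a → Entry b a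
      entry (_ , w@(Q.old _ _) , Q.down {k} _ g) with i⊎j k
      ... | inj₁ refl = stays (_ , lower-wire w , Q₁.down refl g)
      ... | inj₂ refl = leaves
      entry (_ , Q.new {k} _ w , Q.up _ g) with i⊎j k
      ... | inj₁ refl = stays (_ , Q₁.new refl w , Q₁.up refl g)
      ... | inj₂ refl = enters (Redex.glue-removed (Q.redex tt) g)

      -- The last step of the walk must be a first-stage one. Otherwise it ends in the right-hand
      -- side of `j`, which has no names in this reduct, or at a port of the redex of `j`, whose
      -- name is removed.
      settled : ∀ n {a a′ m m′} → Q.Steps n a a′ → ν i a m → ν i a′ m′ → ¬ p.Removed j m′ → m ≡ m′
      settled zero    refl        x y ¬r = Nᵢ.func x y
      settled (suc n) (_ , r , s) x y ¬r with entry s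
      ... | stays t  = settled n r x (Nᵢ.follows⁻ t y) ¬r
      ... | leaves   = contradiction y foreign
      ... | enters d = contradiction (subst (p.Removed j) (Nᵢ.func (removed-name d) y) d) ¬r

      old-functional : ∀ {n m m′} → Old i j n m → Old i j n m′ → m ≡ m′
      old-functional (mkOld x ¬r y) (mkOld x′ ¬r′ y′) with N₀.connected y y′
      ... | inj₁ (n , r) = settled n r x x′ ¬r′
      ... | inj₂ (n , r) = sym (settled n r x′ x ¬r)

      old-injective : ∀ {n n′ m} → Old i j n m → Old i j n′ m → n ≡ n′
      old-injective (mkOld x _ y) (mkOld x′ _ y′) = N₀.func (same x x′ y) y′

      old? : ∀ n → Dec (∃ (Old i j n))
      old? n = map′ (λ p → let m , q , o = find p in m , o)
                    (λ { (m , o@(mkOld x _ _)) → lose (NW.dom⇒port i (name-carrier x)) o })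
                    (any? decide (NW.ports i))
        where
        decide : ∀ m → Dec (Old i j n m)
        decide m with m ∈? NW.ports i | p.removed? j m
        ... | no ¬m | _     = no λ { (mkOld x _ _) → ¬m (NW.dom⇒port i (name-carrier x)) }
        ... | _     | yes r = no λ { (mkOld _ ¬r _) → ¬r r }
        ... | yes k | no ¬r with a , x , n′ , y ← old-name (NW.port⇒dom i k) ¬r with n′ ≟ n
        ...   | yes refl = yes (mkOld x ¬r y)
        ...   | no n′≢n  = no λ { (mkOld x′ _ y′) → n′≢n (N₀.func (same x x′ y) y′) }

    private
      true≢false : true ≢ false
      true≢false ()

      false≢true : false ≢ true
      false≢true ()

      true⊎false : ∀ k → k ≡ true ⊎ k ≡ false
      true⊎false true  = inj₁ refl
      true⊎false false = inj₂ refl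

      false⊎true : ∀ k → k ≡ false ⊎ k ≡ true
      false⊎true true  = inj₂ refl
      false⊎true false = inj₁ refl

    private
      unremoved-name : ∀ {i x n} → ν₀ (old x) n → ¬ p.Removed i x → ν i (old x) x
      unremoved-name x ¬r with _ , Q.old w _ ← N₀.wired x = keeps _ (_ , w) ¬r

    module Agree {i j : Bool} (i≢j : i ≢ j) (i⊎j : ∀ k → k ≡ i ⊎ k ≡ j) (j⊎i : ∀ k → k ≡ j ⊎ k ≡ i) where

      private
        module Nᵢ = Wiring.Naming (IsSystem.isWiring (only-system {R} {ps} {i} (IsSystem.redex both tt))) (isNaming i)
        module Nⱼ = Wiring.Naming (IsSystem.isWiring (only-system {R} {ps} {j} (IsSystem.redex both tt))) (isNaming j)

      -- Steps at the end of the walk are peeled off as in `settled`, but for the wiring of `j`,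
      -- until a single port with both names is left. It cannot belong to a right-hand side, each of
      -- which is named in only one reduct, nor to a redex; so both reducts keep its number.
      meet : ∀ n {a a′ m m′ o} → Q.Steps n a a′ → ν₀ a o → ν i a m → ν j a′ m′ →
             ¬ p.Removed j m → ¬ p.Removed i m′ → m ≡ m′
      meet (suc n) (_ , r , s) z x y ¬r ¬r′ with Half.entry (i≢j ∘ sym) j⊎i s
      ... | Half.stays t  = meet n r z x (Nⱼ.follows⁻ t y) ¬r ¬r′
      ... | Half.leaves   = contradiction y (Half.foreign (i≢j ∘ sym) j⊎i)
      ... | Half.enters d = contradiction (subst (p.Removed i) (Nⱼ.func (Half.removed-name (i≢j ∘ sym) j⊎i d) y) d) ¬r′
      meet zero {new k q} refl z x y ¬r ¬r′ with i⊎j k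
      ... | inj₁ refl = contradiction y (Half.foreign (i≢j ∘ sym) j⊎i)
      ... | inj₂ refl = contradiction x (Half.foreign i≢j i⊎j)
      meet zero {old v} refl z x y ¬r ¬r′ with p.removed? i v | p.removed? j v
      ... | yes d | _     = contradiction (subst (p.Removed i) (Nⱼ.func (Half.removed-name (i≢j ∘ sym) j⊎i d) y) d) ¬r′
      ... | _     | yes d = contradiction (subst (p.Removed j) (Nᵢ.func (Half.removed-name i≢j i⊎j d) x) d) ¬r
      ... | no ¬d | no ¬e = trans (Nᵢ.func x (unremoved-name z ¬d)) (Nⱼ.func (unremoved-name z ¬e) y)

    old-agree : ∀ {n m m′} → Old true false n m → Old false true n m′ → m ≡ m′
    old-agree (mkOld x ¬r y) (mkOld x′ ¬r′ y′) with N₀.connected y y′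
    ... | inj₁ (n , r) = Agree.meet true≢false true⊎false false⊎true n r y x x′ ¬r ¬r′
    ... | inj₂ (n , r) = sym (Agree.meet false≢true false⊎true true⊎false n r y′ x′ x ¬r′ ¬r)

    -- The assumption on common ports enters here: `m` is a port of `R` outside both redexes, so
    -- both reducts use it to name `old m`, which lies on both joint orbits.
    old-separate : ∀ {n n′ m} → Old true false n m → Old false true n′ m → n ≡ n′
    old-separate (mkOld x ¬r y) (mkOld x′ ¬r′ y′)
      with d ← fresh _ (Half.name-carrier true≢false true⊎false x) (Half.name-carrier false≢true false⊎true x′) =
      N₀.func (Half.same true≢false true⊎false x (keeps true d ¬r′) y) (Half.same false≢true false⊎true x′ (keeps false d ¬r) y′)

    private
      limit = bound (NW.ports true ++ NW.ports false)

    -- Exceeds every port of either reduct, so that `M + n` collides with none of the imposed names.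
    M : ℕ
    M = proj₁ limit

    -- Neither R₁ nor R₂ names the loops through both right-hand sides.
    data Rename (n : ℕ) : ℕ → Set where
      true-name  : ∀ {m} → Old true false n m → Rename n m
      false-name : ∀ {m} → Old false true n m → Rename n m
      new-name   : ¬ ∃ (Old true false n) → ¬ ∃ (Old false true n) → Rename n (M + n)

    rename-total : ∀ n → ∃ (Rename n)
    rename-total n with Half.old? true≢false true⊎false n | Half.old? false≢true false⊎true n
    ... | yes (_ , o) | _           = _ , true-name o
    ... | no _        | yes (_ , o) = _ , false-name o
    ... | no ¬t       | no ¬f       = _ , new-name ¬t ¬f

    rename-functional : ∀ {n m m′} → Rename n m → Rename n m′ → m ≡ m′
    rename-functional (true-name o)    (true-name o′)    = Half.old-functional true≢false true⊎false o o′
    rename-functional (true-name o)    (false-name o′)   = old-agree o o′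
    rename-functional (true-name o)    (new-name ¬t _)   = contradiction (_ , o) ¬t
    rename-functional (false-name o)   (true-name o′)    = sym (old-agree o′ o)
    rename-functional (false-name o)   (false-name o′)   = Half.old-functional false≢true false⊎true o o′
    rename-functional (false-name o)   (new-name _ ¬f)   = contradiction (_ , o) ¬f
    rename-functional (new-name ¬t _)  (true-name o)     = contradiction (_ , o) ¬t
    rename-functional (new-name _ ¬f)  (false-name o)    = contradiction (_ , o) ¬f
    rename-functional (new-name _ _)   (new-name _ _)    = refl

    private
      below-true : ∀ {n m} → Old true false n m → m < M
      below-true (mkOld x _ _) = proj₂ limit (∈-++⁺ˡ (NW.dom⇒port true (Half.name-carrier true≢false true⊎false x)))

      below-false : ∀ {n m} → Old false true n m → m < M
      below-false (mkOld x _ _) = proj₂ limit (∈-++⁺ʳ (NW.ports true) (NW.dom⇒port false (Half.name-carrier false≢true false⊎true x)))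

    rename-injective : ∀ {n n′ m} → Rename n m → Rename n′ m → n ≡ n′
    rename-injective x y = injective x y refl
      where
      injective : ∀ {n n′ m m′} → Rename n m → Rename n′ m′ → m ≡ m′ → n ≡ n′
      injective (true-name o)  (true-name o′)  refl = Half.old-injective true≢false true⊎false o o′
      injective (true-name o)  (false-name o′) refl = old-separate o o′
      injective (true-name o)  (new-name _ _)  refl = contradiction (below-true o) (ℕ.m+n≮m M _)
      injective (false-name o) (true-name o′)  refl = sym (old-separate o′ o)
      injective (false-name o) (false-name o′) refl = Half.old-injective false≢true false⊎true o o′
      injective (false-name o) (new-name _ _)  refl = contradiction (below-false o) (ℕ.m+n≮m M _)
      injective (new-name _ _) (true-name o)   refl = contradiction (below-true o) (ℕ.m+n≮m M _)
      injective (new-name _ _) (false-name o)  refl = contradiction (below-false o) (ℕ.m+n≮m M _)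
      injective (new-name _ _) (new-name _ _)  eq   = ℕ.+-cancelˡ-≡ M _ _ eq

    joint : REL Port ℕ 0ℓ
    joint a m = ∃ λ n → ν₀ a n × Rename n m

    joint-isNaming : Q.IsNaming joint
    joint-isNaming = record
      { total     = λ w → let n , x = N₀.total w ; m , r = rename-total n in m , n , x , r
      ; wired     = λ (_ , x , _) → N₀.wired x
      ; func      = λ { (_ , x , r) (_ , y , r′) → rename-functional r (subst (λ n → Rename n _) (N₀.func y x) r′) }
      ; follows   = λ s (_ , x , r) → _ , N₀.follows s x , r
      ; connected = λ { (_ , x , r) (_ , y , r′) → N₀.connected x (subst (ν₀ _) (rename-injective r′ r) y) }
      }

    agrees : ∀ {i j} → (∀ {n m} → Old i j n m → Rename n m) → (i≢j : i ≢ j) (i⊎j : ∀ k → k ≡ i ⊎ k ≡ j) →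
             ∀ {n} → n ∈ N.carrier i → ¬ p.Removed j n → ∃ λ a → ν i a n × joint a n
    agrees rename i≢j i⊎j d ¬r with _ , x , _ , y ← Half.old-name i≢j i⊎j d ¬r =
      _ , x , _ , y , rename (mkOld x ¬r y)

    survivor : ∀ {i j} (i≢j : i ≢ j) (i⊎j : ∀ k → k ≡ i ⊎ k ≡ j) → Redex (N i) (ps j)
    survivor {i} {j} i≢j i⊎j =
      Survival.survives {R} {ps} both {i} {j} i≢j i⊎j {ν i} (isNaming i) (keeps i) {N i} (N≈ i)

    joint-net : Net
    joint-net = Q.quotientNet joint-isNaming

    joint-≈ : Net.raw joint-net ≈ Quotient.quotient both joint
    joint-≈ = ≈-refl

    closing-reduct : ∀ {i j} → (∀ {n m} → Old i j n m → Rename n m) →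
                     (i≢j : i ≢ j) (i⊎j : ∀ k → k ≡ i ⊎ k ≡ j) → Reduct (N i) joint-net ps j (survivor i≢j i⊎j)
    closing-reduct {i} {j} rename i≢j i⊎j =
      Composition.residual {R} {ps} both {i} {j} i≢j i⊎j {ν i} (isNaming i) (keeps i) {N i} (N≈ i)
        {joint} joint-isNaming (agrees rename i≢j i⊎j) {joint-net} joint-≈

    reduct-true : Reduct (N true) joint-net ps false (survivor true≢false true⊎false)
    reduct-true = closing-reduct true-name true≢false true⊎false

    reduct-false : Reduct (N false) joint-net ps true (survivor false≢true false⊎true)
    reduct-false = closing-reduct false-name false≢true false⊎true

  -- Cutting out a redex

  module ContextGluing (X N : Context) (K : Net) (α : Renaming (Context.raw N) (Net.raw K))
    (size : length (Context.interface X) ≡ length (map (Renaming.to α) (Context.interface N)))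
    (disjoint : Disjoint (Context.carrier X) (Net.carrier K)) where

    private
      module X = Context X
      module N = Context N
      module K = Net K
      module α = Renaming α

    interface : List ℕ
    interface = map α.to N.interface

    X-free : ∀ {x} → x ∈ˡ X.interface → x ∈ X.P-f
    X-free = All.lookup (IsInterface.free X.isInterface)

    N-free : ∀ {q} → q ∈ˡ N.interface → q ∈ N.P-f
    N-free = All.lookup (IsInterface.free N.isInterface)

    X-carrier : ∀ {x} → x ∈ˡ X.interface → x ∈ X.carrier
    X-carrier = proj₁ ∘ proj₁ ∘ X-free

    N-carrier : ∀ {q} → q ∈ˡ N.interface → q ∈ N.carrier
    N-carrier = proj₁ ∘ proj₁ ∘ N-free

    interface-unique : Unique interface
    interface-unique = unique-map (λ p q → α.to-injective (N-carrier p) (N-carrier q))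
                                  (IsInterface.unique N.isInterface)

    pair⇒ : ∀ {x q} → (x , q) ∈ˡ zip X.interface N.interface → matching X.interface interface x (α.to q)
    pair⇒ {x} {q} m = subst (λ J → (x , α.to q) ∈ˡ zip J interface) (map-id _) (zip-map⁺ id α.to X.interface N.interface m)

    pair⇐ : ∀ {x y} → matching X.interface interface x y →
            ∃ λ q → (x , q) ∈ˡ zip X.interface N.interface × y ≡ α.to q
    pair⇐ {x} {y} m with _ , q , m′ , refl , e ← zip-map⁻ id α.to X.interface N.interface
                                          (subst (λ J → (x , y) ∈ˡ zip J interface) (sym (map-id _)) m) = q , m′ , e

    isGluing : IsGluing X.wire (matching X.interface interface) K.wire
    isGluing = record
      { σ-perm       = X.wire-isWPermutation
      ; τ-perm       = K.wire-isWPermutation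
      ; disjoint     = disjoint
      ; functional   = zip-functional interface (IsInterface.unique X.isInterface)
      ; injective    = zip-injective X.interface interface-unique
      ; dom-proper   = λ (_ , m) → proj₁ (X-free (zip-∈ˡ _ m))
      ; codom-proper = codom-proper
      ; dom?         = λ x → map′ (zip-total _ _ size) (λ (_ , m) → zip-∈ˡ _ m) (x ∈? X.interface)
      ; codom?       = λ x → map′ (zip-onto _ _ size) (λ (_ , m) → zip-∈ʳ X.interface m) (x ∈? interface)
      }
      where
      codom-proper : ∀ {y} → y ∈ codom (matching X.interface interface) → y ∈ K.carrier × ¬ K.wire y y
      codom-proper (_ , m) with q , m′ , refl ← pair⇐ m with (d , ¬w) , _ ← N-free (zip-∈ʳ X.interface m′) =
        α.to-carrier d , ¬w ∘ from (α.to-wire d d)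

    open Gluing isGluing public

    image-carrier : ∀ {y} → y ∈ K.carrier → ∃ λ q → q ∈ N.carrier × y ≡ α.to q
    image-carrier d with q , d′ , refl ← α.to-surjective d = q , d′ , refl

    outside-unglued : ∀ {x} → x ∈ X.carrier → ¬ x ∈ˡ X.interface → ¬ Glued x
    outside-unglued d ¬m (_ , inj₁ m) = ¬m (zip-∈ˡ _ m)
    outside-unglued d ¬m (_ , inj₂ m) with _ , m′ , refl ← pair⇐ m =
      disjoint d (α.to-carrier (N-carrier (zip-∈ʳ X.interface m′)))

    inside-unglued : ∀ {q} → q ∈ N.carrier → ¬ q ∈ˡ N.interface → ¬ Glued (α.to q)
    inside-unglued d ¬m (_ , inj₁ m) = disjoint (X-carrier (zip-∈ˡ _ m)) (α.to-carrier d)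
    inside-unglued d ¬m (_ , inj₂ m) with _ , m′ , e ← pair⇐ m
      with refl ← α.to-injective d (N-carrier (zip-∈ʳ X.interface m′)) e = ¬m (zip-∈ʳ X.interface m′)

  -- Place relates the ports of a context X to the ports of S that remain when
  -- the redex of p is cut out: an interface port stands for the port of the
  -- redex to which it used to be attached.
  data Place (p : Patch) (X : Context) : ℕ → ℕ → Set where
    keep : ∀ {x} → x ∈ Context.carrier X → ¬ x ∈ˡ Context.interface X → Place p X x x
    cut  : ∀ {x r} → (x , r) ∈ˡ zip (Context.interface X) (Patch.I p) → Place p X x (Patch.attach p r)

  -- Describes the context through `S` alone, without reference to a renamed left-hand side. It
  -- follows from a source gluing (`FromSource`) and suffices to rebuild one (`ToSource`).
  record IsCut (S : Net) (p : Patch) (X : Context) : Set where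
    open Patch p
    private
      module S = Net S
      module X = Context X
    field
      redex      : Redex S p
      size       : length X.interface ≡ length I
      unremoved  : ∀ {x} → x ∈ X.carrier → ¬ x ∈ˡ X.interface → ¬ Removed x
      onto       : ∀ {s} → s ∈ S.carrier → ¬ Active s → ∃ λ x → Place p X x s
      wire⇒      : ∀ {x y s t} → Place p X x s → Place p X y t → X.wire x y → S.wire s t
      wire⇐      : ∀ {x y s t} → Place p X x s → Place p X y t → S.wire s t → X.wire x y
      cell⇒      : ∀ {x y} → X.cell x y → S.cell x y
      cell⇐      : ∀ {x y} → S.cell x y → ¬ Removed x → X.cell x y
      principal⇒ : ∀ {x} → X.principal x → S.principal x
      principal⇐ : ∀ {x} → S.principal x → ¬ Removed x → X.principal x
      label⇒     : ∀ {x s} → X.label x s → S.label x s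
      label⇐     : ∀ {x s} → S.label x s → ¬ Removed x → X.label x s

  module PlaceProperties {p : Patch} {X : Context} (size : length (Context.interface X) ≡ length (Patch.I p)) where

    open Patch p
    private
      module X = Context X
      module XW = WPermutation X.wire-isWPermutation

    place : ∀ {x} → x ∈ X.carrier → ∃ (Place p X x)
    place {x} d with x ∈? X.interface
    ... | no ¬m = x , keep d ¬m
    ... | yes m with r , m′ ← zip-total X.interface I size m = attach r , cut m′

    place-carrier : ∀ {x s} → Place p X x s → x ∈ X.carrier
    place-carrier (keep d _) = d
    place-carrier (cut m) = proj₁ (proj₁ (All.lookup (IsInterface.free X.isInterface) (zip-∈ˡ _ m)))

    place-func : ∀ {x s t} → Place p X x s → Place p X x t → s ≡ t
    place-func (keep _ _)  (keep _ _)  = refl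
    place-func (keep _ ¬m) (cut m)     = contradiction (zip-∈ˡ _ m) ¬m
    place-func (cut m)     (keep _ ¬m) = contradiction (zip-∈ˡ _ m) ¬m
    place-func (cut m)     (cut m′)    = cong attach (zip-functional I (IsInterface.unique X.isInterface) m m′)

    cell-outside : ∀ {x} → x ∈ X.P-c → ¬ x ∈ˡ X.interface
    cell-outside d m = proj₂ (All.lookup (IsInterface.free X.isInterface) m) d

    module _ {S : Net} (redex : Redex S p)
             (unremoved : ∀ {x} → x ∈ X.carrier → ¬ x ∈ˡ X.interface → ¬ Removed x) where

      private module SW = WPermutation (Net.wire-isWPermutation S)

      place-removed : ∀ {x s} → Place p X x s → ¬ Removed s → x ≡ s
      place-removed (keep _ _) _  = refl
      place-removed (cut m)    ¬d = contradiction (Redex.attach-removed redex (zip-∈ʳ X.interface m)) ¬d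

      place-inj : ∀ {x y s} → Place p X x s → Place p X y s → x ≡ y
      place-inj l r = injective l r refl
        where
        injective : ∀ {x y s t} → Place p X x s → Place p X y t → s ≡ t → x ≡ y
        injective (keep _ _)  (keep _ _) e    = e
        injective (keep d ¬m) (cut m)    refl = contradiction (Redex.attach-removed redex (zip-∈ʳ X.interface m)) (unremoved d ¬m)
        injective (cut m)     (keep d ¬m) refl = contradiction (Redex.attach-removed redex (zip-∈ʳ X.interface m)) (unremoved d ¬m)
        injective (cut {r = r} m) (cut {r = u} m′) e
          with refl ← Redex.attach-injective redex (zip-∈ʳ X.interface m) (zip-∈ʳ X.interface m′) e =
          zip-injective X.interface (IsInterface.unique L.isInterface) m m′

      place-inactive : ∀ {x s} → Place p X x s → ¬ Active s
      place-inactive (keep d ¬m) a = unremoved d ¬m (active-removed a)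
      place-inactive (cut m)     a = Redex.attach-inactive redex (zip-∈ʳ X.interface m) a

      -- Preservation gives reflection: `x` is wired to something in `X`, and the image of that wire
      -- must be the given one because wires of `S` are functional.
      place-wire⇐ : (∀ {x y s t} → Place p X x s → Place p X y t → X.wire x y → Net.wire S s t) →
                    ∀ {x y s t} → Place p X x s → Place p X y t → Net.wire S s t → X.wire x y
      place-wire⇐ wire⇒ l r w with y′ , v ← place-carrier l with _ , r′ ← place (_ , XW.symmetric v)
        with refl ← SW.functional w (wire⇒ l r′ v) with refl ← place-inj r r′ = v

  -- The source of a step: gluing a context with a left-hand side

  module Source {p : Patch} (X : Context) (K : Net) (α : Renaming (Context.raw (Patch.R-r p)) (Net.raw K))
    (α≡ι : ∀ {t} → Patch.Inner p t → Renaming.to α t ≡ Patch.ι p t)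
    (size : length (Context.interface X) ≡ length (map (Renaming.to α) (Patch.I p)))
    (disjoint : Disjoint (Context.carrier X) (Net.carrier K)) where

    open Patch p
    private
      module X = Context X
      module K = Net K
      module α = Renaming α
      module XW = WPermutation X.wire-isWPermutation
      module LW = WPermutation L.wire-isWPermutation
    module G = ContextGluing X R-r K α size disjoint

    size′ : length X.interface ≡ length I
    size′ = trans size (length-map α.to I)

    open PlaceProperties {p} {X} size′ public

    inner-carrier : ∀ {t} → Inner t → t ∈ L.carrier
    inner-carrier = proj₁ ∘ L.P-c⊆P

    inner-unglued : ∀ {t} → Inner t → ¬ G.Glued (α.to t)
    inner-unglued i = G.inside-unglued (inner-carrier i) (λ m → I-outer m i)

    ι-carrier : ∀ {t} → Inner t → ι t ∈ K.carrier
    ι-carrier i = subst K.carrier (α≡ι i) (α.to-carrier (inner-carrier i))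

    attach-≡ : ∀ {r} → r ∈ˡ I → α.to (mate r) ≡ attach r
    attach-≡ m = α≡ι (proj₁ (I-mate m (I-wire m)))

    attach-wire : ∀ {r} → r ∈ˡ I → K.wire (α.to r) (attach r)
    attach-wire m = subst (K.wire _) (attach-≡ m) (to (α.to-wire (_ , I-wire m) (_ , LW.symmetric (I-wire m))) (I-wire m))

    place-unglued : ∀ {x s} → Place p X x s → ¬ G.Glued s
    place-unglued (keep d ¬m) = G.outside-unglued d ¬m
    place-unglued (cut m) with m′ ← zip-∈ʳ X.interface m =
      subst (λ s → ¬ G.Glued s) (attach-≡ m′) (inner-unglued (proj₁ (I-mate m′ (I-wire m′))))

    -- A redex port `attach r` is wired to the image of `r`, which is glued to `x`; so one step
    -- leads from it into the context. This step and its mirror image in `place-exit` extend a wire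
    -- of `X` to a wire of the gluing.
    place-enter : ∀ {x s} → Place p X x s → s G.↝ x
    place-enter (keep d _) = zero , refl
    place-enter (cut m) = 1 , _ , refl , _ ,
      inj₂ (WPermutation.symmetric K.wire-isWPermutation (attach-wire (zip-∈ʳ X.interface m))) , inj₂ (G.pair⇒ m)

    place-exit : ∀ {x y t} → Place p X y t → X.wire x y → ∃ λ z → x G.↝ z × G.W z t
    place-exit (keep _ _) w = _ , (zero , refl) , inj₁ w
    place-exit (cut m)    w = _ , (1 , _ , refl , _ , inj₁ w , inj₁ (G.pair⇒ m)) , inj₂ (attach-wire (zip-∈ʳ X.interface m))

    glued-wire : Graph
    glued-wire = X.wire ↭[ matching X.interface G.interface ] K.wire

    direct : ∀ {s z t} → ¬ G.Glued s → s G.↝ z → G.W z t → ¬ G.Glued t → glued-wire s t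
    direct ¬s r w ¬t = G.quotient⇒↭ (inj₁ (_ , _ ,
      G.chain r ¬s (G.wired-↜ (proj₁ r) (_ , w) (proj₂ r)) refl , w , ¬t ,
      G.chain (zero , refl) ¬t (_ , IsWiring.W-sym G.isWiring w) refl))

    wire-place : ∀ {x y s t} → Place p X x s → Place p X y t → X.wire x y → glued-wire s t
    wire-place l r w with _ , q , v ← place-exit r w =
      direct (place-unglued l) (G.↝-trans (place-enter l) q) v (place-unglued r)

    wire-active : glued-wire (ι b) (ι c)
    wire-active rewrite sym (α≡ι b-inner) | sym (α≡ι c-inner) =
      direct (inner-unglued b-inner) (zero , refl)
        (inj₂ (to (α.to-wire (inner-carrier b-inner) (inner-carrier c-inner)) b-c)) (inner-unglued c-inner)

    glued-functional : ∀ {s t u} → glued-wire s t → glued-wire s u → t ≡ u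
    glued-functional w v = G.Naming.quotient-func G.canonical-isNaming (G.↭⇒quotient w) (G.↭⇒quotient v)

    glued-symmetric : ∀ {s t} → glued-wire s t → glued-wire t s
    glued-symmetric w = G.quotient⇒↭ (G.Naming.quotient-sym G.canonical-isNaming (G.↭⇒quotient w))

    private
      leaf-exit : ∀ {r u} → r ∈ˡ I → G.W (α.to r) u → ¬ G.Glued u
      leaf-exit m (inj₁ w) = contradiction (α.to-carrier (G.N-carrier m)) (disjoint (_ , w))
      leaf-exit m (inj₂ w)
        with refl ← IsWPermutation.functional K.wire-isWPermutation w (attach-wire m) =
        subst (λ s → ¬ G.Glued s) (attach-≡ m) (inner-unglued (proj₁ (I-mate m (I-wire m))))

      -- An interface port of a left-hand side is wired to a cell port, which is never glued. A walk
      -- that enters the left-hand side thus exits at once, and the source gluing has no double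
      -- orbits.
      acyclic : ∀ {a} → ¬ G.Cyclic a
      acyclic c with G.cyclic-glued c
      ... | _ , inj₂ m with _ , m′ , refl ← G.pair⇐ m with k , r ← c with _ , (_ , w , s) , _ ← G.uncons k r =
        leaf-exit (zip-∈ʳ X.interface m′) w (_ , s)
      ... | _ , inj₁ m with _ , m′ , refl ← G.pair⇐ m with k , r@(u , q , _ , w , s) ← c
        with refl ← G.g-func (inj₁ m) (G.g-sym s) =
        leaf-exit (zip-∈ʳ X.interface m′) (IsWiring.W-sym G.isWiring w) (G.cyclic-glued (G.cyclic-← (_ , w , s) c))

    wire-source : ∀ {s t} → glued-wire s t → (∃ λ x → Place p X x s) ⊎ Active s
    wire-source w with G.↭⇒quotient w
    ... | inj₁ (_ , _ , G.loop c _ _ _ , _)        = contradiction c acyclic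
    ... | inj₂ (_ , (_ , n) , cl)                    = contradiction (G.Naming.closed⇒cyclic G.canonical-isNaming n cl) acyclic
    ... | inj₁ (_ , _ , G.chain _ ¬g (_ , inj₁ v) refl , _) =
      inj₁ (_ , keep (_ , v) λ m → ¬g (let _ , m′ = zip-total X.interface G.interface size m in _ , inj₁ m′))
    ... | inj₁ (_ , _ , G.chain _ ¬g (_ , inj₂ v) refl , _) with t , d , refl ← G.image-carrier (_ , v)
      with t ∈? I
    ...   | yes m = contradiction (let x , m′ = zip-onto X.interface I size′ m in x , inj₂ (G.pair⇒ m′)) ¬g
    ...   | no ¬m with inner? t
    ...     | no ¬i = contradiction (outer-I d ¬i) ¬m
    ...     | yes i with t ≟ b | t ≟ c
    ...       | yes refl | _        = inj₂ (inj₁ (α≡ι i))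
    ...       | _        | yes refl = inj₂ (inj₂ (α≡ι i))
    ...       | no ¬b    | no ¬c with r , m , w′ ← auxiliary-mate i [ ¬b , ¬c ]′
      with x , m′ ← zip-onto X.interface I size′ m =
      inj₁ (x , subst (Place p X x) (sym (trans (α≡ι i) (cong ι (sym (mate-≡ w′))))) (cut m′))

    private
      ∈codom : ∀ {t u} → L.cell t u → Inner u
      ∈codom s = proj₂ (IsPartialPermutation.dom≐codom L.cell-isPartialPermutation) (_ , s)

      K-codom : ∀ {x y} → K.cell x y → y ∈ K.P-c
      K-codom s = proj₂ (IsPartialPermutation.dom≐codom K.cell-isPartialPermutation) (_ , s)

    K-cell⇒ : ∀ {t u} → L.cell t u → K.cell (ι t) (ι u)
    K-cell⇒ s = subst₂ K.cell (α≡ι (_ , s)) (α≡ι (∈codom s))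
      (to (α.to-cell (inner-carrier (_ , s)) (inner-carrier (∈codom s))) s)

    K-cell⇐ : ∀ {x y} → K.cell x y → ∃₂ λ t u → L.cell t u × x ≡ ι t × y ≡ ι u
    K-cell⇐ s with t , d , refl ← G.image-carrier (proj₁ (K.P-c⊆P (_ , s)))
                 | u , e , refl ← G.image-carrier (proj₁ (K.P-c⊆P (K-codom s)))
      with s′ ← from (α.to-cell d e) s = t , u , s′ , α≡ι (_ , s′) , α≡ι (∈codom s′)

    K-principal⇒ : ∀ {t} → L.principal t → K.principal (ι t)
    K-principal⇒ x with i ← L.principal⊆P-c x = subst K.principal (α≡ι i) (to (α.to-principal (inner-carrier i)) x)

    K-principal⇐ : ∀ {x} → K.principal x → ∃ λ t → L.principal t × x ≡ ι t
    K-principal⇐ x with t , d , refl ← G.image-carrier (proj₁ (K.P-c⊆P (K.principal⊆P-c x)))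
      with x′ ← from (α.to-principal d) x = t , x′ , α≡ι (L.principal⊆P-c x′)

    K-label⇒ : ∀ {t l} → L.label t l → K.label (ι t) l
    K-label⇒ x with i ← from (L.label-dom _) (_ , x) =
      subst (λ y → K.label y _) (α≡ι i) (to (α.to-label (inner-carrier i)) x)

    K-label⇐ : ∀ {x l} → K.label x l → ∃ λ t → L.label t l × x ≡ ι t
    K-label⇐ x with t , d , refl ← G.image-carrier (proj₁ (K.P-c⊆P (from (K.label-dom _) (_ , x))))
      with x′ ← from (α.to-label d) x = t , x′ , α≡ι (from (L.label-dom _) (_ , x′))

    ι-injective′ : ∀ {t u} → Inner t → Inner u → ι t ≡ ι u → t ≡ u
    ι-injective′ i j e = α.to-injective (inner-carrier i) (inner-carrier j) (trans (α≡ι i) (trans e (sym (α≡ι j))))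

    glued-net : RawNet
    glued-net = X.raw ↭ⁿ[ matching X.interface G.interface ] K.raw

    module FromSource {S : Net} (S≈ : Net.raw S ≈ glued-net) where

      private
        module S = Net S
        module SW = WPermutation S.wire-isWPermutation
        open _≈_ S≈

        not-X : ∀ {t} → Inner t → ι t ∉ X.carrier
        not-X i d = disjoint d (ι-carrier i)

        X-P-c : ∀ {x} → x ∈ X.P-c → x ∈ X.carrier
        X-P-c = proj₁ ∘ X.P-c⊆P

        X-codom : ∀ {x y} → X.cell x y → y ∈ X.P-c
        X-codom s = proj₂ (IsPartialPermutation.dom≐codom X.cell-isPartialPermutation) (_ , s)

        X-principal : ∀ {x} → X.principal x → x ∈ X.carrier
        X-principal = X-P-c ∘ X.principal⊆P-c

        X-label : ∀ {x l} → X.label x l → x ∈ X.carrier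
        X-label l = X-P-c (from (X.label-dom _) (_ , l))

      redex : Redex S p
      redex = record
        { ι-injective = ι-injective′
        ; wire-b-c    = proj₂ wire-≈ wire-active
        ; cell⇒       = λ s → proj₂ cell-≈ (inj₂ (K-cell⇒ s))
        ; cell⇐       = cell⇐
        ; cell-from   = cell-from
        ; cell-to     = cell-to
        ; principal⇒  = λ _ x → proj₂ principal-≈ (inj₂ (K-principal⇒ x))
        ; principal⇐  = principal⇐
        ; label⇒      = λ _ x → proj₂ label-≈ (inj₂ (K-label⇒ x))
        ; label⇐      = label⇐
        }
        where
        cell⇐ : ∀ {t u} → Inner t → Inner u → S.cell (ι t) (ι u) → L.cell t u
        cell⇐ i j s with proj₁ cell-≈ s
        ... | inj₁ s′ = contradiction (X-P-c (_ , s′)) (not-X i)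
        ... | inj₂ s′ with t , u , s″ , e , e′ ← K-cell⇐ s′ =
          subst₂ L.cell (sym (ι-injective′ i (_ , s″) e)) (sym (ι-injective′ j (∈codom s″) e′)) s″

        cell-from : ∀ {t y} → Inner t → S.cell (ι t) y → Removed y
        cell-from i s with proj₁ cell-≈ s
        ... | inj₁ s′ = contradiction (X-P-c (_ , s′)) (not-X i)
        ... | inj₂ s′ with _ , _ , s″ , _ , e ← K-cell⇐ s′ = _ , ∈codom s″ , e

        cell-to : ∀ {t y} → Inner t → S.cell y (ι t) → Removed y
        cell-to i s with proj₁ cell-≈ s
        ... | inj₁ s′ = contradiction (X-P-c (X-codom s′)) (not-X i)
        ... | inj₂ s′ with _ , _ , s″ , e , _ ← K-cell⇐ s′ = _ , (_ , s″) , e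

        principal⇐ : ∀ {t} → Inner t → S.principal (ι t) → L.principal t
        principal⇐ i x with proj₁ principal-≈ x
        ... | inj₁ x′ = contradiction (X-principal x′) (not-X i)
        ... | inj₂ x′ with _ , x″ , e ← K-principal⇐ x′ =
          subst L.principal (sym (ι-injective′ i (L.principal⊆P-c x″) e)) x″

        label⇐ : ∀ {t l} → Inner t → S.label (ι t) l → L.label t l
        label⇐ i x with proj₁ label-≈ x
        ... | inj₁ x′ = contradiction (X-label x′) (not-X i)
        ... | inj₂ x′ with _ , x″ , e ← K-label⇐ x′ =
          subst (λ t → L.label t _) (sym (ι-injective′ i (from (L.label-dom _) (_ , x″)) e)) x″

      private
        unremoved : ∀ {x} → x ∈ X.carrier → ¬ x ∈ˡ X.interface → ¬ Removed x
        unremoved d _ (t , i , refl) = not-X i d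

        wire⇒ : ∀ {x y s t} → Place p X x s → Place p X y t → X.wire x y → S.wire s t
        wire⇒ l r w = proj₂ wire-≈ (wire-place l r w)

        onto : ∀ {s} → s ∈ S.carrier → ¬ Active s → ∃ λ x → Place p X x s
        onto (_ , w) ¬a with wire-source (proj₁ wire-≈ w)
        ... | inj₁ l = l
        ... | inj₂ a = contradiction a ¬a

        cell⇐ : ∀ {x y} → S.cell x y → ¬ Removed x → X.cell x y
        cell⇐ s ¬d with proj₁ cell-≈ s
        ... | inj₁ s′ = s′
        ... | inj₂ s′ with _ , _ , s″ , e , _ ← K-cell⇐ s′ = contradiction (_ , (_ , s″) , e) ¬d

        principal⇐ : ∀ {x} → S.principal x → ¬ Removed x → X.principal x
        principal⇐ x ¬d with proj₁ principal-≈ x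
        ... | inj₁ x′ = x′
        ... | inj₂ x′ with _ , x″ , e ← K-principal⇐ x′ = contradiction (_ , L.principal⊆P-c x″ , e) ¬d

        label⇐ : ∀ {x l} → S.label x l → ¬ Removed x → X.label x l
        label⇐ x ¬d with proj₁ label-≈ x
        ... | inj₁ x′ = x′
        ... | inj₂ x′ with _ , x″ , e ← K-label⇐ x′ = contradiction (_ , from (L.label-dom _) (_ , x″) , e) ¬d

      isCut : IsCut S p X
      isCut = record
        { redex      = redex
        ; size       = size′
        ; unremoved  = unremoved
        ; onto       = onto
        ; wire⇒      = wire⇒
        ; wire⇐      = place-wire⇐ redex unremoved wire⇒
        ; cell⇒      = λ s → proj₂ cell-≈ (inj₁ s)
        ; cell⇐      = cell⇐
        ; principal⇒ = λ x → proj₂ principal-≈ (inj₁ x)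
        ; principal⇐ = principal⇐
        ; label⇒     = λ x → proj₂ label-≈ (inj₁ x)
        ; label⇐     = label⇐
        }

    module ToSource {S : Net} (isCut : IsCut S p X) where

      open IsCut isCut using (redex; unremoved; onto)
      private
        module S = Net S
        module SW = WPermutation S.wire-isWPermutation
        module C = IsCut isCut
        module redex = Redex redex

        wire⇒ : ∀ {s t} → S.wire s t → glued-wire s t
        wire⇒ {s} {t} w with active? s
        ... | yes (inj₁ refl) with refl ← SW.functional redex.wire-b-c w = wire-active
        ... | yes (inj₂ refl) with refl ← SW.functional (SW.symmetric redex.wire-b-c) w = glued-symmetric wire-active
        wire⇒ {s} {t} w | no ¬a with _ , l ← onto (_ , w) ¬a
          with _ , r ← onto (_ , SW.symmetric w) (λ a → ¬a (redex.active-wire a (SW.symmetric w))) =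
          wire-place l r (C.wire⇐ l r w)

        glued-carrier : ∀ {s t} → glued-wire s t → s ∈ S.carrier
        glued-carrier w with wire-source w
        ... | inj₂ (inj₁ refl) = _ , redex.wire-b-c
        ... | inj₂ (inj₂ refl) = _ , SW.symmetric redex.wire-b-c
        ... | inj₁ (_ , l) with _ , v ← place-carrier l
          with _ , r ← place (_ , WPermutation.symmetric X.wire-isWPermutation v) = _ , C.wire⇒ l r v

        -- The converse inclusion is enough: `s` is wired in `S`, that wire is also a glued one, and
        -- glued wires are functional.
        wire⇐ : ∀ {s t} → glued-wire s t → S.wire s t
        wire⇐ w with _ , v ← glued-carrier w with refl ← glued-functional (wire⇒ v) w = v

        cell⇒ : ∀ {x y} → S.cell x y → X.cell x y ⊎ K.cell x y
        cell⇒ {x} s with removed? x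
        ... | no ¬d = inj₁ (C.cell⇐ s ¬d)
        ... | yes (t , i , refl) with _ , j , refl ← redex.cell-from i s = inj₂ (K-cell⇒ (redex.cell⇐ i j s))

        cell⇐ : ∀ {x y} → X.cell x y ⊎ K.cell x y → S.cell x y
        cell⇐ (inj₁ s) = C.cell⇒ s
        cell⇐ (inj₂ s) with _ , _ , s′ , refl , refl ← K-cell⇐ s = redex.cell⇒ s′

        principal⇒ : ∀ {x} → S.principal x → X.principal x ⊎ K.principal x
        principal⇒ {x} s with removed? x
        ... | no ¬d = inj₁ (C.principal⇐ s ¬d)
        ... | yes (t , i , refl) = inj₂ (K-principal⇒ (redex.principal⇐ i s))

        principal⇐ : ∀ {x} → X.principal x ⊎ K.principal x → S.principal x
        principal⇐ (inj₁ s) = C.principal⇒ s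
        principal⇐ (inj₂ s) with _ , s′ , refl ← K-principal⇐ s = redex.principal⇒ (L.principal⊆P-c s′) s′

        label⇒ : ∀ {x l} → S.label x l → X.label x l ⊎ K.label x l
        label⇒ {x} s with removed? x
        ... | no ¬d = inj₁ (C.label⇐ s ¬d)
        ... | yes (t , i , refl) = inj₂ (K-label⇒ (redex.label⇐ i s))

        label⇐ : ∀ {x l} → X.label x l ⊎ K.label x l → S.label x l
        label⇐ (inj₁ s) = C.label⇒ s
        label⇐ (inj₂ s) with _ , s′ , refl ← K-label⇐ s = redex.label⇒ (from (L.label-dom _) (_ , s′)) s′

      glues : GluesTo S.raw X.raw X.interface K.raw G.interface
      glues = record
        { same-size = size
        ; disjoint  = disjoint
        ; glued     = record
          { wire-≈      = wire⇒ , wire⇐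
          ; cell-≈      = cell⇒ , cell⇐
          ; principal-≈ = principal⇒ , principal⇐
          ; label-≈     = label⇒ , label⇐
          }
        }

  -- The target of a step

  module Target {S : Net} {ps : Bool → Patch} {i : Bool} {X : Context} (isCut : IsCut S (ps i) X)
    (K : Net) (β : Renaming (Context.raw (Patch.R-p (ps i))) (Net.raw K))
    (size : length (Context.interface X) ≡ length (map (Renaming.to β) (Context.interface (Patch.R-p (ps i)))))
    (disjoint : Disjoint (Context.carrier X) (Net.carrier K)) where

    open Patch (ps i)
    private
      module S = Net S
      module X = Context X
      module K = Net K
      module β = Renaming β
      module C = IsCut isCut
      module SW = WPermutation S.wire-isWPermutation
      module XW = WPermutation X.wire-isWPermutation

    sys : IsSystem S (Only i) ps
    sys = only-system {ps = ps} C.redex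

    module Q = Quotient sys
    module G = ContextGluing X R-p K β size disjoint
    private module P = PlaceProperties {ps i} {X} C.size

    -- A redex port corresponds to the interface port of `X` that replaces it. This turns the direct
    -- glue between the redex and the right-hand side into the matching of the two interfaces.
    data T : Port → ℕ → Set where
      old : ∀ {x s} → Place (ps i) X x s → T (old s) x
      new : ∀ {q} → q ∈ R.carrier → T (new i q) (β.to q)

    private
      place-inj : ∀ {x y s} → Place (ps i) X x s → Place (ps i) X y s → x ≡ y
      place-inj = P.place-inj {S} C.redex C.unremoved

      place-inactive : ∀ {x s} → Place (ps i) X x s → ¬ Active s
      place-inactive = P.place-inactive {S} C.redex C.unremoved

      place-wire : ∀ {x y s} → Place (ps i) X x s → X.wire x y → ∃ λ t → Place (ps i) X y t × S.wire s t
      place-wire l w with _ , r ← P.place (_ , XW.symmetric w) = _ , r , C.wire⇒ l r w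

      apart : ∀ {x s q} → Place (ps i) X x s → q ∈ R.carrier → x ≢ β.to q
      apart l d refl = disjoint (P.place-carrier l) (β.to-carrier d)

      T-inj : ∀ {a b x y} → T a x → T b y → x ≡ y → a ≡ b
      T-inj (old l) (old r) refl = cong old (P.place-func l r)
      T-inj (old l) (new d) e    = contradiction e (apart l d)
      T-inj (new d) (old l) e    = contradiction (sym e) (apart l d)
      T-inj (new d) (new d′) e   = cong (new i) (β.to-injective d d′ e)

      T-wire⇐ : ∀ {a b x y} → T a x → T b y → G.W x y → Q.Wire a b
      T-wire⇐ (old l) (old r) (inj₁ w) = Q.old (C.wire⇒ l r w) λ { refl → place-inactive l }
      T-wire⇐ (old l) (new d) (inj₁ w) = contradiction (β.to-carrier d) (disjoint (_ , XW.symmetric w))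
      T-wire⇐ (new d) _       (inj₁ w) = contradiction (β.to-carrier d) (disjoint (_ , w))
      T-wire⇐ (new d) (new e) (inj₂ w) = Q.new refl (from (β.to-wire d e) w)
      T-wire⇐ (new d) (old l) (inj₂ w) =
        contradiction (_ , WPermutation.symmetric K.wire-isWPermutation w) (disjoint (P.place-carrier l))
      T-wire⇐ (old l) _       (inj₂ w) = contradiction (_ , w) (disjoint (P.place-carrier l))

      T-glue⇒ : ∀ {x s q} → Place (ps i) X x s → q ∈ R.carrier → glue s q →
                matching X.interface G.interface x (β.to q)
      T-glue⇒ l d g with r , m , refl ← glue-attach g with zip-onto X.interface I C.size (zip-∈ˡ _ m)
      ... | x , m′ with refl ← place-inj l (cut m′) =
        G.pair⇒ (zip-compose X.interface R.interface (IsInterface.unique L.isInterface) m′ m)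

      T-match : ∀ {a b x y} → T a x → T b y → matching X.interface G.interface x y →
                ∃₂ λ s q → a ≡ old s × b ≡ new i q × glue s q
      T-match t u m with q , m′ , refl ← G.pair⇐ m with d ← G.N-carrier (zip-∈ʳ X.interface m′)
        with r , m″ ← zip-total X.interface I C.size (zip-∈ˡ _ m)
        with refl ← T-inj t (old (cut m″)) refl | refl ← T-inj u (new d) refl
        with q′ , m‴ , g ← attach-glue (zip-∈ʳ X.interface m″)
        with refl ← zip-functional R.interface (IsInterface.unique X.isInterface) m′
                      (zip-compose X.interface R.interface (IsInterface.unique L.isInterface) m″ m‴) =
        _ , _ , refl , refl , g

    iso : WiringIso T Q.Wire Q.Glue G.W G.g
    iso = record
      { isWiring  = Q.isWiring
      ; isWiring′ = G.isWiring
      ; wired     = wired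
      ; total     = λ { (_ , Q.old w n) → let _ , l = C.onto (_ , w) (n refl) in _ , old l
                      ; (_ , Q.new refl w) → _ , new (_ , w) }
      ; onto      = λ { (_ , inj₁ w) → let _ , l = P.place (_ , w) in _ , old l
                      ; (_ , inj₂ w) → onto (_ , w) }
      ; func      = λ { (old l) (old r) → place-inj l r ; (new _) (new _) → refl }
      ; inj       = λ t u → T-inj t u refl
      ; W⇒        = λ { (old l) (old r) (Q.old w _) → inj₁ (C.wire⇐ l r w)
                      ; (new d) (new e) (Q.new refl w) → inj₂ (to (β.to-wire d e) w) }
      ; W⇐        = T-wire⇐
      ; g⇒        = λ { (old l) (new d) (Q.down refl g) → inj₁ (T-glue⇒ l d g)
                      ; (new d) (old l) (Q.up refl g) → inj₂ (T-glue⇒ l d g) }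
      ; g⇐        = λ { t u (inj₁ m) → glue⇐ t u m ; t u (inj₂ m) → Q.g-sym (glue⇐ u t m) }
      }
      where
      wired : ∀ {a x} → T a x → ∃ (Q.Wire a)
      wired (new (_ , w)) = _ , Q.new refl w
      wired (old l) with _ , v ← P.place-carrier l with _ , _ , w ← place-wire l v =
        _ , Q.old w λ { refl → place-inactive l }

      onto : ∀ {y} → y ∈ K.carrier → ∃ λ a → T a y
      onto d with _ , d′ , refl ← G.image-carrier d = _ , new d′

      glue⇐ : ∀ {a b x y} → T a x → T b y → matching X.interface G.interface x y → Q.Glue a b
      glue⇐ t u m with _ , _ , refl , refl , g ← T-match t u m = Q.down refl g

    open Transport iso public

    glued-net : RawNet
    glued-net = X.raw ↭ⁿ[ matching X.interface G.interface ] K.raw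

    module _ {ν : REL Port ℕ 0ℓ} (isNaming : Q.IsNaming ν)
             (faithful : ∀ {a x} → T a x → ¬ Q.Glued a → ν a x) where

      private
        module N = Q.Naming isNaming

        X-carrier : ∀ {x} → x ∈ X.P-c → x ∈ X.carrier
        X-carrier = proj₁ ∘ X.P-c⊆P

        X-codom : ∀ {x y} → X.cell x y → y ∈ X.P-c
        X-codom s = proj₂ (IsPartialPermutation.dom≐codom X.cell-isPartialPermutation) (_ , s)

        R-codom : ∀ {x y} → R.cell x y → y ∈ R.P-c
        R-codom s = proj₂ (IsPartialPermutation.dom≐codom R.cell-isPartialPermutation) (_ , s)

        K-codom : ∀ {x y} → K.cell x y → y ∈ K.P-c
        K-codom s = proj₂ (IsPartialPermutation.dom≐codom K.cell-isPartialPermutation) (_ , s)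

        R-carrier : ∀ {x} → x ∈ R.P-c → x ∈ R.carrier
        R-carrier = proj₁ ∘ R.P-c⊆P

        unremoved : ∀ {x} → x ∈ X.P-c → ¬ Removed x
        unremoved d = C.unremoved (X-carrier d) (P.cell-outside d)

        X-name : ∀ {x} → x ∈ X.P-c → ν (old x) x
        X-name d = faithful (old (keep (X-carrier d) (P.cell-outside d)))
          λ { (_ , Q.down refl g) → unremoved d (Redex.glue-removed C.redex g) }

        R-name : ∀ {q} → q ∈ R.P-c → ν (new i q) (β.to q)
        R-name d = faithful (new (R-carrier d)) (Q.unglued (Q.new refl d))

        open RawNet (Q.quotient ν) using (cell; principal; label)

        cell⇒ : ∀ {m n} → X.cell m n ⊎ K.cell m n → cell m n
        cell⇒ (inj₁ s) = _ , _ , X-name (_ , s) , Q.old (C.cell⇒ s) (λ { refl → unremoved (_ , s) }) , X-name (X-codom s)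
        cell⇒ (inj₂ s) with _ , d , refl ← G.image-carrier (proj₁ (K.P-c⊆P (_ , s)))
                          | _ , e , refl ← G.image-carrier (proj₁ (K.P-c⊆P (K-codom s)))
          with s′ ← from (β.to-cell d e) s = _ , _ , R-name (_ , s′) , Q.new refl s′ , R-name (R-codom s′)

        cell⇐ : ∀ {m n} → cell m n → X.cell m n ⊎ K.cell m n
        cell⇐ (_ , _ , x , Q.old s ¬d , y) with s′ ← C.cell⇐ s (¬d refl)
          with refl ← N.func x (X-name (_ , s′)) | refl ← N.func y (X-name (X-codom s′)) = inj₁ s′
        cell⇐ (_ , _ , x , Q.new refl s , y)
          with refl ← N.func x (R-name (_ , s)) | refl ← N.func y (R-name (R-codom s)) =
          inj₂ (to (β.to-cell (R-carrier (_ , s)) (R-carrier (R-codom s))) s)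

        principal⇒ : ∀ {n} → X.principal n ⊎ K.principal n → principal n
        principal⇒ (inj₁ s) with d ← X.principal⊆P-c s =
          _ , X-name d , Q.old (C.principal⇒ s) λ { refl → unremoved d }
        principal⇒ (inj₂ s) with _ , d , refl ← G.image-carrier (proj₁ (K.P-c⊆P (K.principal⊆P-c s)))
          with s′ ← from (β.to-principal d) s = _ , R-name (R.principal⊆P-c s′) , Q.new refl s′

        principal⇐ : ∀ {n} → principal n → X.principal n ⊎ K.principal n
        principal⇐ (_ , x , Q.old s ¬d) with s′ ← C.principal⇐ s (¬d refl)
          with refl ← N.func x (X-name (X.principal⊆P-c s′)) = inj₁ s′
        principal⇐ (_ , x , Q.new refl s) with refl ← N.func x (R-name (R.principal⊆P-c s)) =
          inj₂ (to (β.to-principal (R-carrier (R.principal⊆P-c s))) s)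

        X-label : ∀ {x l} → X.label x l → x ∈ X.P-c
        X-label l = from (X.label-dom _) (_ , l)

        R-label : ∀ {x l} → R.label x l → x ∈ R.P-c
        R-label l = from (R.label-dom _) (_ , l)

        label⇒ : ∀ {n l} → X.label n l ⊎ K.label n l → label n l
        label⇒ (inj₁ s) with d ← X-label s = _ , X-name d , Q.old (C.label⇒ s) λ { refl → unremoved d }
        label⇒ (inj₂ s) with _ , d , refl ← G.image-carrier (proj₁ (K.P-c⊆P (from (K.label-dom _) (_ , s))))
          with s′ ← from (β.to-label d) s = _ , R-name (R-label s′) , Q.new refl s′

        label⇐ : ∀ {n l} → label n l → X.label n l ⊎ K.label n l
        label⇐ (_ , x , Q.old s ¬d) with s′ ← C.label⇐ s (¬d refl)
          with refl ← N.func x (X-name (X-label s′)) = inj₁ s′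
        label⇐ (_ , x , Q.new refl s) with refl ← N.func x (R-name (R-label s)) =
          inj₂ (to (β.to-label (R-carrier (R-label s))) s)

      -- Cell ports are unglued, so `faithful` alone settles cells, principal ports and labels; only
      -- the wires depend on the names of loops.
      glued-≈ : RawNet.wire glued-net ≗ᴳ Q.QuotientWire ν → glued-net ≈ Q.quotient ν
      glued-≈ wire-≈ = record
        { wire-≈      = wire-≈
        ; cell-≈      = cell⇒ , cell⇐
        ; principal-≈ = principal⇒ , principal⇐
        ; label-≈     = label⇒ , label⇐
        }

    private module T⁻ = Transport (flip-iso iso)

    module FromTarget where

      ν : REL Port ℕ 0ℓ
      ν = T⁻.transport G.canonical

      isNaming : Q.IsNaming ν
      isNaming = T⁻.transport-isNaming G.canonical-isNaming

      private
        faithful : ∀ {a x} → T a x → ¬ Q.Glued a → ν a x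
        faithful t ¬g = _ , t , G.chain (zero , refl) (¬g ∘ glued⇐ t) (WiringIso.wired (flip-iso iso) t) refl

      keeps : Keeps S ps i ν
      keeps d ¬r with _ , l ← C.onto d (¬r ∘ active-removed) with refl ← P.place-removed {S} C.redex C.unremoved l ¬r =
        faithful (old l) λ { (_ , Q.down refl g) → ¬r (Redex.glue-removed C.redex g) }

      quotient-≈ : glued-net ≈ Q.quotient ν
      quotient-≈ = glued-≈ isNaming faithful
        ( (λ w → T⁻.quotient⇒ G.canonical-isNaming (G.↭⇒quotient w))
        , (λ w → G.quotient⇒↭ (T⁻.quotient⇐ G.canonical-isNaming w)))

    -- A gluing dictates its names, so `ν` has to conform: an unglued port gives its own number to
    -- its chain, and a loop bears the least number on it. Carried to ℕ, these hypotheses say that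
    -- `ν` is normalised.
    module ToTarget {ν : REL Port ℕ 0ℓ} (isNaming : Q.IsNaming ν)
      (faithful : ∀ {a x} → T a x → ¬ Q.Glued a → ν a x)
      (closed-port : ∀ {a n} → ν a n → Q.Closed ν n → ∃ λ b → T b n × ν b n)
      (closed-min : ∀ {a n x} → ν a n → Q.Closed ν n → T a x → n ≤ x) where

      private
        ν′ : REL ℕ ℕ 0ℓ
        ν′ = transport ν

        isNaming′ : G.IsNaming ν′
        isNaming′ = transport-isNaming isNaming

        normalised : G.IsNormalised id ν′
        normalised = record
          { start-name  = λ w ¬g → let _ , t = WiringIso.onto iso w in _ , t , faithful t (¬g ∘ glued⇒ t)
          ; closed-name = λ (_ , t , x) cl → let _ , u , y = closed-port x (closed⇐ isNaming cl) in _ , refl , _ , u , y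
          ; closed-min  = λ (_ , t , x) cl → closed-min x (closed⇐ isNaming cl) t
          }

        canonical⇒ : ∀ {x n} → G.canonical x n → ν′ x n
        canonical⇒ = G.canonical⇒normalised isNaming′ normalised

        canonical⇐ : ∀ {x n} → ν′ x n → G.canonical x n
        canonical⇐ = G.normalised⇒canonical isNaming′ normalised

        wire⇒ : ∀ {m n} → G.QuotientWire G.canonical m n → G.QuotientWire ν′ m n
        wire⇒ (inj₁ (_ , _ , x , w , ¬g , y)) = inj₁ (_ , _ , canonical⇒ x , w , ¬g , canonical⇒ y)
        wire⇒ (inj₂ (e , (_ , x) , cl)) = inj₂ (e , (_ , canonical⇒ x) , λ y w → cl (canonical⇐ y) w)

        wire⇐ : ∀ {m n} → G.QuotientWire ν′ m n → G.QuotientWire G.canonical m n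
        wire⇐ (inj₁ (_ , _ , x , w , ¬g , y)) = inj₁ (_ , _ , canonical⇐ x , w , ¬g , canonical⇐ y)
        wire⇐ (inj₂ (e , (_ , x) , cl)) = inj₂ (e , (_ , canonical⇐ x) , λ y w → cl (canonical⇒ y) w)

      quotient-≈ : glued-net ≈ Q.quotient ν
      quotient-≈ = glued-≈ isNaming faithful
        ( (λ w → quotient⇐ isNaming (wire⇒ (G.↭⇒quotient w)))
        , (λ w → G.quotient⇒↭ (wire⇐ (quotient⇒ isNaming w))))

  -- Construction of a step

  module Construction {S S′ : Net} {ps : Bool → Patch} {i : Bool} (redex : Redex S (ps i))
    (reduct : Reduct S S′ ps i redex) where

    open Reduct reduct renaming (reduct-≈ to S′≈)
    open Patch (ps i)
    private
      module S = Net S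
      module S′ = Net S′
      module SW = WPermutation S.wire-isWPermutation
      module SW′ = WPermutation S′.wire-isWPermutation
      module RW = WPermutation R.wire-isWPermutation
      module redex = Redex redex
      module Q = Quotient (only-system {S} {ps} {i} redex)
      module N = Q.Naming isNaming
      module D = Deletion redex

      limit = bound (SW.ports ++ SW′.ports)

      M : ℕ
      M = proj₁ limit

      S<M : ∀ {x} → x ∈ S.carrier → x < M
      S<M d = proj₂ limit (∈-++⁺ˡ (SW.dom⇒port d))

      S′<M : ∀ {x} → x ∈ S′.carrier → x < M
      S′<M d = proj₂ limit (∈-++⁺ʳ SW.ports (SW′.dom⇒port d))

      name-S′ : ∀ {a n} → ν a n → n ∈ S′.carrier
      name-S′ x = _ , proj₂ (_≈_.wire-≈ S′≈) (proj₂ (N.quotient-dom x))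

    -- Numbers of redex ports are needed for the cell ports of the left-hand side and may recur in
    -- `S′`. The interface of the context is therefore shifted above `S` and `S′`, which also keeps
    -- it from being the minimum of a loop.
    δ : ℕ → ℕ
    δ x with removed? x
    ... | yes _ = M + x
    ... | no _  = x

    private
      δ-removed : ∀ {x} → Removed x → δ x ≡ M + x
      δ-removed {x} d with removed? x
      ... | yes _ = refl
      ... | no ¬d = contradiction d ¬d

      δ-unremoved : ∀ {x} → ¬ Removed x → δ x ≡ x
      δ-unremoved {x} ¬d with removed? x
      ... | yes d = contradiction d ¬d
      ... | no _  = refl

      δ-injective : ∀ {x y} → x ∈ S.carrier → y ∈ S.carrier → δ x ≡ δ y → x ≡ y
      δ-injective {x} {y} c d e with removed? x | removed? y
      ... | yes _ | yes _ = ℕ.+-cancelˡ-≡ M x y e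
      ... | yes _ | no _  = contradiction (subst (_< M) (sym e) (S<M d)) (ℕ.m+n≮m M x)
      ... | no _  | yes _ = contradiction (subst (_< M) e (S<M c)) (ℕ.m+n≮m M y)
      ... | no _  | no _  = e

      S-carrier : ∀ {x} → x ∈ Net.carrier D.net → x ∈ S.carrier
      S-carrier (_ , w , _) = _ , w

      module XI = Image D.net δ (λ c d → δ-injective (S-carrier c) (S-carrier d))

      J : List ℕ
      J = map (δ ∘ attach) I

      attach-carrier : ∀ {r} → r ∈ˡ I → attach r ∈ S.carrier
      attach-carrier = proj₁ ∘ redex.removed-P ∘ redex.attach-removed

      J-free : ∀ {x} → x ∈ˡ J → RawNet.P-f XI.raw x
      J-free m with r , m′ , refl ← ∈-map⁻ (δ ∘ attach) m
        with d ← redex.attach-removed m′ with (_ , w) , ¬w ← redex.removed-P d =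
        ((_ , _ , _ , (w , redex.attach-inactive m′) , refl , refl) ,
         λ (_ , _ , (v , _) , e , e′) → ¬w (subst₂ S.wire (δ-injective (_ , v) (_ , w) e)
                                                       (δ-injective (_ , SW.symmetric v) (_ , w) e′) v)) ,
        λ (_ , _ , _ , (s , ¬d) , e , _) →
          ¬d (subst Removed (sym (δ-injective (proj₁ (S.P-c⊆P (_ , s))) (_ , w) e)) d)

    X : Context
    X = record
      { net         = XI.image
      ; interface   = J
      ; isInterface = record
        { unique = unique-map (λ p q e → redex.attach-injective p q (δ-injective (attach-carrier p) (attach-carrier q) e))
                              (IsInterface.unique L.isInterface)
        ; free   = All.tabulate J-free
        }
      }

    private
      module X = Context X
      module XW = WPermutation X.wire-isWPermutation

      size : length J ≡ length I
      size = length-map (δ ∘ attach) I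

      removed-J : ∀ {x} → Removed x → ¬ Active x → δ x ∈ˡ J
      removed-J d ¬a with redex.removed-attach d
      ... | inj₁ a              = contradiction a ¬a
      ... | inj₂ (_ , m , refl) = ∈-map⁺ (δ ∘ attach) m

      place⇒ : ∀ {s} → s ∈ S.carrier → ¬ Active s → Place (ps i) X (δ s) s
      place⇒ {s} d@(_ , w) ¬a with removed? s
      ... | no ¬d = keep (_ , _ , _ , (w , ¬a) , δ-unremoved ¬d , refl) λ m →
        let r , m′ , e = ∈-map⁻ (δ ∘ attach) m in
        ℕ.m+n≮m M (attach r) (subst (_< M) (trans e (δ-removed (redex.attach-removed m′))) (S<M d))
      ... | yes r with redex.removed-attach r
      ...   | inj₁ a              = contradiction a ¬a
      ...   | inj₂ (u , m , refl) = subst (λ x → Place (ps i) X x (attach u)) (δ-removed r) (cut (zip-graph⁺ (δ ∘ attach) m))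

      place⇐ : ∀ {x s} → Place (ps i) X x s → x ≡ δ s × s ∈ S.carrier × ¬ Active s
      place⇐ (keep (_ , x , _ , (w , ¬a) , refl , _) ¬m) with removed? x
      ... | yes d = contradiction (subst (_∈ˡ J) (δ-removed d) (removed-J d ¬a)) ¬m
      ... | no ¬d = sym (δ-unremoved ¬d) , (_ , w) , ¬a
      place⇐ (cut m) with refl , m′ ← zip-graph⁻ (δ ∘ attach) I m =
        refl , attach-carrier m′ , redex.attach-inactive m′

      unremoved : ∀ {x} → x ∈ X.carrier → ¬ x ∈ˡ J → ¬ Removed x
      unremoved d ¬m r with e , c , ¬a ← place⇐ (keep d ¬m) = ¬m (subst (_∈ˡ J) (sym e) (removed-J r ¬a))

      stable : ∀ {x} → ¬ Removed x → ∀ {y} → δ x ≡ y → x ≡ y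
      stable ¬d e = trans (sym (δ-unremoved ¬d)) e

      cell⇒ : ∀ {x y} → X.cell x y → S.cell x y
      cell⇒ (_ , _ , (s , ¬d) , e , e′) = subst₂ S.cell (stable ¬d e)
        (stable (λ { (t , i , refl) → ¬d (redex.cell-to i s) }) e′) s

      cell⇐ : ∀ {x y} → S.cell x y → ¬ Removed x → X.cell x y
      cell⇐ s ¬d = _ , _ , (s , ¬d) , δ-unremoved ¬d , δ-unremoved λ { (t , i , refl) → ¬d (redex.cell-to i s) }

    isCut : IsCut S (ps i) X
    isCut = record
      { redex      = redex
      ; size       = size
      ; unremoved  = unremoved
      ; onto       = λ d ¬a → _ , place⇒ d ¬a
      ; wire⇒      = λ l r (_ , _ , (w , _) , e , e′) →
                       let f , c , _ = place⇐ l ; g , d , _ = place⇐ r in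
                       subst₂ S.wire (δ-injective (_ , w) c (trans e f)) (δ-injective (_ , SW.symmetric w) d (trans e′ g)) w
      ; wire⇐      = λ l r w → let f , _ , ¬a = place⇐ l ; g , _ , _ = place⇐ r in
                       _ , _ , (w , ¬a) , sym f , sym g
      ; cell⇒      = cell⇒
      ; cell⇐      = cell⇐
      ; principal⇒ = λ (_ , (x , ¬d) , e) → subst S.principal (stable ¬d e) x
      ; principal⇐ = λ x ¬d → _ , (x , ¬d) , δ-unremoved ¬d
      ; label⇒     = λ (_ , (x , ¬d) , e) → subst (λ y → S.label y _) (stable ¬d e) x
      ; label⇐     = λ x ¬d → _ , (x , ¬d) , δ-unremoved ¬d
      }

    private
      limit′ = bound (XW.ports ++ SW.ports ++ SW′.ports)

      M′ : ℕ
      M′ = proj₁ limit′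

      X<M′ : ∀ {x} → x ∈ X.carrier → x < M′
      X<M′ d = proj₂ limit′ (∈-++⁺ˡ (XW.dom⇒port d))

      S<M′ : ∀ {x} → x ∈ S.carrier → x < M′
      S<M′ d = proj₂ limit′ (∈-++⁺ʳ XW.ports (∈-++⁺ˡ (SW.dom⇒port d)))

      S′<M′ : ∀ {x} → x ∈ S′.carrier → x < M′
      S′<M′ d = proj₂ limit′ (∈-++⁺ʳ XW.ports (∈-++⁺ʳ SW.ports (SW′.dom⇒port d)))

      X-port : ∀ {x} → x ∈ X.carrier → (x ∈ S.carrier × ¬ Removed x) ⊎ ∃ λ y → x ≡ M + y
      X-port (_ , s , _ , (w , _) , refl , _) with removed? s
      ... | yes _ = inj₂ (_ , refl)
      ... | no ¬d = inj₁ ((_ , w) , ¬d)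

    -- Cell ports have to appear in `S` where `ι` puts them. The interface ports are hidden by the
    -- gluing, so any numbers clear of `X` and `S` will do.
    placement : ℕ → ℕ
    placement t with inner? t
    ... | yes _ = ι t
    ... | no _  = M′ + t

    private
      placement≡ι : ∀ {t} → Inner t → placement t ≡ ι t
      placement≡ι {t} i with inner? t
      ... | yes _ = refl
      ... | no ¬i = contradiction i ¬i

      ι-S : ∀ {t} → Inner t → ι t ∈ S.carrier
      ι-S i = proj₁ (redex.removed-P (_ , i , refl))

      placement-injective : ∀ {t u} → placement t ≡ placement u → t ≡ u
      placement-injective {t} {u} e with inner? t | inner? u
      ... | yes i | yes j = redex.ι-injective i j e
      ... | yes i | no _  = contradiction (subst (_< M′) e (S<M′ (ι-S i))) (ℕ.m+n≮m M′ u)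
      ... | no _  | yes j = contradiction (subst (_< M′) (sym e) (S<M′ (ι-S j))) (ℕ.m+n≮m M′ t)
      ... | no _  | no _  = ℕ.+-cancelˡ-≡ M′ t u e

      module LI = Image (Context.net R-r) placement (λ _ _ → placement-injective)

      L-disjoint : Disjoint X.carrier (Net.carrier LI.image)
      L-disjoint c (_ , t , _ , _ , e , _) with inner? t
      ... | no _  = ℕ.m+n≮m M′ t (subst (_< M′) (sym e) (X<M′ c))
      ... | yes i with X-port c
      ...   | inj₁ (_ , ¬d)   = ¬d (t , i , sym e)
      ...   | inj₂ (y , refl) = ℕ.m+n≮m M y (subst (_< M) e (S<M (ι-S i)))

      source : GluesTo S.raw X.raw J LI.raw (map placement I)
      source = Source.ToSource.glues {ps i} X LI.image LI.isRenaming placement≡ι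
        (trans size (sym (length-map placement I))) L-disjoint {S} isCut

    -- Of the interface ports of the right-hand side on one loop, exactly one may carry the name of
    -- the loop. Taking the least makes the choice unique and computable.
    data Visible (q n : ℕ) : Set where
      interior       : ¬ q ∈ˡ R.interface → Visible q n
      representative : q ∈ˡ R.interface → Q.Closed ν n →
                       (∀ {u} → u ∈ˡ R.interface → ν (new i u) n → q ≤ u) → Visible q n

    -- A port of the right-hand side keeps its name in S′; an interface port has
    -- one only if it represents a loop, and is otherwise given a fresh name,
    -- above those of all loops.
    data Place′ (q : ℕ) : ℕ → Set where
      visible : ∀ {n} → ν (new i q) n → Visible q n → Place′ q n
      hidden  : ∀ {n} → q ∈ˡ R.interface → ν (new i q) n → ¬ Visible q n → Place′ q (M′ + q)

    private
      named? : ∀ n q → Dec (ν (new i q) n)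
      named? n q with q ∈? RW.ports
      ... | no ¬m = no λ x → ¬m (port (N.wired x))
        where
        port : ∃ (Q.Wire (new i q)) → q ∈ˡ RW.ports
        port (_ , Q.new _ w) = RW.dom⇒port (_ , w)
      ... | yes m with l , x ← N.total (_ , Q.new refl (proj₂ (RW.port⇒dom m))) =
        map′ (λ { refl → x }) (N.func x) (l ≟ n)

      R-carrier : ∀ {q} → q ∈ˡ R.interface → q ∈ R.carrier
      R-carrier m = proj₁ (proj₁ (All.lookup (IsInterface.free R.isInterface) m))

      closed? : ∀ {a n} → ν a n → Dec (Q.Closed ν n)
      closed? x with Q.exits⊎cyclic (N.wired x)
      ... | inj₂ c = yes (N.cyclic⇒closed x c)
      ... | inj₁ (_ , _ , r , w , ¬g) = no λ cl → ¬g (cl (N.follows-↝ r x) w)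

      interface-glued : ∀ {q} → q ∈ˡ R.interface → Q.Glued (new i q)
      interface-glued m with s , g ← zip-onto (map attach I) R.interface (trans (length-map attach I) same-size) m =
        _ , Q.up refl g

      removed-glued : ∀ {s} → Removed s → ¬ Active s → Q.Glued (old s)
      removed-glued d ¬a with redex.removed-glued d
      ... | inj₁ a       = contradiction a ¬a
      ... | inj₂ (_ , g) = _ , Q.down refl g

      glued-removed : ∀ {s} → Q.Glued (old s) → Removed s
      glued-removed (_ , Q.down refl g) = redex.glue-removed g

      -- A loop must cross the right-hand side: a port of `S` on it is wired to a glued port of `S`,
      -- so its next port belongs to the interface of the right-hand side.
      loop-port : ∀ {a n} → ν a n → Q.Closed ν n → ∃ λ q → q ∈ˡ R.interface × ν (new i q) n
      loop-port {new _ q} x cl with _ , Q.up refl g ← N.closed-start x cl = q , zip-∈ʳ (map attach I) g , x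
      loop-port {old s} x cl with _ , w@(Q.old _ _) ← N.wired x with _ , g@(Q.down refl h) ← cl x w =
        _ , zip-∈ʳ (map attach I) h , N.follows (_ , w , g) x

      loop-representative : ∀ {a n} → ν a n → Q.Closed ν n → ∃ λ q → q ∈ˡ R.interface × ν (new i q) n ×
                            (∀ {u} → u ∈ˡ R.interface → ν (new i u) n → q ≤ u)
      loop-representative {n = n} x cl with q , m , y ← loop-port x cl =
        least (named? n) R.interface (lose m y)

      visible? : ∀ {q n} → ν (new i q) n → Dec (Visible q n)
      visible? {q} x with q ∈? R.interface
      ... | no ¬m = yes (interior ¬m)
      ... | yes m with closed? x
      ...   | no ¬c = no λ { (interior ¬m) → ¬m m ; (representative _ c _) → ¬c c }
      ...   | yes c with r , k , z , min ← loop-representative x c with r ≟ q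
      ...     | yes refl = yes (representative m c min)
      ...     | no r≢q   = no λ { (interior ¬m) → ¬m m
                                 ; (representative _ _ min′) → r≢q (ℕ.≤-antisym (min m x) (min′ k z)) }

      interior-unglued : ∀ {q} → ¬ q ∈ˡ R.interface → ¬ Q.Glued (new i q)
      interior-unglued ¬m (_ , Q.up _ g) = ¬m (zip-∈ʳ (map attach I) g)

      visible-injective : ∀ {q u n} → ν (new i q) n → ν (new i u) n → Visible q n → Visible u n → q ≡ u
      visible-injective x y (interior ¬m) (interior ¬k) with refl ← N.starts-≡ x y (interior-unglued ¬m) (interior-unglued ¬k) = refl
      visible-injective x y (representative m _ min) (representative k _ min′) = ℕ.≤-antisym (min k y) (min′ m x)
      visible-injective x y (interior ¬m) (representative k cl _) =
        contradiction (N.closed-start x cl) (interior-unglued ¬m)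
      visible-injective x y (representative k cl _) (interior ¬m) =
        contradiction (N.closed-start y cl) (interior-unglued ¬m)

      choose : ∀ q → ∃ λ x → q ∈ R.carrier → Place′ q x
      choose q with q ∈? RW.ports
      ... | no ¬m = q , λ d → contradiction (RW.dom⇒port d) ¬m
      ... | yes m with n , x ← N.total (_ , Q.new refl (proj₂ (RW.port⇒dom m))) with visible? x | q ∈? R.interface
      ...   | yes v | _     = n , λ _ → visible x v
      ...   | no ¬v | yes k = M′ + q , λ _ → hidden k x ¬v
      ...   | no ¬v | no ¬k = contradiction (interior ¬k) ¬v

    placement′ : ℕ → ℕ
    placement′ q = proj₁ (choose q)

    private
      place′ : ∀ {q} → q ∈ R.carrier → Place′ q (placement′ q)
      place′ {q} = proj₂ (choose q)

      place′-injective : ∀ {q u x y} → Place′ q x → Place′ u y → x ≡ y → q ≡ u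
      place′-injective (visible x v)    (visible y w)    refl = visible-injective x y v w
      place′-injective (visible x _)    (hidden _ _ _)   refl = contradiction (S′<M′ (name-S′ x)) (ℕ.m+n≮m M′ _)
      place′-injective (hidden _ _ _)   (visible y _)    refl = contradiction (S′<M′ (name-S′ y)) (ℕ.m+n≮m M′ _)
      place′-injective (hidden _ _ _)   (hidden _ _ _)   e    = ℕ.+-cancelˡ-≡ M′ _ _ e

      module RI = Image (Context.net R-p) placement′ (λ c d → place′-injective (place′ c) (place′ d))

      -- A visible name `x` is below the shifted interface of `X`. If it is also a kept port of `S`,
      -- then `old x` has this name too: on a loop it would be glued and hence removed, and on a
      -- chain it would be a second start.
      R-disjoint : Disjoint X.carrier (Net.carrier RI.image)
      R-disjoint c (_ , q , _ , w , e , _) = apart (place′ (_ , w)) c (sym e)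
        where
        apart : ∀ {x y} → Place′ q y → x ∈ X.carrier → x ≢ y
        apart (hidden _ _ _) c refl = ℕ.m+n≮m M′ q (X<M′ c)
        apart (visible x v) c refl with X-port c
        ... | inj₂ (y , refl) = ℕ.m+n≮m M y (S′<M (name-S′ x))
        ... | inj₁ (d , ¬r) with y ← keeps d ¬r with v
        ...   | representative _ cl _ = ¬r (glued-removed (N.closed-start y cl))
        ...   | interior ¬m with () ← N.starts-≡ x y (interior-unglued ¬m) (¬r ∘ glued-removed)

      size′ : length J ≡ length (map placement′ R.interface)
      size′ = trans size (trans same-size (sym (length-map placement′ R.interface)))

      T : REL Port ℕ 0ℓ
      T = Target.T {S} {ps} {i} {X} isCut RI.image RI.isRenaming size′ R-disjoint

      faithful : ∀ {a x} → T a x → ¬ Q.Glued a → ν a x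
      faithful (Target.old l) ¬g with refl , d , ¬a ← place⇐ l =
        subst (ν _) (sym (δ-unremoved ¬r)) (keeps d ¬r)
        where
        ¬r = λ r → ¬g (removed-glued r ¬a)
      faithful (Target.new {q} d) ¬g = named (place′ d)
        where
        named : ∀ {x} → Place′ q x → ν (new i q) x
        named (visible x _)  = x
        named (hidden m _ _) = contradiction (interface-glued m) ¬g

      shown : ∀ {q n x} → ν (new i q) n → Visible q n → Place′ q x → x ≡ n
      shown y v (visible x _)    = N.func x y
      shown y v (hidden _ x ¬v) = contradiction (subst (Visible _) (N.func y x) v) ¬v

      T-new : ∀ {q n} → q ∈ R.carrier → placement′ q ≡ n → T (new i q) n
      T-new d refl = Target.new d

      closed-port : ∀ {a n} → ν a n → Q.Closed ν n → ∃ λ b → T b n × ν b n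
      closed-port x cl = let q , m , y , min = loop-representative x cl in
        new i q , T-new (R-carrier m) (shown y (representative m cl min) (place′ (R-carrier m))) , y

      -- Apart from its representative, every port of a loop was sent above all ports of `S′`: redex
      -- ports by `δ`, the other interface ports of the right-hand side as `hidden`.
      closed-min : ∀ {a n x} → ν a n → Q.Closed ν n → T a x → n ≤ x
      closed-min x cl (Target.old l) with refl , d , ¬a ← place⇐ l =
        subst (_ ≤_) (sym (δ-removed (glued-removed (N.closed-start x cl))))
              (ℕ.≤-trans (ℕ.<⇒≤ (S′<M (name-S′ x))) (ℕ.m≤m+n M _))
      closed-min x cl (Target.new {q} d) = above (place′ d)
        where
        above : ∀ {y} → Place′ q y → _ ≤ y
        above (visible y _)  = ℕ.≤-reflexive (N.func x y)
        above (hidden _ _ _) = ℕ.≤-trans (ℕ.<⇒≤ (S′<M′ (name-S′ x))) (ℕ.m≤m+n M′ q)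

      target : GluesTo S′.raw X.raw J RI.raw (map placement′ R.interface)
      target = record
        { same-size = size′
        ; disjoint  = R-disjoint
        ; glued     = ≈-trans S′≈ (≈-sym (Target.ToTarget.quotient-≈ {S} {ps} {i} {X} isCut RI.image RI.isRenaming size′ R-disjoint
                        isNaming faithful closed-port closed-min))
        }

    step : S ⟶⟨ 𝓡 ⟩ S′
    step = record
      { X      = X
      ; αR     = LI.image
      ; βR     = RI.image
      ; α      = LI.isRenaming
      ; β      = RI.isRenaming
      ; source = source
      ; target = target
      }

  -- The diamond

  patch : ∀ {s₁ s₂} {𝓡 : Rule s₁ s₂} {S S′} → S ⟶⟨ 𝓡 ⟩ S′ → Patch
  patch {𝓡 = 𝓡} r = record { 𝓡 = 𝓡 ; ι = Renaming.to (_⟶⟨_⟩_.α r) }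

  step-cut : ∀ {s₁ s₂} {𝓡 : Rule s₁ s₂} {S S′} (r : S ⟶⟨ 𝓡 ⟩ S′) → IsCut S (patch r) (_⟶⟨_⟩_.X r)
  step-cut {S = S} r = Source.FromSource.isCut {patch r} X αR α (λ _ → refl)
    (GluesTo.same-size source) (GluesTo.disjoint source) {S} (GluesTo.glued source)
    where open _⟶⟨_⟩_ r

  reduct : ∀ {S S′} ps i {X} (isCut : IsCut S (ps i) X) (K : Net)
           (β : Renaming (Context.raw (Patch.R-p (ps i))) (Net.raw K)) →
           GluesTo (Net.raw S′) (Context.raw X) (Context.interface X) (Net.raw K)
                   (map (Renaming.to β) (Context.interface (Patch.R-p (ps i)))) →
           Reduct S S′ ps i (IsCut.redex isCut)
  reduct {S} ps i {X} isCut K β t = record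
    { ν        = FromTarget.ν {S} {ps} {i} {X} isCut K β size disjoint
    ; isNaming = FromTarget.isNaming {S} {ps} {i} {X} isCut K β size disjoint
    ; keeps    = FromTarget.keeps {S} {ps} {i} {X} isCut K β size disjoint
    ; reduct-≈ = ≈-trans (GluesTo.glued t) (FromTarget.quotient-≈ {S} {ps} {i} {X} isCut K β size disjoint)
    }
    where
    module FromTarget = Target.FromTarget
    size     = GluesTo.same-size t
    disjoint = GluesTo.disjoint t

  module _ {S : Net} where

    private
      module S = Net S
      module SW = WPermutation S.wire-isWPermutation

    removed-orbit : ∀ {p x y} → Redex S p → Patch.Removed p x → y ∈ Orbit S.cell x → Patch.Removed p y
    removed-orbit redex d (zero  , refl) = d
    removed-orbit redex d (suc n , _ , o , s) with t , i , refl ← removed-orbit redex d (n , o) =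
      Redex.cell-from redex i s

    -- Principal ports are preserved and reflected by `ι`, and a left-hand side has no others than
    -- `b` and `c`.
    removed-principal : ∀ {p x} → Redex S p → Patch.Removed p x → S.principal x → Patch.Active p x
    removed-principal {p} redex (t , i , refl) x with to (Patch.r-principal p t) (Redex.principal⇐ redex i x)
    ... | inj₁ refl = inj₁ refl
    ... | inj₂ refl = inj₂ refl

    -- Two redexes that share a cell share its principal port, hence the wire
    -- between their principal ports, hence both cells.
    redexes-disjoint : ∀ {p q} → Redex S p → Redex S q →
      ¬ SamePair (Orbit S.cell (Patch.ι p (Patch.b p)) , Orbit S.cell (Patch.ι p (Patch.c p)))
                 (Orbit S.cell (Patch.ι q (Patch.b q)) , Orbit S.cell (Patch.ι q (Patch.c q))) →
      ∀ {x} → Patch.Removed p x → ¬ Patch.Removed q x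
    redexes-disjoint {p} {q} r s distinct d e
      with z , o , x ← S.principal-exists (Redex.removed-P-c r d) =
      same (removed-principal r (removed-orbit r d o) x) (removed-principal s (removed-orbit s e o) x)
      where
      module p = Patch p
      module q = Patch q

      orbits : ∀ {x y} → x ≡ y → Orbit S.cell x ≐ Orbit S.cell y
      orbits refl = id , id

      same : ∀ {z} → p.Active z → q.Active z → ⊥
      same (inj₁ refl) (inj₁ e) = distinct (inj₁ (orbits e , orbits
        (SW.functional (subst (λ z → S.wire z _) e (Redex.wire-b-c r)) (Redex.wire-b-c s))))
      same (inj₁ refl) (inj₂ e) = distinct (inj₂ (orbits e , orbits
        (SW.functional (subst (λ z → S.wire z _) e (Redex.wire-b-c r)) (SW.symmetric (Redex.wire-b-c s)))))
      same (inj₂ refl) (inj₁ e) = distinct (inj₂ (orbits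
        (SW.functional (subst (λ z → S.wire z _) e (SW.symmetric (Redex.wire-b-c r))) (Redex.wire-b-c s)) , orbits e))
      same (inj₂ refl) (inj₂ e) = distinct (inj₁ (orbits
        (SW.functional (subst (λ z → S.wire z _) e (SW.symmetric (Redex.wire-b-c r))) (SW.symmetric (Redex.wire-b-c s))) , orbits e))

  diamond : ∀ {R : Net} {ps : Bool → Patch} (N : Bool → Net) (redex : ∀ i → Redex R (ps i)) →
            (∀ {x} → Patch.Removed (ps true) x → ¬ Patch.Removed (ps false) x) →
            (∀ i → Reduct R (N i) ps i (redex i)) →
            (∀ x → x ∈ Net.carrier (N true) → x ∈ Net.carrier (N false) → x ∈ Net.carrier R) →
            ∃ λ R′ → N true ⟶⟨ Patch.𝓡 (ps false) ⟩ R′ × N false ⟶⟨ Patch.𝓡 (ps true) ⟩ R′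
  diamond {R} {ps} N redex disjoint reducts fresh =
    JointNaming.joint-net both N reducts fresh ,
    Construction.step {ps = ps} {i = false} _ (JointNaming.reduct-true both N reducts fresh) ,
    Construction.step {ps = ps} {i = true} _ (JointNaming.reduct-false both N reducts fresh)
    where
    both : IsSystem R Both ps
    both = record
      { act?     = λ _ → yes tt
      ; redex    = λ {i} _ → redex i
      ; disjoint = λ { {true} {true} _ _ _ _ → refl ; {false} {false} _ _ _ _ → refl
                     ; {true} {false} _ _ d e → contradiction e (disjoint d)
                     ; {false} {true} _ _ d e → contradiction d (disjoint e) }
      }

proposition5p3 : (𝕊 : Signature) → let open Nets 𝕊 in
    {s₁ s₂ t₁ t₂ : Symbol} (𝓡₁ : Rule s₁ s₂) (𝓡₂ : Rule t₁ t₂)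
    (R R₁ R₂ : Net) (r₁ : R ⟶⟨ 𝓡₁ ⟩ R₁) (r₂ : R ⟶⟨ 𝓡₂ ⟩ R₂) →
    DistinctRedexes r₁ r₂ →
    (∀ x → x ∈ Net.carrier R₁ → x ∈ Net.carrier R₂ → x ∈ Net.carrier R) →
    ∃ λ (R′ : Net) → (R₁ ⟶⟨ 𝓡₂ ⟩ R′) × (R₂ ⟶⟨ 𝓡₁ ⟩ R′)
proposition5p3 𝕊 𝓡₁ 𝓡₂ R R₁ R₂ r₁ r₂ distinct fresh = diamond {R} {ps} N (λ i → IsCut.redex (isCut i))
  (redexes-disjoint {R} (IsCut.redex (isCut true)) (IsCut.redex (isCut false)) distinct) reducts fresh
  where
  open Nets 𝕊
  open Reduction 𝕊

  ps : Bool → Patch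
  ps true  = patch r₁
  ps false = patch r₂

  N : Bool → Net
  N true  = R₁
  N false = R₂

  X : Bool → Context
  X true  = _⟶⟨_⟩_.X r₁
  X false = _⟶⟨_⟩_.X r₂

  isCut : ∀ i → IsCut R (ps i) (X i)
  isCut true  = step-cut r₁
  isCut false = step-cut r₂

  reducts : ∀ i → Reduct R (N i) ps i (IsCut.redex (isCut i))
  reducts true  = reduct {S′ = R₁} ps true (isCut true) (_⟶⟨_⟩_.βR r₁) (_⟶⟨_⟩_.β r₁) (_⟶⟨_⟩_.target r₁)
  reducts false = reduct {S′ = R₂} ps false (isCut false) (_⟶⟨_⟩_.βR r₂) (_⟶⟨_⟩_.β r₂) (_⟶⟨_⟩_.target r₂)
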